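{- Let $M$ be a real symmetric matrix indexed by a finite set $V$ and suppose distinct $a,b\in V$ are strongly cospectral for $M$ with common eigenvalue support \[ \{a_0-b_0\sqrt\Delta,\ a_0,\ a_0+b_0\sqrt\Delta\},\qquad a_0,b_0\in\mathbb Q,\quad b_0>0, \] where $\Delta>1$ is a square-free integer. Suppose the signs at the two outer values $a_0\pm b_0\sqrt\Delta$ agree and are opposite to the sign at $a_0$. Then \[ \mathcal K(M;a,b)=\begin{cases}\mathbb N^+,&a_0=0,\\ \{1\},&a_0\neq0.\end{cases} \] In the second case the minimum positive transfer time (under $M$) is $\pi/(b_0\sqrt\Delta)$.
   Context: $\mathbb N^+=\{1,2,3,\ldots\}$. $e_v$ denotes the standard basis vector indexed by $v\in V$. For a real symmetric matrix $M$ with spectral decomposition $M=\sum_{\lambda\in\operatorname{Spec}(M)}\lambda E_\lambda$ ($E_\lambda$ the orthogonal projection onto the $\lambda$-eigenspace), put $\operatorname{supp}_M(x)=\{\lambda\in\operatorname{Spec}(M):E_\lambda x\neq 0\}$. Elements $a,b$ of $V$ are strongly cospectral for $M$ if $\operatorname{supp}_M(e_a)=\operatorname{supp}_M(e_b)$ (the common eigenvalue support) and for each $\lambda$ in it $E_\lambda e_b=\sigma_\lambda E_\lambda e_a$ with $\sigma_\lambda\in\{1,-1\}$; $\sigma_\lambda$ is the sign at $\lambda$. A real symmetric matrix $K$ has perfect state transfer (PST) from $a$ to $b$ at time $\tau>0$ (a transfer time) if $\exp(-\mathrm i\tau K)e_a=\gamma e_b$ for some $\gamma\in\mathbb C$ with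 $|\gamma|=1$; it has PST from $a$ to $b$ if this holds for some $\tau>0$. $\mathcal K(M;a,b)=\{k\in\mathbb N^+:M^k\text{ has PST from }a\text{ to }b\}$. -}

module Defs where

open import Algebra.Bundles using (CommutativeRing; RawRing; Semiring)
open import Data.Bool.Base using (if_then_else_)
open import Data.Fin.Base using (Fin; toℕ)
open import Data.Fin.Properties using (_≟_)
open import Data.Integer.Base using (ℤ; +_; -[1+_])
open import Data.Nat.Base as ℕ using (ℕ; zero; suc; _!)
open import Data.Nat.Divisibility using (_∣_)
open import Data.Product.Base using (∃-syntax; _×_)
open import Data.Rational.Base using (ℚ; ↥_; ↧ₙ_)
open import Data.Sign.Base as Sign using (Sign)
open import Data.Sum.Base using (_⊎_)
open import Data.Vec.Functional using (Vector)
open import Function.Bundles using (_⇔_)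
open import Level using (Level; _⊔_) renaming (suc to lsuc)
open import Relation.Binary.Core using (Rel)
open import Relation.Binary.PropositionalEquality.Core using (_≡_)
open import Relation.Binary.Structures using (IsStrictTotalOrder)
open import Relation.Nullary.Decidable.Core using (does)
open import Relation.Nullary.Negation.Core using (¬_)
open import Relation.Unary using (Pred; _≐_)
import Algebra.Definitions.RawSemiring as RawSemiringDefs

SquareFree : ℕ → Set
SquareFree n = ∀ d → d ℕ.* d ∣ n → d ≡ 1

ℕ⁺ : Pred ℕ Level.zero
ℕ⁺ k = 1 ℕ.≤ k

------------------------------------------------------------------------
-- The real numbers, as an Archimedean Cauchy-complete ordered field.
-- Classically such a field is unique up to unique isomorphism.  Being a
-- classical field, it has a trichotomous (hence decidable) order.

record RealField (c ℓ₁ ℓ₂ : Level) : Set (lsuc (c ⊔ ℓ₁ ⊔ ℓ₂)) where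
  infix 8 _⁻¹
  infix 4 _<_ _≤_
  field
    commutativeRing : CommutativeRing c ℓ₁

  open CommutativeRing commutativeRing public
  open RawSemiringDefs (Semiring.rawSemiring semiring) public
    using (sum; _^_) renaming (_×_ to _·ℕ_)

  -- The value of 0# ⁻¹ is left unspecified.
  field
    0≉1                : ¬ (0# ≈ 1#)
    _⁻¹                : Carrier → Carrier
    ⁻¹-cong            : ∀ {x y} → x ≈ y → x ⁻¹ ≈ y ⁻¹
    ⁻¹-inverseʳ        : ∀ {x} → ¬ (x ≈ 0#) → x * x ⁻¹ ≈ 1#
    _<_                : Rel Carrier ℓ₂
    isStrictTotalOrder : IsStrictTotalOrder _≈_ _<_
    +-monoʳ-<          : ∀ {x y} z → x < y → z + x < z + y
    *-pos              : ∀ {x y} → 0# < x → 0# < y → 0# < x * y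

  _≤_ : Rel Carrier (ℓ₁ ⊔ ℓ₂)
  x ≤ y = x < y ⊎ x ≈ y

  Within : Carrier → Carrier → Carrier → Set ℓ₂
  Within ε x y = (x < y + ε) × (y < x + ε)

  IsLimit : (ℕ → Carrier) → Carrier → Set (c ⊔ ℓ₂)
  IsLimit s l = ∀ ε → 0# < ε → ∃[ N ] (∀ n → N ℕ.≤ n → Within ε (s n) l)

  IsCauchy : (ℕ → Carrier) → Set (c ⊔ ℓ₂)
  IsCauchy s = ∀ ε → 0# < ε →
    ∃[ N ] (∀ m n → N ℕ.≤ m → N ℕ.≤ n → Within ε (s m) (s n))

  field
    archimedean : ∀ x → ∃[ n ] x < n ·ℕ 1#
    complete    : ∀ s → IsCauchy s → ∃[ l ] IsLimit s l

  fromℕ : ℕ → Carrier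
  fromℕ n = n ·ℕ 1#

  fromℤ : ℤ → Carrier
  fromℤ (+ n)    = fromℕ n
  fromℤ -[1+ n ] = - fromℕ (suc n)

  fromℚ : ℚ → Carrier
  fromℚ q = fromℤ (↥ q) * fromℕ (↧ₙ q) ⁻¹

------------------------------------------------------------------------

module Matrices {c ℓ} (R : RawRing c ℓ) where
  open RawRing R
  open RawSemiringDefs rawSemiring using (sum)

  Matrix : ℕ → Set c
  Matrix n = Fin n → Fin n → Carrier

  infix 4 _≈ᵛ_ _≈ᴹ_
  infixl 7 _*ᴹ_ _*ᵛ_
  infixr 8 _^ᴹ_

  _≈ᵛ_ : ∀ {n} → Vector Carrier n → Vector Carrier n → Set ℓ
  x ≈ᵛ y = ∀ i → x i ≈ y i

  _≈ᴹ_ : ∀ {n} → Matrix n → Matrix n → Set ℓ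
  A ≈ᴹ B = ∀ i j → A i j ≈ B i j

  0ᵛ : ∀ {n} → Vector Carrier n
  0ᵛ _ = 0#

  e : ∀ {n} → Fin n → Vector Carrier n
  e v i = if does (i ≟ v) then 1# else 0#

  1ᴹ : ∀ {n} → Matrix n
  1ᴹ i j = e j i

  _*ᴹ_ : ∀ {n} → Matrix n → Matrix n → Matrix n
  (A *ᴹ B) i j = sum λ k → A i k * B k j

  _*ᵛ_ : ∀ {n} → Matrix n → Vector Carrier n → Vector Carrier n
  (A *ᵛ x) i = sum λ k → A i k * x k

  _^ᴹ_ : ∀ {n} → Matrix n → ℕ → Matrix n
  A ^ᴹ zero  = 1ᴹ
  A ^ᴹ suc k = A *ᴹ A ^ᴹ k

------------------------------------------------------------------------

module Real {c ℓ₁ ℓ₂} (ℝ : RealField c ℓ₁ ℓ₂) where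
  open RealField ℝ hiding (zero) public

  IsLeast : ∀ {ℓ} → Pred Carrier ℓ → Carrier → Set (c ⊔ ℓ₁ ⊔ ℓ₂ ⊔ ℓ)
  IsLeast P x = P x × (∀ y → P y → x ≤ y)

  IsSqrt : Carrier → Carrier → Set (ℓ₁ ⊔ ℓ₂)
  IsSqrt x s = (0# ≤ s) × (s * s ≈ x)

  series : (ℕ → Carrier) → ℕ → Carrier
  series t N = sum {N} λ n → t (toℕ n)

  cosTerm : Carrier → ℕ → Carrier
  cosTerm x n = (- 1#) ^ n * x ^ (2 ℕ.* n) * fromℕ ((2 ℕ.* n) !) ⁻¹

  IsCos : Carrier → Carrier → Set (c ⊔ ℓ₂)
  IsCos x y = IsLimit (series (cosTerm x)) y

  -- π / 2 is the least positive zero of the cosine.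
  IsPi : Carrier → Set (c ⊔ ℓ₁ ⊔ ℓ₂)
  IsPi p = ∃[ h ] IsLeast (λ t → (0# < t) × IsCos t 0#) h × (p ≈ h + h)

  record ℂ : Set c where
    constructor _+i_
    field
      re im : Carrier
  open ℂ public

  ℂ-rawRing : RawRing c ℓ₁
  ℂ-rawRing = record
    { Carrier = ℂ
    ; _≈_     = λ z w → (re z ≈ re w) × (im z ≈ im w)
    ; _+_     = λ z w → (re z + re w) +i (im z + im w)
    ; _*_     = λ z w → (re z * re w - im z * im w) +i (re z * im w + im z * re w)
    ; -_      = λ z → (- re z) +i (- im z)
    ; 0#      = 0# +i 0#
    ; 1#      = 1# +i 0#
    }

  module ℂ-Ring = RawRing ℂ-rawRing

  -- |γ| = 1, in the form |γ|² = 1.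
  IsUnimodular : ℂ → Set ℓ₁
  IsUnimodular γ = re γ * re γ + im γ * im γ ≈ 1#

  open Matrices rawRing public
  module ℂM = Matrices ℂ-rawRing

  expTerm : ∀ {n} → ℂM.Matrix n → ℕ → ℂM.Matrix n
  expTerm A k i j = ((fromℕ (k !) ⁻¹) +i 0#) ℂ-Ring.* (A ℂM.^ᴹ k) i j

  -- X = exp A: the partial sums of ∑ₖ Aᵏ / k! converge to X entrywise, in
  -- both the real and the imaginary part.
  IsExp : ∀ {n} → ℂM.Matrix n → ℂM.Matrix n → Set (c ⊔ ℓ₂)
  IsExp A X = ∀ i j →
    IsLimit (series λ k → re (expTerm A k i j)) (re (X i j)) ×
    IsLimit (series λ k → im (expTerm A k i j)) (im (X i j))

  ⟨_,_⟩ : ∀ {n} → Vector Carrier n → Vector Carrier n → Carrier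
  ⟨ x , y ⟩ = sum λ i → x i * y i

  Symmetric : ∀ {n} → Matrix n → Set ℓ₁
  Symmetric M = ∀ i j → M i j ≈ M j i

  Eigenspace : ∀ {n} → Matrix n → Carrier → Pred (Vector Carrier n) ℓ₁
  Eigenspace M l x = M *ᵛ x ≈ᵛ λ i → l * x i

  Spec : ∀ {n} → Matrix n → Pred Carrier (c ⊔ ℓ₁)
  Spec M l = ∃[ x ] Eigenspace M l x × ¬ (x ≈ᵛ 0ᵛ)

  IsOrthogonalProjection : ∀ {n} → Matrix n → Pred (Vector Carrier n) ℓ₁ → Set (c ⊔ ℓ₁)
  IsOrthogonalProjection P U = ∀ x →
    U (P *ᵛ x) × (∀ u → U u → ⟨ (λ i → x i - (P *ᵛ x) i) , u ⟩ ≈ 0#)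

  -- By the spectral theorem every real symmetric matrix has such a
  -- decomposition, and it is unique up to reindexing.
  record SpectralDecomposition {n} (M : Matrix n) : Set (c ⊔ ℓ₁) where
    field
      size          : ℕ
      θ             : Fin size → Carrier
      θ-injective   : ∀ i j → θ i ≈ θ j → i ≡ j
      θ-spectrum    : ∀ l → Spec M l ⇔ (∃[ i ] θ i ≈ l)
      E             : Fin size → Matrix n
      E-projection  : ∀ i → IsOrthogonalProjection (E i) (Eigenspace M (θ i))
      decomposition : M ≈ᴹ λ p q → sum λ i → θ i * E i p q

  module _ {n} {M : Matrix n} (D : SpectralDecomposition M) where
    open SpectralDecomposition D

    supp : Vector Carrier n → Pred Carrier ℓ₁
    supp x l = ∃[ i ] (θ i ≈ l) × ¬ (E i *ᵛ x ≈ᵛ 0ᵛ)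

    signed : Sign → Carrier → Carrier
    signed Sign.+ x = x
    signed Sign.- x = - x

    -- The second condition puts l in the support of e a; without it σ would
    -- not be determined.
    HasSign : (a b : Fin n) → Carrier → Sign → Set ℓ₁
    HasSign a b l σ = ∃[ i ] (θ i ≈ l) × ¬ (E i *ᵛ e a ≈ᵛ 0ᵛ) ×
      (E i *ᵛ e b ≈ᵛ λ p → signed σ ((E i *ᵛ e a) p))

    StronglyCospectral : (a b : Fin n) → Set (c ⊔ ℓ₁)
    StronglyCospectral a b =
      (supp (e a) ≐ supp (e b)) ×
      (∀ l → supp (e a) l → ∃[ σ ] HasSign a b l σ)

  -i_•_ : Carrier → ∀ {n} → Matrix n → ℂM.Matrix n
  (-i τ • K) i j = 0# +i (- (τ * K i j))

  -- X is exp (- i τ K); it exists and is unique for every τ and K, so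
  -- asking for it is no restriction.
  PSTAt : ∀ {n} → Matrix n → (a b : Fin n) → Carrier → Set (c ⊔ ℓ₁ ⊔ ℓ₂)
  PSTAt K a b τ = (0# < τ) ×
    ∃[ X ] IsExp (-i τ • K) X ×
    ∃[ γ ] IsUnimodular γ × (X ℂM.*ᵛ ℂM.e a ℂM.≈ᵛ λ i → γ ℂ-Ring.* ℂM.e b i)

  PST : ∀ {n} → Matrix n → (a b : Fin n) → Set (c ⊔ ℓ₁ ⊔ ℓ₂)
  PST K a b = ∃[ τ ] PSTAt K a b τ

  𝒦 : ∀ {n} → Matrix n → (a b : Fin n) → Pred ℕ (c ⊔ ℓ₁ ⊔ ℓ₂)
  𝒦 M a b k = ℕ⁺ k × PST (M ^ᴹ k) a b

module Submission where

-- The exponential series acts on the eigenspaces separately, so exp(-iτK) e_a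
-- = Σ exp(-iτκ) E e_a for every K that acts on each eigenspace of M by a
-- scalar κ.  Comparing with γ e_b in one eigenspace of the support, transfer at
-- time τ means that exp(-iτκ) is γ times the sign; with the given sign pattern,
-- both phases τ(κ± - κ₀) must be odd multiples of π.
-- For K = M they are ±τ b₀√Δ, whence the least transfer time.  For K = Mᵏ and
-- a₀ = 0 they are ±τ(b₀√Δ)ᵏ, and τ = π/(b₀√Δ)ᵏ works.  For k ≥ 2 and a₀ ≠ 0 the
-- numbers θ±ᵏ - a₀ᵏ = (A - a₀ᵏ) ± B√Δ would have a rational ratio, which is
-- impossible because A² > a₀²ᵏ and B ≠ 0.
-- Over an abstract complete ordered field, cos and sin come from their series,
-- the addition formulas from the Cauchy product, and π from the first zero of
-- cos, found by bisection.

import Algebra.Definitions.RawSemiring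
import Algebra.Properties.AbelianGroup
import Algebra.Properties.CommutativeMonoid.Sum
import Algebra.Properties.CommutativeSemiring.Exp
import Algebra.Properties.Ring
import Algebra.Properties.Semiring.Mult
import Algebra.Properties.Semiring.Mult.TCOptimised
import Algebra.Properties.Semiring.Sum
import Algebra.Solver.Ring
import Algebra.Solver.Ring.AlmostCommutativeRing as ACR
import Data.Fin.Properties as Finₚ
import Data.Integer.Properties as ℤₚ
import Data.Nat.Divisibility as ∣
import Data.Nat.Properties as ℕₚ
import Data.Rational.Properties as ℚₚ
import Relation.Binary.Construct.StrictToNonStrict as StrictToNonStrict
import Relation.Binary.Reasoning.Setoid
open import Algebra.Bundles using (RawRing)
open import Data.Fin.Base as Fin using (Fin; toℕ; punchIn)
open import Data.Integer.Base as ℤ using (ℤ; +_; -[1+_]; ∣_∣)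
open import Data.Maybe.Base using (Maybe; map)
open import Data.Nat.Base as ℕ using (ℕ; zero; suc; NonZero; _!)
open import Data.Nat.Coprimality using (Coprime; coprime-/gcd; coprime-divisor)
open import Data.Nat.Divisibility using (_∣_; divides)
open import Data.Nat.DivMod using (_/_; m/n*n≡m)
open import Data.Nat.GCD using (gcd; gcd[m,n]∣m; gcd[m,n]∣n; gcd[m,n]≢0)
open import Data.Product.Base using (∃-syntax; ∃₂; _×_; _,_; proj₁; proj₂)
open import Data.Rational.Base as ℚ using (ℚ; mkℚ; 0ℚ; ↥_; ↧ₙ_)
open import Data.Sign.Base as Sign using (Sign; opposite)
open import Data.Sum.Base using (_⊎_; inj₁; inj₂; [_,_]′)
open import Data.Vec.Functional using (Vector)
open import Function.Base using (_∘_; id)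
open import Function.Bundles using (Equivalence)
open import Level using (_⊔_)
open import Relation.Binary.Definitions using (tri<; tri≈; tri>)
open import Relation.Binary.PropositionalEquality.Core as ≡ using (_≡_; _≢_)
open import Relation.Binary.Structures using (IsStrictTotalOrder; IsTotalOrder)
open import Relation.Nullary.Decidable.Core using (Dec; yes; no; decidable-stable; dec⇒maybe)
open import Relation.Nullary.Negation.Core using (¬_; contradiction)
open import Relation.Unary using (_≐_; ｛_｝)
open import Defs

-- About γ only |γ| = 1 is known, so a single phase says nothing. Comparing each outer phase with
-- the one at a₀ eliminates γ and leaves two real conditions, cos = -1, at the two differences. For
-- k = 1 these coincide, because the outer eigenvalues lie symmetrically about a₀; for a₀ = 0 every
-- power keeps this symmetry up to sign. For a₀ ≠ 0 and k ≥ 2 the differences are x + y√Δ and x -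
-- y√Δ with x = A - a₀ᵏ and y = B rational. Conjugation inverts their ratio and fixes it if it is
-- rational, so a rational ratio is 1 or -1; the first means y = 0, the second x = 0. What has to be
-- shown is therefore that neither vanishes. The sign of a₀ is unknown, hence also the signs of A
-- and B; the quantity that can be controlled is the product a₀AB, which never becomes negative.
-- Trichotomy of the order makes equality of reals decidable, and this is what permits the many
-- proofs by contradiction.

squareFree-nonsquare : ∀ {Δ} → 1 ℕ.< Δ → SquareFree Δ → ∀ m n → n ≢ 0 → m ℕ.* m ≢ Δ ℕ.* (n ℕ.* n)
squareFree-nonsquare {Δ} 1<Δ sqf m n n≢0 eq = contradiction Δ≡1 (ℕₚ.>⇒≢ 1<Δ)
  where
  g : ℕ
  g = gcd m n
  instance
    g≢0 : NonZero g
    g≢0 = ℕ.≢-nonZero (gcd[m,n]≢0 m n (inj₂ n≢0))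
    gg≢0 : NonZero (g ℕ.* g)
    gg≢0 = ℕₚ.m*n≢0 g g
  m′ n′ : ℕ
  m′ = m / g
  n′ = n / g
  sq : ∀ k → g ∣ k → (k / g) ℕ.* (k / g) ℕ.* (g ℕ.* g) ≡ k ℕ.* k
  sq k g∣k = ≡.trans (ℕₚ.[m*n]*[o*p]≡[m*o]*[n*p] (k / g) (k / g) g g) (≡.cong₂ ℕ._*_ (m/n*n≡m g∣k) (m/n*n≡m g∣k))
  eq′ : m′ ℕ.* m′ ≡ Δ ℕ.* (n′ ℕ.* n′)
  eq′ = ℕₚ.*-cancelʳ-≡ _ _ (g ℕ.* g) (≡.trans (sq m (gcd[m,n]∣m m n)) (≡.trans eq
    (≡.trans (≡.cong (Δ ℕ.*_) (≡.sym (sq n (gcd[m,n]∣n m n)))) (≡.sym (ℕₚ.*-assoc Δ (n′ ℕ.* n′) (g ℕ.* g))))))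
  -- In lowest terms n′ is coprime to m′ and yet divides m′², so n′ = 1. Then Δ = m′² is itself a
  -- square, and square-freeness leaves only m′ = 1.
  n′∣m′m′ : n′ ∣ m′ ℕ.* m′
  n′∣m′m′ = divides (Δ ℕ.* n′) (≡.trans eq′ (≡.sym (ℕₚ.*-assoc Δ n′ n′)))
  coprime : Coprime m′ n′
  coprime = coprime-/gcd m n
  n′≡1 : n′ ≡ 1
  n′≡1 = coprime (coprime-divisor (λ (p , q) → coprime (q , p)) n′∣m′m′ , ∣.∣-refl)
  m′m′≡Δ : m′ ℕ.* m′ ≡ Δ
  m′m′≡Δ = ≡.trans eq′ (≡.trans (≡.cong (λ k → Δ ℕ.* (k ℕ.* k)) n′≡1) (ℕₚ.*-identityʳ Δ))
  m′≡1 : m′ ≡ 1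
  m′≡1 = sqf m′ (∣.∣-reflexive m′m′≡Δ)
  Δ≡1 : Δ ≡ 1
  Δ≡1 = ≡.trans (≡.sym m′m′≡Δ) (≡.cong (λ k → k ℕ.* k) m′≡1)

module Development {c ℓ₁ ℓ₂} (ℝ : RealField c ℓ₁ ℓ₂) where
  open Real ℝ
  open Algebra.Properties.AbelianGroup +-abelianGroup using (⁻¹-∙-comm)
  open Algebra.Properties.CommutativeMonoid.Sum +-commutativeMonoid
    using (sum-cong-≋; ∑-distrib-+; ∑-comm; sum-remove; sum-replicate-zero)
  open Algebra.Properties.CommutativeSemiring.Exp commutativeSemiring using (^-congˡ; ^-distrib-*)
  open Algebra.Properties.Ring ring using (-‿distribˡ-*; -‿distribʳ-*; -‿involutive; -0#≈0#; -1*x≈-x)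
  open Algebra.Properties.Semiring.Sum semiring using (*-distribˡ-sum; *-distribʳ-sum)
  open Relation.Binary.Reasoning.Setoid setoid
  private
    module Mult = Algebra.Properties.Semiring.Mult semiring
    module Mult′ = Algebra.Properties.Semiring.Mult.TCOptimised semiring

  -- Ring solver with integer coefficients

  x-0≈x : ∀ x → x - 0# ≈ x
  x-0≈x x = trans (+-congˡ -0#≈0#) (+-identityʳ x)

  -- Unlike fromℤ, this sends 1 to 1# on the nose, which the solver relies on.
  fromℤ′ : ℤ → Carrier
  fromℤ′ (+ n)    = n Mult′.× 1#
  fromℤ′ -[1+ n ] = - (suc n Mult′.× 1#)

  fromℤ′-⊖ : ∀ m n → fromℤ′ (m ℤ.⊖ n) ≈ m Mult′.× 1# - n Mult′.× 1#
  fromℤ′-⊖ m       zero    = sym (x-0≈x _)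
  fromℤ′-⊖ zero    (suc n) = sym (+-identityˡ _)
  fromℤ′-⊖ (suc m) (suc n) = begin
    fromℤ′ (suc m ℤ.⊖ suc n) ≡⟨ ≡.cong fromℤ′ (ℤₚ.[1+m]⊖[1+n]≡m⊖n m n) ⟩
    fromℤ′ (m ℤ.⊖ n)         ≈⟨ fromℤ′-⊖ m n ⟩
    a - b                    ≈⟨ +-congˡ (+-identityˡ (- b)) ⟨
    a + (0# - b)             ≈⟨ +-congˡ (+-congʳ (-‿inverseʳ 1#)) ⟨
    a + (1# - 1# - b)        ≈⟨ +-congˡ (+-assoc _ _ _) ⟩
    a + (1# + (- 1# - b))    ≈⟨ +-assoc _ _ _ ⟨
    (a + 1#) + (- 1# - b)    ≈⟨ +-cong (+-comm a 1#) (⁻¹-∙-comm 1# b) ⟩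
    (1# + a) - (1# + b)      ≈⟨ +-cong (Mult′.1+× m 1#) (-‿cong (Mult′.1+× n 1#)) ⟨
    suc m Mult′.× 1# - suc n Mult′.× 1# ∎
    where
    a = m Mult′.× 1#
    b = n Mult′.× 1#

  fromℤ′-neg : ∀ i → fromℤ′ (ℤ.- i) ≈ - fromℤ′ i
  fromℤ′-neg (+ zero)  = sym -0#≈0#
  fromℤ′-neg (+ suc n) = refl
  fromℤ′-neg -[1+ n ]  = sym (-‿involutive _)

  fromℤ′-+ : ∀ i j → fromℤ′ (i ℤ.+ j) ≈ fromℤ′ i + fromℤ′ j
  fromℤ′-+ (+ m)    (+ n)    = Mult′.×-homo-+ 1# m n
  fromℤ′-+ (+ m)    -[1+ n ] = fromℤ′-⊖ m (suc n)
  fromℤ′-+ -[1+ m ] (+ n)    = trans (fromℤ′-⊖ n (suc m)) (+-comm _ _)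
  fromℤ′-+ -[1+ m ] -[1+ n ] = begin
    - (suc (suc (m ℕ.+ n)) Mult′.× 1#)            ≡⟨ ≡.cong (λ k → - (suc k Mult′.× 1#)) (ℕₚ.+-suc m n) ⟨
    - ((suc m ℕ.+ suc n) Mult′.× 1#)              ≈⟨ -‿cong (Mult′.×-homo-+ 1# (suc m) (suc n)) ⟩
    - (suc m Mult′.× 1# + suc n Mult′.× 1#)       ≈⟨ ⁻¹-∙-comm _ _ ⟨
    - (suc m Mult′.× 1#) - (suc n Mult′.× 1#)     ∎

  fromℤ′-pos-* : ∀ m j → fromℤ′ (+ m ℤ.* j) ≈ fromℤ′ (+ m) * fromℤ′ j
  fromℤ′-pos-* m (+ n) = begin
    fromℤ′ (+ m ℤ.* + n)            ≡⟨ ≡.cong fromℤ′ (ℤₚ.pos-* m n) ⟨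
    (m ℕ.* n) Mult′.× 1#            ≈⟨ Mult′.×1-homo-* m n ⟩
    (m Mult′.× 1#) * (n Mult′.× 1#) ∎
  fromℤ′-pos-* m -[1+ n ] = begin
    fromℤ′ (+ m ℤ.* -[1+ n ])           ≡⟨ ≡.cong fromℤ′ (ℤₚ.neg-distribʳ-* (+ m) (+ suc n)) ⟨
    fromℤ′ (ℤ.- (+ m ℤ.* + suc n))      ≈⟨ fromℤ′-neg (+ m ℤ.* + suc n) ⟩
    - fromℤ′ (+ m ℤ.* + suc n)          ≈⟨ -‿cong (fromℤ′-pos-* m (+ suc n)) ⟩
    - (fromℤ′ (+ m) * fromℤ′ (+ suc n)) ≈⟨ -‿distribʳ-* _ _ ⟩
    fromℤ′ (+ m) * fromℤ′ -[1+ n ]      ∎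

  fromℤ′-* : ∀ i j → fromℤ′ (i ℤ.* j) ≈ fromℤ′ i * fromℤ′ j
  fromℤ′-* (+ m) j = fromℤ′-pos-* m j
  fromℤ′-* -[1+ m ] j = begin
    fromℤ′ (-[1+ m ] ℤ.* j)          ≡⟨ ≡.cong fromℤ′ (ℤₚ.neg-distribˡ-* (+ suc m) j) ⟨
    fromℤ′ (ℤ.- (+ suc m ℤ.* j))     ≈⟨ fromℤ′-neg (+ suc m ℤ.* j) ⟩
    - fromℤ′ (+ suc m ℤ.* j)         ≈⟨ -‿cong (fromℤ′-pos-* (suc m) j) ⟩
    - (fromℤ′ (+ suc m) * fromℤ′ j)  ≈⟨ -‿distribˡ-* _ _ ⟩
    fromℤ′ -[1+ m ] * fromℤ′ j       ∎

  almostCommutativeRing = ACR.fromCommutativeRing commutativeRing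

  ℤ-rawRing : RawRing _ _
  ℤ-rawRing = record
    { _≈_ = _≡_ ; _+_ = ℤ._+_ ; _*_ = ℤ._*_ ; -_ = ℤ.-_ ; 0# = + 0 ; 1# = + 1 }

  fromℤ′-morphism : ℤ-rawRing ACR.-Raw-AlmostCommutative⟶ almostCommutativeRing
  fromℤ′-morphism = record
    { ⟦_⟧ = fromℤ′ ; +-homo = fromℤ′-+ ; *-homo = fromℤ′-* ; -‿homo = fromℤ′-neg
    ; 0-homo = refl ; 1-homo = refl }

  coefficient≟ : ∀ i j → Maybe (fromℤ′ i ≈ fromℤ′ j)
  coefficient≟ i j = map (λ i≡j → reflexive (≡.cong fromℤ′ i≡j)) (dec⇒maybe (i ℤₚ.≟ j))

  open Algebra.Solver.Ring ℤ-rawRing almostCommutativeRing fromℤ′-morphism coefficient≟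
      using (solve; _:=_; con; _:+_; _:*_; _:-_; :-_; Polynomial)

  :0 :1 :2 : ∀ {n} → Polynomial n
  :0 = con (+ 0)
  :1 = con (+ 1)
  :2 = con (+ 2)

  -- Ordered field arithmetic and null sequences

  open IsStrictTotalOrder isStrictTotalOrder
    using (compare; _≟_; <-resp-≈) renaming (irrefl to <-irrefl; trans to <-trans)
  open IsTotalOrder (StrictToNonStrict.isTotalOrder _≈_ _<_ isStrictTotalOrder)
    using () renaming (trans to ≤-trans; antisym to ≤-antisym; refl to ≤-refl; total to ≤-total)

  <-respʳ : ∀ {x y z} → y ≈ z → x < y → x < z
  <-respʳ = proj₁ <-resp-≈

  <-respˡ : ∀ {x y z} → y ≈ z → y < x → z < x
  <-respˡ = proj₂ <-resp-≈

  ≤-respʳ : ∀ {x y z} → y ≈ z → x ≤ y → x ≤ z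
  ≤-respʳ y≈z x≤y = ≤-trans x≤y (inj₂ y≈z)

  ≤-respˡ : ∀ {x y z} → y ≈ z → y ≤ x → z ≤ x
  ≤-respˡ y≈z y≤x = ≤-trans (inj₂ (sym y≈z)) y≤x

  <-≤-trans : ∀ {x y z} → x < y → y ≤ z → x < z
  <-≤-trans = StrictToNonStrict.<-≤-trans _≈_ _<_ <-trans <-respʳ

  ≤-<-trans : ∀ {x y z} → x ≤ y → y < z → x < z
  ≤-<-trans = StrictToNonStrict.≤-<-trans _≈_ _<_ sym <-trans <-respˡ

  ≤⇒≯ : ∀ {x y} → x ≤ y → ¬ y < x
  ≤⇒≯ x≤y y<x = <-irrefl refl (≤-<-trans x≤y y<x)

  ≮⇒≥ : ∀ {x y} → ¬ x < y → y ≤ x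
  ≮⇒≥ {x} {y} x≮y with compare x y
  ... | tri< x<y _ _ = contradiction x<y x≮y
  ... | tri≈ _ x≈y _ = inj₂ (sym x≈y)
  ... | tri> _ _ y<x = inj₁ y<x

  <⇒≉ : ∀ {x y} → x < y → ¬ x ≈ y
  <⇒≉ x<y x≈y = <-irrefl x≈y x<y

  >⇒≉ : ∀ {x y} → y < x → ¬ x ≈ y
  >⇒≉ y<x x≈y = <-irrefl (sym x≈y) y<x

  <⇒0< : ∀ {x y} → x < y → 0# < y - x
  <⇒0< {x} {y} x<y = <-respˡ (-‿inverseˡ x) (<-respʳ (+-comm (- x) y) (+-monoʳ-< (- x) x<y))

  -- Linear arithmetic: z is built from the hypotheses, the equation is left to
  -- the ring solver.
  by< : ∀ {x y z} → 0# < z → z ≈ y - x → x < y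
  by< {x} {y} {z} 0<z z≈y-x =
    <-respˡ (+-identityʳ x) (<-respʳ eq (+-monoʳ-< x 0<z))
    where eq = trans (+-congˡ z≈y-x) (solve 2 (λ x y → x :+ (y :- x) := y) refl x y)

  by≤ : ∀ {x y z} → 0# ≤ z → z ≈ y - x → x ≤ y
  by≤ (inj₁ 0<z) eq = inj₁ (by< 0<z eq)
  by≤ {x} {y} {z} (inj₂ 0≈z) eq = inj₂ (begin
    x             ≈⟨ +-identityʳ x ⟨
    x + 0#        ≈⟨ +-congˡ (trans 0≈z eq) ⟩
    x + (y - x)   ≈⟨ solve 2 (λ x y → x :+ (y :- x) := y) refl x y ⟩
    y             ∎)

  ≤⇒0≤ : ∀ {x y} → x ≤ y → 0# ≤ y - x
  ≤⇒0≤ (inj₁ x<y) = inj₁ (<⇒0< x<y)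
  ≤⇒0≤ {x} {y} (inj₂ x≈y) = inj₂ (sym (trans (+-congˡ (-‿cong x≈y)) (-‿inverseʳ y)))

  0<-+ : ∀ {x y} → 0# < x → 0# ≤ y → 0# < x + y
  0<-+ {x} {y} 0<x 0≤y = ≤-<-trans 0≤y (by< 0<x (solve 2 (λ x y → x := x :+ y :- y) refl x y))

  0≤-+ : ∀ {x y} → 0# ≤ x → 0# ≤ y → 0# ≤ x + y
  0≤-+ (inj₁ 0<x) 0≤y = inj₁ (0<-+ 0<x 0≤y)
  0≤-+ {x} {y} (inj₂ 0≈x) 0≤y = ≤-respʳ (trans (sym (+-identityˡ y)) (+-congʳ 0≈x)) 0≤y

  0≤-* : ∀ {x y} → 0# ≤ x → 0# ≤ y → 0# ≤ x * y
  0≤-* (inj₁ 0<x) (inj₁ 0<y) = inj₁ (*-pos 0<x 0<y)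
  0≤-* {x} {y} (inj₂ 0≈x) _ = inj₂ (sym (trans (*-congʳ (sym 0≈x)) (zeroˡ y)))
  0≤-* {x} {y} (inj₁ _) (inj₂ 0≈y) = inj₂ (sym (trans (*-congˡ (sym 0≈y)) (zeroʳ x)))

  +-mono-≤ : ∀ {x y u v} → x ≤ y → u ≤ v → x + u ≤ y + v
  +-mono-≤ {x} {y} {u} {v} x≤y u≤v = by≤ (0≤-+ (≤⇒0≤ x≤y) (≤⇒0≤ u≤v))
    (solve 4 (λ x y u v → y :- x :+ (v :- u) := y :+ v :- (x :+ u)) refl x y u v)

  *-monoˡ-≤ : ∀ {x y z} → 0# ≤ z → x ≤ y → z * x ≤ z * y
  *-monoˡ-≤ {x} {y} {z} 0≤z x≤y = by≤ (0≤-* 0≤z (≤⇒0≤ x≤y))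
    (solve 3 (λ x y z → z :* (y :- x) := z :* y :- z :* x) refl x y z)

  *-mono-≤ : ∀ {x y u v} → 0# ≤ y → 0# ≤ u → x ≤ y → u ≤ v → x * u ≤ y * v
  *-mono-≤ {x} {y} {u} {v} 0≤y 0≤u x≤y u≤v = by≤ (0≤-+ (0≤-* 0≤y (≤⇒0≤ u≤v)) (0≤-* 0≤u (≤⇒0≤ x≤y)))
    (solve 4 (λ x y u v → y :* (v :- u) :+ u :* (y :- x) := y :* v :- x :* u) refl x y u v)

  *-monoˡ-< : ∀ {x y z} → 0# < z → x < y → z * x < z * y
  *-monoˡ-< {x} {y} {z} 0<z x<y = by< (*-pos 0<z (<⇒0< x<y))
    (solve 3 (λ x y z → z :* (y :- x) := z :* y :- z :* x) refl x y z)

  <0⇒0<- : ∀ {x} → x < 0# → 0# < - x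
  <0⇒0<- {x} x<0 = <-respʳ (+-identityˡ (- x)) (<⇒0< x<0)

  ≤0⇒0≤- : ∀ {x} → x ≤ 0# → 0# ≤ - x
  ≤0⇒0≤- {x} x≤0 = ≤-respʳ (+-identityˡ (- x)) (≤⇒0≤ x≤0)

  0≤x² : ∀ x → 0# ≤ x * x
  0≤x² x with ≤-total 0# x
  ... | inj₁ 0≤x = 0≤-* 0≤x 0≤x
  ... | inj₂ x≤0 = ≤-respʳ (solve 1 (λ x → :- x :* :- x := x :* x) refl x) (0≤-* (≤0⇒0≤- x≤0) (≤0⇒0≤- x≤0))

  0<x² : ∀ {x} → ¬ x ≈ 0# → 0# < x * x
  0<x² {x} x≉0 with compare x 0#
  ... | tri< x<0 _ _ = <-respʳ (solve 1 (λ x → :- x :* :- x := x :* x) refl x) (*-pos (<0⇒0<- x<0) (<0⇒0<- x<0))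
  ... | tri≈ _ x≈0 _ = contradiction x≈0 x≉0
  ... | tri> _ _ 0<x = *-pos 0<x 0<x

  0<1 : 0# < 1#
  0<1 = <-respʳ (*-identityˡ 1#) (0<x² (0≉1 ∘ sym))

  2# : Carrier
  2# = 1# + 1#

  0<2 : 0# < 2#
  0<2 = 0<-+ 0<1 (inj₁ 0<1)

  x*y≈0⇒y≈0 : ∀ {x y} → ¬ x ≈ 0# → x * y ≈ 0# → y ≈ 0#
  x*y≈0⇒y≈0 {x} {y} x≉0 xy≈0 = begin
    y                ≈⟨ *-identityˡ y ⟨
    1# * y           ≈⟨ *-congʳ (⁻¹-inverseʳ x≉0) ⟨
    x * x ⁻¹ * y     ≈⟨ solve 3 (λ x i y → x :* i :* y := i :* (x :* y)) refl x (x ⁻¹) y ⟩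
    x ⁻¹ * (x * y)   ≈⟨ *-congˡ xy≈0 ⟩
    x ⁻¹ * 0#        ≈⟨ zeroʳ _ ⟩
    0#               ∎

  *-≉0 : ∀ {x y} → ¬ x ≈ 0# → ¬ y ≈ 0# → ¬ x * y ≈ 0#
  *-≉0 x≉0 y≉0 xy≈0 = y≉0 (x*y≈0⇒y≈0 x≉0 xy≈0)

  x*x≈0⇒x≈0 : ∀ {x} → x * x ≈ 0# → x ≈ 0#
  x*x≈0⇒x≈0 {x} xx≈0 with compare x 0#
  ... | tri< _ x≉0 _ = contradiction xx≈0 (*-≉0 x≉0 x≉0)
  ... | tri≈ _ x≈0 _ = x≈0
  ... | tri> _ x≉0 _ = contradiction xx≈0 (*-≉0 x≉0 x≉0)

  x-y≈0⇒x≈y : ∀ {x y} → x - y ≈ 0# → x ≈ y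
  x-y≈0⇒x≈y {x} {y} eq = begin
    x            ≈⟨ solve 2 (λ x y → x := x :- y :+ y) refl x y ⟩
    x - y + y    ≈⟨ +-congʳ eq ⟩
    0# + y       ≈⟨ +-identityˡ y ⟩
    y            ∎

  x≈y⇒x-y≈0 : ∀ {x y} → x ≈ y → x - y ≈ 0#
  x≈y⇒x-y≈0 {x} {y} eq = trans (+-congʳ eq) (-‿inverseʳ y)

  *-cancelˡ : ∀ {x y z} → ¬ x ≈ 0# → x * y ≈ x * z → y ≈ z
  *-cancelˡ {x} {y} {z} x≉0 eq = x-y≈0⇒x≈y (x*y≈0⇒y≈0 x≉0
    (trans (solve 3 (λ x y z → x :* (y :- z) := x :* y :- x :* z) refl x y z) (x≈y⇒x-y≈0 eq)))

  ⁻¹-unique : ∀ {x y} → x * y ≈ 1# → y ≈ x ⁻¹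
  ⁻¹-unique {x} {y} xy≈1 = *-cancelˡ x≉0 (trans xy≈1 (sym (⁻¹-inverseʳ x≉0)))
    where
    x≉0 : ¬ x ≈ 0#
    x≉0 x≈0 = 0≉1 (trans (sym (zeroˡ y)) (trans (*-congʳ (sym x≈0)) xy≈1))

  0<⁻¹ : ∀ {x} → 0# < x → 0# < x ⁻¹
  0<⁻¹ {x} 0<x with compare (x ⁻¹) 0#
  ... | tri< i<0 _ _ = contradiction (<-trans 0<1 (by< (*-pos 0<x (<0⇒0<- i<0))
          (trans (solve 2 (λ x i → x :* (:- i) := :0 :- x :* i) refl x (x ⁻¹)) (+-congˡ (-‿cong (⁻¹-inverseʳ (>⇒≉ 0<x)))))))
        (<-irrefl refl)
  ... | tri≈ _ i≈0 _ = contradiction (trans (sym (zeroʳ x)) (trans (*-congˡ (sym i≈0)) (⁻¹-inverseʳ (>⇒≉ 0<x)))) 0≉1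
  ... | tri> _ _ 0<i = 0<i

  *-cancelˡ-≤ : ∀ {x y z} → 0# < x → x * y ≤ x * z → y ≤ z
  *-cancelˡ-≤ {x} {y} {z} 0<x xy≤xz = ≮⇒≥ λ z<y → ≤⇒≯ xy≤xz (*-monoˡ-< 0<x z<y)

  *-cancelˡ-< : ∀ {x y z} → 0# < x → x * y < x * z → y < z
  *-cancelˡ-< {x} {y} {z} 0<x xy<xz with compare y z
  ... | tri< y<z _ _ = y<z
  ... | tri≈ _ y≈z _ = contradiction xy<xz (<-irrefl (*-congˡ y≈z))
  ... | tri> _ _ z<y = contradiction xy<xz (≤⇒≯ (inj₁ (*-monoˡ-< 0<x z<y)))

  ½ : Carrier
  ½ = 2# ⁻¹

  0<½ : 0# < ½
  0<½ = 0<⁻¹ 0<2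

  ½+½≈1 : ½ + ½ ≈ 1#
  ½+½≈1 = trans (solve 1 (λ h → h :+ h := :2 :* h) refl ½) (⁻¹-inverseʳ (>⇒≉ 0<2))

  halve : ∀ x → ½ * x + ½ * x ≈ x
  halve x = trans (sym (distribʳ x ½ ½)) (trans (*-congʳ ½+½≈1) (*-identityˡ x))

  0<half : ∀ {x} → 0# < x → 0# < ½ * x
  0<half = *-pos 0<½

  half< : ∀ {x} → 0# < x → ½ * x < x
  half< {x} 0<x = by< (0<half 0<x) (trans (solve 1 (λ h → h := h :+ h :- h) refl (½ * x)) (+-congʳ (halve x)))

  fromℕ-+ : ∀ m n → fromℕ (m ℕ.+ n) ≈ fromℕ m + fromℕ n
  fromℕ-+ = Mult.×-homo-+ 1#

  fromℕ-* : ∀ m n → fromℕ (m ℕ.* n) ≈ fromℕ m * fromℕ n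
  fromℕ-* = Mult.×1-homo-*

  0≤fromℕ : ∀ n → 0# ≤ fromℕ n
  0≤fromℕ zero    = inj₂ refl
  0≤fromℕ (suc n) = 0≤-+ (inj₁ 0<1) (0≤fromℕ n)

  0<fromℕ : ∀ {n} → 0 ℕ.< n → 0# < fromℕ n
  0<fromℕ {suc n} _ = 0<-+ 0<1 (0≤fromℕ n)

  fromℕ-mono-≤ : ∀ {m n} → m ℕ.≤ n → fromℕ m ≤ fromℕ n
  fromℕ-mono-≤ {n = n} ℕ.z≤n = 0≤fromℕ n
  fromℕ-mono-≤ (ℕ.s≤s m≤n)   = +-mono-≤ ≤-refl (fromℕ-mono-≤ m≤n)

  fromℕ-mono-< : ∀ {m n} → m ℕ.< n → fromℕ m < fromℕ n
  fromℕ-mono-< {m} {n} m<n = <-≤-trans (by< {z = 1#} 0<1 (solve 1 (λ m → :1 := :1 :+ m :- m) refl (fromℕ m))) (fromℕ-mono-≤ m<n)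

  -- Bd A x says |x| ≤ A.
  Bd : Carrier → Carrier → Set _
  Bd A x = (x ≤ A) × (- x ≤ A)

  Bd-cong : ∀ {A B x y} → A ≈ B → x ≈ y → Bd A x → Bd B y
  Bd-cong A≈B x≈y (p , q) = ≤-respʳ A≈B (≤-respˡ x≈y p) , ≤-respʳ A≈B (≤-respˡ (-‿cong x≈y) q)

  Bd-mono : ∀ {A B x} → A ≤ B → Bd A x → Bd B x
  Bd-mono A≤B (p , q) = ≤-trans p A≤B , ≤-trans q A≤B

  Bd-neg : ∀ {A x} → Bd A x → Bd A (- x)
  Bd-neg {A} {x} (p , q) = q , ≤-respˡ (sym (-‿involutive x)) p

  Bd-0 : ∀ {A} → 0# ≤ A → Bd A 0#
  Bd-0 0≤A = 0≤A , ≤-respˡ (sym -0#≈0#) 0≤A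

  Bd-nonneg : ∀ {A x} → Bd A x → 0# ≤ A
  Bd-nonneg {A} {x} (p , q) with ≤-total 0# x
  ... | inj₁ 0≤x = ≤-trans 0≤x p
  ... | inj₂ x≤0 = ≤-trans (≤0⇒0≤- x≤0) q

  Bd-self : ∀ {x} → 0# ≤ x → Bd x x
  Bd-self {x} 0≤x = ≤-refl , by≤ (0≤-+ 0≤x 0≤x) (solve 1 (λ x → x :+ x := x :- :- x) refl x)

  Bd-+ : ∀ {A B x y} → Bd A x → Bd B y → Bd (A + B) (x + y)
  Bd-+ {A} {B} {x} {y} (p , q) (r , s) =
    +-mono-≤ p r , ≤-respˡ (solve 2 (λ x y → :- x :+ :- y := :- (x :+ y)) refl x y) (+-mono-≤ q s)

  -- No distinction of signs is needed: products of the nonnegative numbers A ± x and B ± y add up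
  -- in pairs to 2(AB - xy) and 2(AB + xy).
  Bd-* : ∀ {A B x y} → Bd A x → Bd B y → Bd (A * B) (x * y)
  Bd-* {A} {B} {x} {y} (p , q) (r , s) = *-cancelˡ-≤ 0<2 upper , *-cancelˡ-≤ 0<2 lower
    where
    A-x = ≤⇒0≤ p
    A+x = ≤-respʳ (solve 2 (λ A x → A :- :- x := A :+ x) refl A x) (≤⇒0≤ q)
    B-y = ≤⇒0≤ r
    B+y = ≤-respʳ (solve 2 (λ A x → A :- :- x := A :+ x) refl B y) (≤⇒0≤ s)
    upper = by≤ (0≤-+ (0≤-* A-x B+y) (0≤-* A+x B-y))
      (solve 4 (λ A B x y → (A :- x) :* (B :+ y) :+ (A :+ x) :* (B :- y) := :2 :* (A :* B) :- :2 :* (x :* y)) refl A B x y)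
    lower = by≤ (0≤-+ (0≤-* A-x B-y) (0≤-* A+x B+y))
      (solve 4 (λ A B x y → (A :- x) :* (B :- y) :+ (A :+ x) :* (B :+ y) := :2 :* (A :* B) :- :2 :* (:- (x :* y))) refl A B x y)

  ‖_‖ : Carrier → Carrier
  ‖ x ‖ with ≤-total 0# x
  ... | inj₁ _ = x
  ... | inj₂ _ = - x

  Bd-‖‖ : ∀ x → Bd ‖ x ‖ x
  Bd-‖‖ x with ≤-total 0# x
  ... | inj₁ 0≤x = Bd-self 0≤x
  ... | inj₂ x≤0 = Bd-cong refl (-‿involutive x) (Bd-neg (Bd-self (≤0⇒0≤- x≤0)))

  Bd-^ : ∀ {A x} → Bd A x → ∀ n → Bd (A ^ n) (x ^ n)
  Bd-^ b zero    = Bd-self (inj₁ 0<1)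
  Bd-^ b (suc n) = Bd-* b (Bd-^ b n)

  Null : (ℕ → Carrier) → Set _
  Null s = ∀ ε → 0# < ε → ∃[ N ] (∀ n → N ℕ.≤ n → Bd ε (s n))

  Null-cong : ∀ {s t} → (∀ n → s n ≈ t n) → Null s → Null t
  Null-cong s≈t ns ε 0<ε with ns ε 0<ε
  ... | N , h = N , λ n N≤n → Bd-cong refl (s≈t n) (h n N≤n)

  Null-dom : ∀ {s t} → (∀ n → Bd (s n) (t n)) → Null s → Null t
  Null-dom b ns ε 0<ε with ns ε 0<ε
  ... | N , h = N , λ n N≤n → Bd-mono (proj₁ (h n N≤n)) (b n)

  Null-0 : Null (λ _ → 0#)
  Null-0 ε 0<ε = 0 , λ _ _ → Bd-0 (inj₁ 0<ε)

  Null-neg : ∀ {s} → Null s → Null (λ n → - s n)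
  Null-neg ns ε 0<ε with ns ε 0<ε
  ... | N , h = N , λ n N≤n → Bd-neg (h n N≤n)

  Null-+ : ∀ {s t} → Null s → Null t → Null (λ n → s n + t n)
  Null-+ ns nt ε 0<ε with ns (½ * ε) (0<half 0<ε) | nt (½ * ε) (0<half 0<ε)
  ... | M , f | N , g = M ℕ.⊔ N , λ n le →
    Bd-cong (halve ε) refl (Bd-+ (f n (ℕₚ.≤-trans (ℕₚ.m≤m⊔n M N) le)) (g n (ℕₚ.≤-trans (ℕₚ.m≤n⊔m M N) le)))

  Null-scale : ∀ a {s} → Null s → Null (λ n → a * s n)
  Null-scale a {s} ns ε 0<ε with ns (A ⁻¹ * ε) (*-pos (0<⁻¹ 0<A) 0<ε)
    where
    -- The added 1 makes A positive, hence invertible, even when a = 0.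
    A = ‖ a ‖ + 1#
    0<A : 0# < A
    0<A = <-respʳ (+-comm 1# ‖ a ‖) (0<-+ 0<1 (Bd-nonneg (Bd-‖‖ a)))
  ... | N , h = N , λ n N≤n → Bd-mono (inj₂ (eq 0<A)) (Bd-* bA (h n N≤n))
    where
    A = ‖ a ‖ + 1#
    0<A : 0# < A
    0<A = <-respʳ (+-comm 1# ‖ a ‖) (0<-+ 0<1 (Bd-nonneg (Bd-‖‖ a)))
    bA : Bd A a
    bA = Bd-cong refl (+-identityʳ a) (Bd-+ (Bd-‖‖ a) (Bd-0 (inj₁ 0<1)))
    eq : 0# < A → A * (A ⁻¹ * ε) ≈ ε
    eq 0<A = trans (sym (*-assoc _ _ _)) (trans (*-congʳ (⁻¹-inverseʳ (>⇒≉ 0<A))) (*-identityˡ ε))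

  Null-* : ∀ {s t} → Null s → Null t → Null (λ n → s n * t n)
  Null-* ns nt ε 0<ε with ns ε 0<ε | nt 1# 0<1
  ... | M , f | N , g = M ℕ.⊔ N , λ n le →
    Bd-cong (*-identityʳ ε) refl (Bd-* (f n (ℕₚ.≤-trans (ℕₚ.m≤m⊔n M N) le)) (g n (ℕₚ.≤-trans (ℕₚ.m≤n⊔m M N) le)))

  Null-subseq : ∀ {s} (f : ℕ → ℕ) → (∀ n → n ℕ.≤ f n) → Null s → Null (s ∘ f)
  Null-subseq f n≤f ns ε 0<ε with ns ε 0<ε
  ... | N , h = N , λ n N≤n → h (f n) (ℕₚ.≤-trans N≤n (n≤f n))

  Null-const : ∀ {a} → Null (λ _ → a) → a ≈ 0#
  Null-const {a} na with compare a 0#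
  ... | tri≈ _ a≈0 _ = a≈0
  ... | tri< a<0 _ _ with na (½ * - a) (0<half (<0⇒0<- a<0))
  ...   | N , h = contradiction (proj₂ (h N ℕₚ.≤-refl)) λ le → ≤⇒≯ le (half< (<0⇒0<- a<0))
  Null-const {a} na | tri> _ _ 0<a with na (½ * a) (0<half 0<a)
  ...   | N , h = contradiction (proj₁ (h N ℕₚ.≤-refl)) λ le → ≤⇒≯ le (half< 0<a)

  -- Turns the Archimedean axiom into convergence to 0. The weak rate 1/n suffices for both later
  -- uses, the terms xⁿ/n! and the widths of the bisection.
  Null-O[1/n] : ∀ {s} C → (∀ n → 0# ≤ s n) → (∀ n → fromℕ (suc n) * s n ≤ C) → Null s
  Null-O[1/n] {s} C 0≤s h ε 0<ε with archimedean (C * ε ⁻¹)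
  ... | N , C/ε<N = N , λ n N≤n → Bd-mono (inj₁ (lt n N≤n)) (Bd-self (0≤s n))
    where
    lt : ∀ n → N ℕ.≤ n → s n < ε
    lt n N≤n = *-cancelˡ-< (0<fromℕ {suc n} (ℕ.s≤s ℕ.z≤n)) (≤-<-trans (h n)
      (<-≤-trans (<-respˡ eq (*-monoˡ-< 0<ε C/ε<N))
        (≤-respʳ (*-comm _ _) (*-monoˡ-≤ (inj₁ 0<ε) (fromℕ-mono-≤ (ℕₚ.m≤n⇒m≤1+n N≤n))))))
      where
      eq : ε * (C * ε ⁻¹) ≈ C
      eq = trans (solve 3 (λ e C i → e :* (C :* i) := C :* (e :* i)) refl ε C (ε ⁻¹))
           (trans (*-congˡ (⁻¹-inverseʳ (>⇒≉ 0<ε))) (*-identityʳ C))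

  -- Limits of sequences

  _⟶_ : (ℕ → Carrier) → Carrier → Set _
  s ⟶ l = Null (λ n → s n - l)

  infix 4 _⟶_

  ⟶⇒IsLimit : ∀ {s l} → s ⟶ l → IsLimit s l
  ⟶⇒IsLimit {s} {l} ns ε 0<ε with ns (½ * ε) (0<half 0<ε)
  ... | N , h = N , λ n N≤n → let p , q = h n N≤n in
      by< (<⇒0< (≤-<-trans p (half< 0<ε))) (solve 3 (λ s l e → e :- (s :- l) := l :+ e :- s) refl (s n) l ε)
    , by< (<⇒0< (≤-<-trans q (half< 0<ε))) (solve 3 (λ s l e → e :- (:- (s :- l)) := s :+ e :- l) refl (s n) l ε)

  IsLimit⇒⟶ : ∀ {s l} → IsLimit s l → s ⟶ l
  IsLimit⇒⟶ {s} {l} lim ε 0<ε with lim ε 0<ε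
  ... | N , h = N , λ n N≤n → let p , q = h n N≤n in
      by≤ (inj₁ (<⇒0< p)) (solve 3 (λ s l e → l :+ e :- s := e :- (s :- l)) refl (s n) l ε)
    , by≤ (inj₁ (<⇒0< q)) (solve 3 (λ s l e → s :+ e :- l := e :- (:- (s :- l))) refl (s n) l ε)

  ⟶-unique : ∀ {s k l} → s ⟶ k → s ⟶ l → k ≈ l
  ⟶-unique {s} {k} {l} sk sl = x-y≈0⇒x≈y (Null-const (Null-cong
    (λ n → solve 3 (λ s k l → s :- l :+ :- (s :- k) := k :- l) refl (s n) k l) (Null-+ sl (Null-neg sk))))

  ⟶-cong : ∀ {s t k l} → (∀ n → s n ≈ t n) → k ≈ l → s ⟶ k → t ⟶ l
  ⟶-cong s≈t k≈l = Null-cong (λ n → +-cong (s≈t n) (-‿cong k≈l))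

  ⟶-const : ∀ a → (λ _ → a) ⟶ a
  ⟶-const a = Null-cong (λ _ → sym (-‿inverseʳ a)) Null-0

  ⟶-null : ∀ {s t l} → Null (λ n → s n - t n) → s ⟶ l → t ⟶ l
  ⟶-null {s} {t} {l} nst sl = Null-cong
    (λ n → solve 3 (λ s t l → s :- l :+ :- (s :- t) := t :- l) refl (s n) (t n) l) (Null-+ sl (Null-neg nst))

  ⟶-neg : ∀ {s l} → s ⟶ l → (λ n → - s n) ⟶ - l
  ⟶-neg {s} {l} sl = Null-cong (λ n → solve 2 (λ s l → :- (s :- l) := :- s :- :- l) refl (s n) l) (Null-neg sl)

  ⟶-+ : ∀ {s t k l} → s ⟶ k → t ⟶ l → (λ n → s n + t n) ⟶ k + l
  ⟶-+ {s} {t} {k} {l} sk tl = Null-cong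
    (λ n → solve 4 (λ s t k l → s :- k :+ (t :- l) := s :+ t :- (k :+ l)) refl (s n) (t n) k l) (Null-+ sk tl)

  ⟶-* : ∀ {s t k l} → s ⟶ k → t ⟶ l → (λ n → s n * t n) ⟶ k * l
  ⟶-* {s} {t} {k} {l} sk tl = Null-cong
    (λ n → solve 4 (λ s t k l → (s :- k) :* (t :- l) :+ (k :* (t :- l) :+ l :* (s :- k)) := s :* t :- k :* l) refl (s n) (t n) k l)
    (Null-+ (Null-* sk tl) (Null-+ (Null-scale k tl) (Null-scale l sk)))

  ⟶-sum : ∀ {m} {s : Fin m → ℕ → Carrier} {l : Fin m → Carrier} → (∀ i → s i ⟶ l i) →
    (λ n → sum λ i → s i n) ⟶ sum l
  ⟶-sum {zero}  h = ⟶-const 0#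
  ⟶-sum {suc m} h = ⟶-+ (h Fin.zero) (⟶-sum (h ∘ Fin.suc))

  ⟶-≤ : ∀ {s l u} → (∀ n → s n ≤ u) → s ⟶ l → l ≤ u
  ⟶-≤ {s} {l} {u} s≤u sl = ≮⇒≥ λ u<l → let d = <⇒0< u<l; (N , h) = sl _ (0<half d) in
    ≤⇒≯ (proj₂ (h N ℕₚ.≤-refl)) (<-≤-trans (half< d)
      (by≤ (≤⇒0≤ (s≤u N)) (solve 3 (λ s l u → u :- s := :- (s :- l) :- (l :- u)) refl (s N) l u)))

  ⟶-≥ : ∀ {s l u} → (∀ n → u ≤ s n) → s ⟶ l → u ≤ l
  ⟶-≥ {s} {l} {u} u≤s sl = by≤ (≤⇒0≤ (⟶-≤ {u = - u} (λ n → by≤ (≤⇒0≤ (u≤s n))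
      (solve 2 (λ s u → s :- u := :- u :- :- s) refl (s n) u)) (⟶-neg sl)))
    (solve 2 (λ l u → :- u :- :- l := l :- u) refl l u)

  -- Completeness in terms of the differences `s (n + k) - s n`: for a series these are the blocks
  -- that `series-split` cuts off.
  ⟶-complete : ∀ s → (∀ ε → 0# < ε → ∃[ N ] (∀ n k → N ℕ.≤ n → Bd ε (s (n ℕ.+ k) - s n))) → ∃[ l ] s ⟶ l
  ⟶-complete s h with complete s cauchy
    where
    cauchy : IsCauchy s
    cauchy ε 0<ε with h (½ * ε) (0<half 0<ε)
    ... | N , b = N , λ m n N≤m N≤n → within m n N≤m N≤n (ℕₚ.≤-total m n)
      where
      within : ∀ m n → N ℕ.≤ m → N ℕ.≤ n → m ℕ.≤ n ⊎ n ℕ.≤ m → Within ε (s m) (s n)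
      within m n N≤m N≤n (inj₁ m≤n) with ℕₚ.m≤n⇒∃[o]m+o≡n m≤n
      ... | k , ≡.refl = let p , q = b m k N≤m in
          by< (<⇒0< (≤-<-trans q (half< 0<ε))) (solve 3 (λ x y e → e :- (:- (y :- x)) := y :+ e :- x) refl (s m) (s n) ε)
        , by< (<⇒0< (≤-<-trans p (half< 0<ε))) (solve 3 (λ x y e → e :- (y :- x) := x :+ e :- y) refl (s m) (s n) ε)
      within m n N≤m N≤n (inj₂ n≤m) with ℕₚ.m≤n⇒∃[o]m+o≡n n≤m
      ... | k , ≡.refl = let p , q = b n k N≤n in
          by< (<⇒0< (≤-<-trans p (half< 0<ε))) (solve 3 (λ x y e → e :- (x :- y) := y :+ e :- x) refl (s m) (s n) ε)
        , by< (<⇒0< (≤-<-trans q (half< 0<ε))) (solve 3 (λ x y e → e :- (:- (x :- y)) := x :+ e :- y) refl (s m) (s n) ε)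
  ... | l , lim = l , IsLimit⇒⟶ lim

  -- Partial sums of series

  series-cong : ∀ {f g : ℕ → Carrier} → (∀ n → f n ≈ g n) → ∀ N → series f N ≈ series g N
  series-cong f≈g N = sum-cong-≋ {N} (λ i → f≈g (toℕ i))

  series-split : ∀ f m k → series f (m ℕ.+ k) ≈ series f m + series (λ j → f (m ℕ.+ j)) k
  series-split f zero    k = sym (+-identityˡ _)
  series-split f (suc m) k = trans (+-congˡ (series-split (f ∘ suc) m k)) (sym (+-assoc _ _ _))

  series-snoc : ∀ f N → series f (suc N) ≈ series f N + f N
  series-snoc f zero    = trans (+-identityʳ _) (sym (+-identityˡ _))
  series-snoc f (suc N) = trans (+-congˡ (series-snoc (f ∘ suc) N)) (sym (+-assoc _ _ _))

  series-+ : ∀ f g N → series (λ n → f n + g n) N ≈ series f N + series g N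
  series-+ f g N = ∑-distrib-+ {N} (f ∘ toℕ) (g ∘ toℕ)

  series-scale : ∀ a f N → series (λ n → a * f n) N ≈ a * series f N
  series-scale a f N = sym (*-distribˡ-sum {N} a (f ∘ toℕ))

  series-nonneg : ∀ {f} → (∀ n → 0# ≤ f n) → ∀ N → 0# ≤ series f N
  series-nonneg 0≤f zero    = inj₂ refl
  series-nonneg 0≤f (suc N) = 0≤-+ (0≤f 0) (series-nonneg (0≤f ∘ suc) N)

  Bd-series : ∀ {f g} → (∀ n → Bd (g n) (f n)) → ∀ N → Bd (series g N) (series f N)
  Bd-series b zero    = Bd-self (inj₂ refl)
  Bd-series b (suc N) = Bd-+ (b 0) (Bd-series (b ∘ suc) N)

  -- Sine and cosine

  -- Weights with iⁿ = cosᵂ n + i sinᵂ n.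
  cosᵂ sinᵂ : ℕ → Carrier
  cosᵂ zero    = 1#
  cosᵂ (suc n) = - sinᵂ n
  sinᵂ zero    = 0#
  sinᵂ (suc n) = cosᵂ n

  Bd-cosᵂ : ∀ n → Bd 1# (cosᵂ n)
  Bd-sinᵂ : ∀ n → Bd 1# (sinᵂ n)
  Bd-cosᵂ zero    = Bd-self (inj₁ 0<1)
  Bd-cosᵂ (suc n) = Bd-neg (Bd-sinᵂ n)
  Bd-sinᵂ zero    = Bd-0 (inj₁ 0<1)
  Bd-sinᵂ (suc n) = Bd-cosᵂ n

  -- Real and imaginary part of the law of exponents for i. The addition formulas of cosine and sine
  -- are this identity, applied coefficient by coefficient in the Cauchy product.
  cosᵂ-+ : ∀ m n → cosᵂ (m ℕ.+ n) ≈ cosᵂ m * cosᵂ n - sinᵂ m * sinᵂ n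
  sinᵂ-+ : ∀ m n → sinᵂ (m ℕ.+ n) ≈ sinᵂ m * cosᵂ n + cosᵂ m * sinᵂ n
  cosᵂ-+ zero    n = solve 2 (λ c s → c := :1 :* c :- :0 :* s) refl (cosᵂ n) (sinᵂ n)
  cosᵂ-+ (suc m) n = trans (-‿cong (sinᵂ-+ m n))
    (solve 4 (λ c s c′ s′ → :- (s :* c′ :+ c :* s′) := :- s :* c′ :- c :* s′) refl (cosᵂ m) (sinᵂ m) (cosᵂ n) (sinᵂ n))
  sinᵂ-+ zero    n = solve 2 (λ c s → s := :0 :* c :+ :1 :* s) refl (cosᵂ n) (sinᵂ n)
  sinᵂ-+ (suc m) n = trans (cosᵂ-+ m n)
    (solve 4 (λ c s c′ s′ → c :* c′ :- s :* s′ := c :* c′ :+ :- s :* s′) refl (cosᵂ m) (sinᵂ m) (cosᵂ n) (sinᵂ n))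

  0<n! : ∀ n → 0# < fromℕ (n !)
  0<n! n = 0<fromℕ (ℕₚ.1≤n! n)

  0≤^ : ∀ {x} → 0# ≤ x → ∀ n → 0# ≤ x ^ n
  0≤^ 0≤x zero    = inj₁ 0<1
  0≤^ 0≤x (suc n) = 0≤-* 0≤x (0≤^ 0≤x n)

  opaque
    term : ℕ → Carrier → Carrier
    term n x = x ^ n * fromℕ (n !) ⁻¹

    term-def : ∀ n x → term n x ≈ x ^ n * fromℕ (n !) ⁻¹
    term-def n x = refl

    -- The recurrence of xⁿ/n! with the denominator cleared. It replaces most computation with
    -- factorials: decay of the terms, monotonicity and the binomial theorem all come from it.
    term-suc : ∀ n x → fromℕ (suc n) * term (suc n) x ≈ x * term n x
    term-suc n x = *-cancelˡ (>⇒≉ (0<n! n)) (begin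
      a * (s * (x * p * i))       ≈⟨ solve 5 (λ a s x p i → a :* (s :* (x :* p :* i)) := x :* p :* (s :* a :* i)) refl a s x p i ⟩
      x * p * (s * a * i)         ≈⟨ *-congˡ (*-congʳ (fromℕ-* (suc n) (n !))) ⟨
      x * p * (fromℕ (suc n !) * i) ≈⟨ *-congˡ (⁻¹-inverseʳ (>⇒≉ (0<n! (suc n)))) ⟩
      x * p * 1#                  ≈⟨ *-congˡ (⁻¹-inverseʳ (>⇒≉ (0<n! n))) ⟨
      x * p * (a * j)             ≈⟨ solve 4 (λ a x p j → x :* p :* (a :* j) := a :* (x :* (p :* j))) refl a x p j ⟩
      a * (x * (p * j))           ∎)
      where
      a s p i j : Carrier
      a = fromℕ (n !)
      s = fromℕ (suc n)
      p = x ^ n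
      i = fromℕ (suc n !) ⁻¹
      j = fromℕ (n !) ⁻¹

    term-cong : ∀ n {x y} → x ≈ y → term n x ≈ term n y
    term-cong n x≈y = *-congʳ (^-congˡ n x≈y)

    term-0 : ∀ x → term 0 x ≈ 1#
    term-0 x = trans (*-identityˡ _) (sym (⁻¹-unique (solve 0 ((:1 :+ :0) :* :1 := :1) refl)))

    0≤term : ∀ n {x} → 0# ≤ x → 0# ≤ term n x
    0≤term n 0≤x = 0≤-* (0≤^ 0≤x n) (inj₁ (0<⁻¹ (0<n! n)))

    Bd-term : ∀ n {A x} → Bd A x → Bd (term n A) (term n x)
    Bd-term n b = Bd-* (Bd-^ b n) (Bd-self (inj₁ (0<⁻¹ (0<n! n))))

  fromℕ-suc≉0 : ∀ n → ¬ fromℕ (suc n) ≈ 0#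
  fromℕ-suc≉0 n = >⇒≉ (0<fromℕ {suc n} (ℕ.s≤s ℕ.z≤n))

  -- Convergence of the exponential series

  module _ {x} (0≤x : 0# ≤ x) where

    private
      -- A natural number beyond 2x. From there on the ratio x/(n + 1) of consecutive terms is at
      -- most 1/2, so tails are indexed as `bound + n`.
      bound : ℕ
      bound = proj₁ (archimedean (2# * x))

      2x≤ : ∀ n → 2# * x ≤ fromℕ (suc (bound ℕ.+ n))
      2x≤ n = ≤-trans (inj₁ (proj₂ (archimedean (2# * x)))) (fromℕ-mono-≤ (ℕₚ.m≤n⇒m≤1+n (ℕₚ.m≤m+n bound n)))

    term-halves : ∀ n → 2# * term (suc (bound ℕ.+ n)) x ≤ term (bound ℕ.+ n) x
    term-halves n = *-cancelˡ-≤ (0<fromℕ {suc (bound ℕ.+ n)} (ℕ.s≤s ℕ.z≤n))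
        (≤-respˡ eq (*-mono-≤ (0≤fromℕ (suc (bound ℕ.+ n))) (0≤term (bound ℕ.+ n) 0≤x) (2x≤ n) ≤-refl))
      where
      eq : 2# * x * term (bound ℕ.+ n) x ≈ fromℕ (suc (bound ℕ.+ n)) * (2# * term (suc (bound ℕ.+ n)) x)
      eq = trans (*-assoc _ _ _) (trans (*-congˡ (sym (term-suc (bound ℕ.+ n) x)))
        (solve 3 (λ h s t → h :* (s :* t) := s :* (h :* t)) refl 2# (fromℕ (suc (bound ℕ.+ n))) (term (suc (bound ℕ.+ n)) x)))

    -- Comparison with a geometric series of ratio 1/2. By induction the rest after the leading term
    -- is at most twice the next term, which is at most the leading term itself.
    tail-bound : ∀ n k → series (λ j → term (bound ℕ.+ n ℕ.+ j) x) k ≤ 2# * term (bound ℕ.+ n) x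
    tail-bound n zero    = 0≤-* (inj₁ 0<2) (0≤term (bound ℕ.+ n) 0≤x)
    tail-bound n (suc k) = ≤-respˡ (+-cong head tail) (≤-respʳ (sym (solve 1 (λ t → :2 :* t := t :+ t) refl _))
      (+-mono-≤ ≤-refl (≤-trans (tail-bound (suc n) k) (≤-respˡ (*-congˡ (reflexive (≡.cong
          (λ m → term m x) (≡.sym (ℕₚ.+-suc bound n))))) (term-halves n)))))
      where
      head = reflexive (≡.cong (λ m → term m x) (≡.sym (ℕₚ.+-identityʳ (bound ℕ.+ n))))
      tail = series-cong (λ j → reflexive (≡.cong (λ m → term m x)
        (≡.trans (≡.cong (ℕ._+ j) (ℕₚ.+-suc bound n)) (≡.sym (ℕₚ.+-suc (bound ℕ.+ n) j))))) k

    term≤ : ∀ n → term (bound ℕ.+ n) x ≤ term bound x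
    term≤ zero    = inj₂ (reflexive (≡.cong (λ m → term m x) (ℕₚ.+-identityʳ bound)))
    term≤ (suc n) = ≤-respˡ (reflexive (≡.cong (λ m → term m x) (≡.sym (ℕₚ.+-suc bound n))))
      (≤-trans (by≤ (0≤term (suc (bound ℕ.+ n)) 0≤x) (solve 1 (λ t → t := :2 :* t :- t) refl (term (suc (bound ℕ.+ n)) x)))
               (≤-trans (term-halves n) (term≤ n)))

    -- Since n + 1 ≤ bound + n + 1, the recurrence gives (n + 1) · `term (bound + n + 1) x` ≤ x ·
    -- `term (bound + n) x`, and beyond `bound` no term exceeds `term bound x`; this is the constant
    -- passed to `Null-O[1/n]`.
    term-null : Null (λ n → term (bound ℕ.+ suc n) x)
    term-null = Null-O[1/n] (x * term bound x) (λ n → 0≤term (bound ℕ.+ suc n) 0≤x) λ n →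
      ≤-respˡ (*-congˡ (reflexive (≡.cong (λ m → term m x) (≡.sym (ℕₚ.+-suc bound n)))))
      (≤-trans (*-mono-≤ (0≤fromℕ (suc (bound ℕ.+ n))) (0≤term (suc (bound ℕ.+ n)) 0≤x) (fromℕ-mono-≤ {suc n} {suc (bound ℕ.+ n)} (ℕ.s≤s (ℕₚ.m≤n+m n bound))) ≤-refl)
      (≤-trans (inj₂ (term-suc (bound ℕ.+ n) x)) (*-monoˡ-≤ 0≤x (term≤ n))))

    private
      tail-bound′ : ∀ N d k →
        series (λ j → term (bound ℕ.+ suc N ℕ.+ d ℕ.+ j) x) k ≤ 2# * term (bound ℕ.+ suc (N ℕ.+ d)) x
      tail-bound′ N d k = ≤-respˡ
        (series-cong (λ j → reflexive (≡.cong (λ m → term (m ℕ.+ j) x) (≡.sym (ℕₚ.+-assoc bound (suc N) d)))) k)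
        (tail-bound (suc (N ℕ.+ d)) k)

    exp-cauchy : ∀ ε → 0# < ε → ∃[ N ] (∀ n k → N ℕ.≤ n → series (λ j → term (n ℕ.+ j) x) k ≤ ε)
    exp-cauchy ε 0<ε = bound ℕ.+ suc N , lemma
      where
      N : ℕ
      N = proj₁ (term-null (½ * ε) (0<half 0<ε))
      small : ∀ d → 2# * term (bound ℕ.+ suc (N ℕ.+ d)) x ≤ ε
      small d = ≤-respʳ (trans (solve 1 (λ h → :2 :* h := h :+ h) refl (½ * ε)) (halve ε))
        (*-monoˡ-≤ (inj₁ 0<2) (proj₁ (proj₂ (term-null (½ * ε) (0<half 0<ε)) (N ℕ.+ d) (ℕₚ.m≤m+n N d))))
      lemma : ∀ n k → bound ℕ.+ suc N ℕ.≤ n → series (λ j → term (n ℕ.+ j) x) k ≤ ε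
      lemma n k le = ≡.subst (λ m → series (λ j → term (m ℕ.+ j) x) k ≤ ε) (ℕₚ.m+[n∸m]≡n le)
        (≤-trans (tail-bound′ N _ k) (small _))

  -- Cosine and sine are exponential series with weights of modulus at most 1, so convergence and
  -- the Cauchy product are proved once for all such weights.
  weighted : (ℕ → Carrier) → Carrier → ℕ → Carrier
  weighted w x = series (λ n → w n * term n x)

  weighted-cong : ∀ w {x y} → x ≈ y → ∀ N → weighted w x N ≈ weighted w y N
  weighted-cong w x≈y = series-cong (λ n → *-congˡ {w n} (term-cong n x≈y))

  -- Absolute convergence: each block at x is dominated by the same block of the exponential series
  -- at ‖x‖.
  weighted-converges : ∀ {w} → (∀ n → Bd 1# (w n)) → ∀ x → ∃[ l ] weighted w x ⟶ l
  weighted-converges {w} bw x = ⟶-complete _ λ ε 0<ε →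
    let N , h = exp-cauchy (Bd-nonneg (Bd-‖‖ x)) ε 0<ε in
    N , λ n k N≤n → Bd-mono (h n k N≤n) (Bd-cong refl
      (trans (solve 2 (λ a b → b := a :+ b :- a) refl _ _) (+-congʳ (sym (series-split (λ n → w n * term n x) n k))))
      (Bd-series (λ j → Bd-cong (*-identityˡ _) refl (Bd-* (bw (n ℕ.+ j)) (Bd-term (n ℕ.+ j) (Bd-‖‖ x)))) k))

  -- Sums of f i j over i < R, j < C; over i + j < N; and over i + j = n.

  rect : ℕ → ℕ → (ℕ → ℕ → Carrier) → Carrier
  rect R C f = series (λ i → series (f i) C) R

  tri : ℕ → (ℕ → ℕ → Carrier) → Carrier
  tri zero    f = 0#
  tri (suc N) f = series (f 0) (suc N) + tri N (f ∘ suc)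

  diag : ℕ → (ℕ → ℕ → Carrier) → Carrier
  diag zero    f = f 0 0
  diag (suc n) f = f 0 (suc n) + diag n (f ∘ suc)

  rect-cong : ∀ R C {f g} → (∀ i j → f i j ≈ g i j) → rect R C f ≈ rect R C g
  rect-cong R C f≈g = series-cong (λ i → series-cong (f≈g i) C) R

  rect-+ : ∀ R C f g → rect R C (λ i j → f i j + g i j) ≈ rect R C f + rect R C g
  rect-+ R C f g = trans (series-cong (λ i → series-+ (f i) (g i) C) R) (series-+ (λ i → series (f i) C) (λ i → series (g i) C) R)

  rect-neg : ∀ R C f → rect R C (λ i j → - f i j) ≈ - rect R C f
  rect-neg R C f = begin
    rect R C (λ i j → - f i j)       ≈⟨ rect-cong R C (λ i j → -1*x≈-x (f i j)) ⟨
    rect R C (λ i j → - 1# * f i j)  ≈⟨ series-cong (λ i → series-scale (- 1#) (f i) C) R ⟩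
    series (λ i → - 1# * series (f i) C) R  ≈⟨ series-scale (- 1#) (λ i → series (f i) C) R ⟩
    - 1# * rect R C f                ≈⟨ -1*x≈-x _ ⟩
    - rect R C f                     ∎

  rect-* : ∀ u v R C → rect R C (λ i j → u i * v j) ≈ series u R * series v C
  rect-* u v R C = begin
    rect R C (λ i j → u i * v j)        ≈⟨ series-cong (λ i → trans (series-scale (u i) v C) (*-comm _ _)) R ⟩
    series (λ i → series v C * u i) R   ≈⟨ series-scale (series v C) u R ⟩
    series v C * series u R             ≈⟨ *-comm _ _ ⟩
    series u R * series v C             ∎

  tri-+ : ∀ N f g → tri N (λ i j → f i j + g i j) ≈ tri N f + tri N g
  tri-+ zero    f g = sym (+-identityˡ 0#)
  tri-+ (suc N) f g = trans (+-cong (series-+ (f 0) (g 0) (suc N)) (tri-+ N (f ∘ suc) (g ∘ suc)))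
    (solve 4 (λ a b c d → a :+ b :+ (c :+ d) := a :+ c :+ (b :+ d)) refl _ _ _ _)

  tri-neg : ∀ N f → tri N (λ i j → - f i j) ≈ - tri N f
  tri-neg zero    f = sym -0#≈0#
  tri-neg (suc N) f = trans (+-cong (trans (series-cong (λ i → sym (-1*x≈-x (f 0 i))) (suc N))
      (trans (series-scale (- 1#) (f 0) (suc N)) (-1*x≈-x _))) (tri-neg N (f ∘ suc)))
    (solve 2 (λ a b → :- a :+ :- b := :- (a :+ b)) refl _ _)

  tri-snoc : ∀ N f → tri (suc N) f ≈ tri N f + diag N f
  tri-snoc zero    f = solve 1 (λ a → a :+ :0 :+ :0 := :0 :+ a) refl (f 0 0)
  tri-snoc (suc N) f = trans (+-cong (series-snoc (f 0) (suc N)) (tri-snoc N (f ∘ suc)))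
    (solve 4 (λ a b c d → a :+ b :+ (c :+ d) := a :+ c :+ (b :+ d)) refl _ _ _ _)

  tri≈series-diag : ∀ N f → tri N f ≈ series (λ n → diag n f) N
  tri≈series-diag zero    f = refl
  tri≈series-diag (suc N) f = trans (tri-snoc N f) (trans (+-congʳ (tri≈series-diag N f)) (sym (series-snoc (λ n → diag n f) N)))

  series-mono : ∀ {f} → (∀ n → 0# ≤ f n) → ∀ {M N} → M ℕ.≤ N → series f M ≤ series f N
  series-mono {f} 0≤f {M} M≤N with ℕₚ.m≤n⇒∃[o]m+o≡n M≤N
  ... | k , ≡.refl = by≤ (series-nonneg (λ j → 0≤f (M ℕ.+ j)) k)
    (trans (solve 2 (λ a b → b := a :+ b :- a) refl _ _) (+-congʳ (sym (series-split f M k))))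

  -- Together with `rect≤tri` this places the square of side N between the triangles of sizes N and
  -- 2N. The excess of the square over the smaller triangle is then bounded by a difference of two
  -- triangles, and that difference is a block of a single series.
  tri≤rect : ∀ {f} → (∀ i j → 0# ≤ f i j) → ∀ {N C} → N ℕ.≤ C → tri N f ≤ rect N C f
  tri≤rect 0≤f {zero}  N≤C = ≤-refl
  tri≤rect 0≤f {suc N} N≤C = +-mono-≤ (series-mono (0≤f 0) N≤C) (tri≤rect (0≤f ∘ suc) (ℕₚ.<⇒≤ N≤C))

  rect≤tri : ∀ {f} → (∀ i j → 0# ≤ f i j) → ∀ {R C N} → R ℕ.+ C ℕ.≤ N → rect R C f ≤ tri N f
  rect≤tri 0≤f {zero}  {C} {zero} le = ≤-refl
  rect≤tri 0≤f {zero}  {C} {suc N} le = 0≤-+ (series-nonneg (0≤f 0) (suc N)) (rect≤tri (0≤f ∘ suc) {zero} {zero} {N} ℕ.z≤n)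
  rect≤tri 0≤f {suc R} {C} {suc N} (ℕ.s≤s le) =
    +-mono-≤ (series-mono (0≤f 0) (ℕₚ.m≤n⇒m≤1+n (ℕₚ.≤-trans (ℕₚ.m≤n+m C R) le))) (rect≤tri (0≤f ∘ suc) {R} {C} le)

  -- Off the triangle, the square sum of f is dominated by that of g ≥ |f|:
  -- compare square and triangle for the nonnegative arrays g ± f.
  Bd-rect-tri : ∀ {f g} → (∀ i j → Bd (g i j) (f i j)) → ∀ N →
    Bd (rect N N g - tri N g) (rect N N f - tri N f)
  Bd-rect-tri {f} {g} b N =
      by≤ (≤⇒0≤ (tri≤rect {f = λ i j → g i j - f i j} (λ i j → ≤⇒0≤ (proj₁ (b i j))) {N} ℕₚ.≤-refl))
        (trans (+-cong (trans (rect-+ N N g (λ i j → - f i j)) (+-congˡ (rect-neg N N f))) (-‿cong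
            (trans (tri-+ N g (λ i j → - f i j)) (+-congˡ (tri-neg N f)))))
          (solve 4 (λ a b c d → a :- b :- (c :- d) := a :- c :- (b :- d)) refl _ _ _ _))
    , by≤ (≤⇒0≤ (tri≤rect {f = λ i j → g i j + f i j}
        (λ i j → ≤-respʳ (+-congˡ (-‿involutive _)) (≤⇒0≤ (proj₂ (b i j)))) {N} ℕₚ.≤-refl))
        (trans (+-cong (rect-+ N N g f) (-‿cong (tri-+ N g f)))
          (solve 4 (λ a b c d → a :+ b :- (c :+ d) := a :- c :- :- (b :- d)) refl _ _ _ _))

  diag-cong : ∀ n {f g} → (∀ i j → f i j ≈ g i j) → diag n f ≈ diag n g
  diag-cong zero    f≈g = f≈g 0 0
  diag-cong (suc n) f≈g = +-cong (f≈g 0 (suc n)) (diag-cong n (f≈g ∘ suc))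

  diag-scale : ∀ n (w : ℕ → Carrier) (f : ℕ → ℕ → Carrier) → diag n (λ i j → w (i ℕ.+ j) * f i j) ≈ w n * diag n f
  diag-scale zero    w f = refl
  diag-scale (suc n) w f = trans (+-congˡ (diag-scale n (w ∘ suc) (f ∘ suc))) (sym (distribˡ _ _ _))

  diag-+ : ∀ n f g → diag n (λ i j → f i j + g i j) ≈ diag n f + diag n g
  diag-+ zero    f g = refl
  diag-+ (suc n) f g = trans (+-congˡ (diag-+ n (f ∘ suc) (g ∘ suc)))
    (solve 4 (λ a b c d → a :+ b :+ (c :+ d) := a :+ c :+ (b :+ d)) refl _ _ _ _)

  diag-snoc : ∀ n f → diag (suc n) f ≈ diag n (λ i j → f i (suc j)) + f (suc n) 0
  diag-snoc zero    f = refl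
  diag-snoc (suc n) f = trans (+-congˡ (diag-snoc n (f ∘ suc))) (sym (+-assoc _ _ _))

  -- The binomial theorem for xⁿ/n!, by induction through
  -- (n+1) Dₙ₊₁ = (x + y) Dₙ, where i + j = n + 1 is split into its summands.
  diag-term : ∀ x y n → diag n (λ i j → term i x * term j y) ≈ term n (x + y)
  diag-term x y zero    = trans (*-cong (term-0 x) (term-0 y)) (trans (*-identityˡ 1#) (sym (term-0 (x + y))))
  diag-term x y (suc n) = *-cancelˡ (fromℕ-suc≉0 n) (begin
    fromℕ (suc n) * diag (suc n) f
      ≈⟨ diag-scale (suc n) fromℕ f ⟨
    diag (suc n) (λ i j → fromℕ (i ℕ.+ j) * f i j)
      ≈⟨ diag-cong (suc n) (λ i j → trans (*-congʳ (fromℕ-+ i j)) (distribʳ (f i j) (fromℕ i) (fromℕ j))) ⟩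
    diag (suc n) (λ i j → fromℕ i * f i j + fromℕ j * f i j)
      ≈⟨ diag-+ (suc n) (λ i j → fromℕ i * f i j) (λ i j → fromℕ j * f i j) ⟩
    diag (suc n) (λ i j → fromℕ i * f i j) + diag (suc n) (λ i j → fromℕ j * f i j)
      ≈⟨ +-congˡ (diag-snoc n (λ i j → fromℕ j * f i j)) ⟩
    0# * f 0 (suc n) + diag n (λ i j → fromℕ (suc i) * f (suc i) j)
      + (diag n (λ i j → fromℕ (suc j) * f i (suc j)) + 0# * f (suc n) 0)
      ≈⟨ solve 4 (λ a p q b → :0 :* a :+ p :+ (q :+ :0 :* b) := p :+ q) refl (f 0 (suc n)) _ _ (f (suc n) 0) ⟩
    diag n (λ i j → fromℕ (suc i) * f (suc i) j) + diag n (λ i j → fromℕ (suc j) * f i (suc j))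
      ≈⟨ +-cong (diag-cong n (λ i j → trans (sym (*-assoc _ _ _)) (trans (*-congʳ (term-suc i x)) (*-assoc _ _ _))))
                (diag-cong n (λ i j → trans (solve 3 (λ s a b → s :* (a :* b) := a :* (s :* b)) refl _ _ _)
                   (trans (*-congˡ (term-suc j y)) (solve 3 (λ a y b → a :* (y :* b) := y :* (a :* b)) refl _ _ _)))) ⟩
    diag n (λ i j → x * f i j) + diag n (λ i j → y * f i j)
      ≈⟨ +-cong (diag-scale n (λ _ → x) f) (diag-scale n (λ _ → y) f) ⟩
    x * diag n f + y * diag n f
      ≈⟨ distribʳ _ x y ⟨
    (x + y) * diag n f
      ≈⟨ *-congˡ (diag-term x y n) ⟩
    (x + y) * term n (x + y)
      ≈⟨ term-suc n (x + y) ⟨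
    fromℕ (suc n) * term (suc n) (x + y) ∎)
    where
    f : ℕ → ℕ → Carrier
    f i j = term i x * term j y

  -- The weight depends only on i + j, so on the triangle the double sum collapses, by `diag-term`,
  -- to the series at x + y. The rest of the square is dominated by the N terms from index N on of
  -- the exponential series at ‖x‖ + ‖y‖. The square is factored only afterwards, by the addition
  -- laws of the weights.
  cauchy-product : ∀ {w} → (∀ n → Bd 1# (w n)) → ∀ x y →
    Null (λ N → rect N N (λ i j → w (i ℕ.+ j) * (term i x * term j y)) - weighted w (x + y) N)
  cauchy-product {w} bw x y = Null-cong (λ N → +-congˡ (-‿cong (tri≈weighted N))) (Null-dom bound small)
    where
    f g : ℕ → ℕ → Carrier
    f i j = w (i ℕ.+ j) * (term i x * term j y)
    g i j = term i ‖ x ‖ * term j ‖ y ‖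
    z = ‖ x ‖ + ‖ y ‖
    0≤z : 0# ≤ z
    0≤z = 0≤-+ (Bd-nonneg (Bd-‖‖ x)) (Bd-nonneg (Bd-‖‖ y))
    0≤g : ∀ i j → 0# ≤ g i j
    0≤g i j = 0≤-* (0≤term i (Bd-nonneg (Bd-‖‖ x))) (0≤term j (Bd-nonneg (Bd-‖‖ y)))
    tri≈weighted : ∀ N → tri N f ≈ weighted w (x + y) N
    tri≈weighted N = trans (tri≈series-diag N f)
      (series-cong (λ n → trans (diag-scale n w (λ i j → term i x * term j y)) (*-congˡ (diag-term x y n))) N)
    tri≈exp : ∀ N → tri N g ≈ series (λ n → term n z) N
    tri≈exp N = trans (tri≈series-diag N g) (series-cong (diag-term ‖ x ‖ ‖ y ‖) N)
    tail : ∀ N → rect N N g - tri N g ≤ series (λ j → term (N ℕ.+ j) z) N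
    tail N = by≤ (≤⇒0≤ (rect≤tri 0≤g {N} {N} ℕₚ.≤-refl))
      (trans (+-congʳ (trans (tri≈exp (N ℕ.+ N)) (trans (series-split (λ n → term n z) N N) (+-congʳ (sym (tri≈exp N))))))
        (solve 3 (λ t r u → t :+ u :- r := u :- (r :- t)) refl (tri N g) (rect N N g) (series (λ j → term (N ℕ.+ j) z) N)))
    bound : ∀ N → Bd (series (λ j → term (N ℕ.+ j) z) N) (rect N N f - tri N f)
    bound N = Bd-mono (tail N) (Bd-rect-tri
      (λ i j → Bd-cong (*-identityˡ _) refl (Bd-* (bw (i ℕ.+ j)) (Bd-* (Bd-term i (Bd-‖‖ x)) (Bd-term j (Bd-‖‖ y))))) N)
    small : Null (λ N → series (λ j → term (N ℕ.+ j) z) N)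
    small ε 0<ε = proj₁ (exp-cauchy 0≤z ε 0<ε) , λ n N≤n → Bd-mono (proj₂ (exp-cauchy 0≤z ε 0<ε) n n N≤n)
        (Bd-self (series-nonneg (λ j → 0≤term (n ℕ.+ j) 0≤z) n))

  -- Cosine, sine and their addition formulas

  opaque
    cos sin : Carrier → Carrier
    cos x = proj₁ (weighted-converges Bd-cosᵂ x)
    sin x = proj₁ (weighted-converges Bd-sinᵂ x)

    cos-limit : ∀ x → weighted cosᵂ x ⟶ cos x
    cos-limit x = proj₂ (weighted-converges Bd-cosᵂ x)

    sin-limit : ∀ x → weighted sinᵂ x ⟶ sin x
    sin-limit x = proj₂ (weighted-converges Bd-sinᵂ x)

  cos-cong : ∀ {x y} → x ≈ y → cos x ≈ cos y
  cos-cong x≈y = ⟶-unique (⟶-cong (weighted-cong cosᵂ x≈y) refl (cos-limit _)) (cos-limit _)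

  sin-cong : ∀ {x y} → x ≈ y → sin x ≈ sin y
  sin-cong x≈y = ⟶-unique (⟶-cong (weighted-cong sinᵂ x≈y) refl (sin-limit _)) (sin-limit _)

  rect-weighted : ∀ u v x y N → rect N N (λ i j → u i * v j * (term i x * term j y)) ≈ weighted u x N * weighted v y N
  rect-weighted u v x y N = trans
    (rect-cong N N (λ i j → solve 4 (λ a b c d → a :* b :* (c :* d) := a :* c :* (b :* d)) refl (u i) (v j) (term i x) (term j y)))
    (rect-* (λ n → u n * term n x) (λ n → v n * term n y) N N)

  cos-+ : ∀ x y → cos (x + y) ≈ cos x * cos y - sin x * sin y
  cos-+ x y = ⟶-unique (cos-limit (x + y)) (⟶-null (cauchy-product Bd-cosᵂ x y)
    (⟶-cong (λ N → sym (expand N)) refl (⟶-+ (⟶-* (cos-limit x) (cos-limit y)) (⟶-neg (⟶-* (sin-limit x) (sin-limit y))))))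
    where
    expand : ∀ N → rect N N (λ i j → cosᵂ (i ℕ.+ j) * (term i x * term j y))
      ≈ weighted cosᵂ x N * weighted cosᵂ y N - weighted sinᵂ x N * weighted sinᵂ y N
    expand N = trans (rect-cong N N λ i j → trans (*-congʳ (cosᵂ-+ i j))
        (solve 3 (λ a b t → (a :- b) :* t := a :* t :+ :- (b :* t)) refl (cosᵂ i * cosᵂ j) (sinᵂ i * sinᵂ j) (term i x * term j y)))
      (trans (rect-+ N N (λ i j → cosᵂ i * cosᵂ j * (term i x * term j y)) (λ i j → - (sinᵂ i * sinᵂ j * (term i x * term j y))))
        (+-cong (rect-weighted cosᵂ cosᵂ x y N)
          (trans (rect-neg N N (λ i j → sinᵂ i * sinᵂ j * (term i x * term j y))) (-‿cong (rect-weighted sinᵂ sinᵂ x y N)))))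

  sin-+ : ∀ x y → sin (x + y) ≈ sin x * cos y + cos x * sin y
  sin-+ x y = ⟶-unique (sin-limit (x + y)) (⟶-null (cauchy-product Bd-sinᵂ x y)
    (⟶-cong (λ N → sym (expand N)) refl (⟶-+ (⟶-* (sin-limit x) (cos-limit y)) (⟶-* (cos-limit x) (sin-limit y)))))
    where
    expand : ∀ N → rect N N (λ i j → sinᵂ (i ℕ.+ j) * (term i x * term j y))
      ≈ weighted sinᵂ x N * weighted cosᵂ y N + weighted cosᵂ x N * weighted sinᵂ y N
    expand N = trans (rect-cong N N λ i j → trans (*-congʳ (sinᵂ-+ i j)) (distribʳ (term i x * term j y) (sinᵂ i * cosᵂ j) (cosᵂ i * sinᵂ j)))
      (trans (rect-+ N N (λ i j → sinᵂ i * cosᵂ j * (term i x * term j y))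
          (λ i j → cosᵂ i * sinᵂ j * (term i x * term j y))) (+-cong (rect-weighted sinᵂ cosᵂ x y N) (rect-weighted cosᵂ sinᵂ x y N)))

  -- The number π

  term-suc-0 : ∀ n → term (suc n) 0# ≈ 0#
  term-suc-0 n = x*y≈0⇒y≈0 (fromℕ-suc≉0 n) (trans (term-suc n 0#) (zeroˡ (term n 0#)))

  weighted-0 : ∀ w N → weighted w 0# (suc N) ≈ w 0
  weighted-0 w N = begin
    w 0 * term 0 0# + series (λ n → w (suc n) * term (suc n) 0#) N
      ≈⟨ +-cong (*-congˡ (term-0 0#)) (series-cong (λ n → trans (*-congˡ (term-suc-0 n)) (zeroʳ (w (suc n)))) N) ⟩
    w 0 * 1# + series (λ _ → 0#) N
      ≈⟨ +-cong (*-identityʳ (w 0)) (series-0 N) ⟩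
    w 0 + 0#
      ≈⟨ +-identityʳ (w 0) ⟩
    w 0 ∎
    where
    series-0 : ∀ N → series (λ _ → 0#) N ≈ 0#
    series-0 zero    = refl
    series-0 (suc N) = trans (+-identityˡ _) (series-0 N)

  ⟶-suc : ∀ {s l} → s ⟶ l → (s ∘ suc) ⟶ l
  ⟶-suc = Null-subseq suc ℕₚ.n≤1+n

  cos-0 : cos 0# ≈ 1#
  cos-0 = ⟶-unique (⟶-suc (cos-limit 0#)) (⟶-cong (λ N → sym (weighted-0 cosᵂ N)) refl (⟶-const 1#))

  -- The cosine weights vanish at odd n and the sine weights at even n. Multiplication by (-1)ⁿ
  -- expresses both facts without a case distinction on parity, in the form used for cos(-x) and
  -- sin(-x).
  cosᵂ-parity : ∀ n → cosᵂ n * (- 1#) ^ n ≈ cosᵂ n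
  sinᵂ-parity : ∀ n → sinᵂ n * (- 1#) ^ n ≈ - sinᵂ n
  cosᵂ-parity zero    = *-identityˡ 1#
  cosᵂ-parity (suc n) = trans (solve 2 (λ s p → :- s :* (:- :1 :* p) := s :* p) refl (sinᵂ n) ((- 1#) ^ n)) (sinᵂ-parity n)
  sinᵂ-parity zero    = solve 0 (:0 :* :1 := :- :0) refl
  sinᵂ-parity (suc n) = trans (solve 2 (λ c p → c :* (:- :1 :* p) := :- (c :* p)) refl (cosᵂ n) ((- 1#) ^ n)) (-‿cong (cosᵂ-parity n))

  term-neg : ∀ n x → term n (- x) ≈ (- 1#) ^ n * term n x
  term-neg n x = begin
    term n (- x)                    ≈⟨ term-def n (- x) ⟩
    (- x) ^ n * i                   ≈⟨ *-congʳ (^-congˡ n (solve 1 (λ x → :- x := :- :1 :* x) refl x)) ⟩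
    (- 1# * x) ^ n * i              ≈⟨ *-congʳ (^-distrib-* (- 1#) x n) ⟩
    (- 1#) ^ n * x ^ n * i          ≈⟨ *-assoc _ _ _ ⟩
    (- 1#) ^ n * (x ^ n * i)        ≈⟨ *-congˡ (term-def n x) ⟨
    (- 1#) ^ n * term n x           ∎
    where i = fromℕ (n !) ⁻¹

  cos-neg : ∀ x → cos (- x) ≈ cos x
  cos-neg x = ⟶-unique (cos-limit (- x)) (⟶-cong (λ N → sym (series-cong eq N)) refl (cos-limit x))
    where
    eq : ∀ n → cosᵂ n * term n (- x) ≈ cosᵂ n * term n x
    eq n = trans (*-congˡ (term-neg n x)) (trans (sym (*-assoc (cosᵂ n) ((- 1#) ^ n) (term n x))) (*-congʳ (cosᵂ-parity n)))

  sin-neg : ∀ x → sin (- x) ≈ - sin x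
  sin-neg x = ⟶-unique (sin-limit (- x))
    (⟶-cong (λ N → trans (solve 1 (λ s → :- s := :- :1 :* s) refl (weighted sinᵂ x N))
        (trans (sym (series-scale (- 1#) (λ n → sinᵂ n * term n x) N)) (sym (series-cong eq N)))) refl (⟶-neg (sin-limit x)))
    where
    eq : ∀ n → sinᵂ n * term n (- x) ≈ - 1# * (sinᵂ n * term n x)
    eq n = trans (*-congˡ (term-neg n x)) (trans (sym (*-assoc (sinᵂ n) ((- 1#) ^ n) (term n x)))
      (trans (*-congʳ (sinᵂ-parity n)) (solve 2 (λ s t → :- s :* t := :- :1 :* (s :* t)) refl (sinᵂ n) (term n x))))

  cos-sub : ∀ x y → cos (x - y) ≈ cos x * cos y + sin x * sin y
  cos-sub x y = begin
    cos (x - y)                                  ≈⟨ cos-+ x (- y) ⟩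
    cos x * cos (- y) - sin x * sin (- y)        ≈⟨ +-cong (*-congˡ (cos-neg y)) (-‿cong (*-congˡ (sin-neg y))) ⟩
    cos x * cos y - sin x * - sin y              ≈⟨ solve 3 (λ p s t → p :- s :* :- t := p :+ s :* t)
        refl (cos x * cos y) (sin x) (sin y) ⟩
    cos x * cos y + sin x * sin y                ∎

  sin-sub : ∀ x y → sin (x - y) ≈ sin x * cos y - cos x * sin y
  sin-sub x y = begin
    sin (x - y)                                  ≈⟨ sin-+ x (- y) ⟩
    sin x * cos (- y) + cos x * sin (- y)        ≈⟨ +-cong (*-congˡ (cos-neg y)) (*-congˡ (sin-neg y)) ⟩
    sin x * cos y + cos x * - sin y              ≈⟨ solve 3 (λ p s t → p :+ s :* :- t := p :- s :* t)
        refl (sin x * cos y) (cos x) (sin y) ⟩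
    sin x * cos y - cos x * sin y                ∎

  cos²+sin²≈1 : ∀ x → cos x * cos x + sin x * sin x ≈ 1#
  cos²+sin²≈1 x = trans (sym (cos-sub x x)) (trans (cos-cong (-‿inverseʳ x)) cos-0)

  cos-double : ∀ x → cos (x + x) ≈ 2# * (cos x * cos x) - 1#
  cos-double x = trans (cos-+ x x) (trans (+-congˡ (-‿cong eq))
    (solve 1 (λ p → p :- (:1 :- p) := :2 :* p :- :1) refl (cos x * cos x)))
    where
    eq : sin x * sin x ≈ 1# - cos x * cos x
    eq = trans (solve 2 (λ p q → q := p :+ q :- p) refl (cos x * cos x) (sin x * sin x)) (+-congʳ (cos²+sin²≈1 x))

  -- Alternating series and bounds for the sine

  series-peel : ∀ (d : ℕ → Carrier) N → series (λ n → cosᵂ n * d n) (suc (suc N))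
    ≈ d 0 - series (λ n → cosᵂ n * d (suc (suc n))) N
  series-peel d N = begin
    1# * d 0 + (- 0# * d 1 + series (λ n → - cosᵂ n * d (suc (suc n))) N)
      ≈⟨ solve 3 (λ a b s → :1 :* a :+ (:- :0 :* b :+ s) := a :+ s) refl (d 0) (d 1) _ ⟩
    d 0 + series (λ n → - cosᵂ n * d (suc (suc n))) N
      ≈⟨ +-congˡ (series-cong (λ n → solve 2 (λ c t → :- c :* t := :- :1 :* (c :* t)) refl (cosᵂ n) (d (suc (suc n)))) N) ⟩
    d 0 + series (λ n → - 1# * (cosᵂ n * d (suc (suc n)))) N
      ≈⟨ +-congˡ (series-scale (- 1#) (λ n → cosᵂ n * d (suc (suc n))) N) ⟩
    d 0 + - 1# * series (λ n → cosᵂ n * d (suc (suc n))) N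
      ≈⟨ solve 2 (λ a s → a :+ :- :1 :* s := a :- s) refl (d 0) _ ⟩
    d 0 - series (λ n → cosᵂ n * d (suc (suc n))) N ∎

  -- Leibniz's estimate, by induction in steps of two: peeling writes the sum as d 0 - S, where 0 ≤
  -- S ≤ d 2 ≤ d 0 by the induction hypothesis.
  alternating : ∀ {d : ℕ → Carrier} → (∀ n → 0# ≤ d n) → (∀ n → d (suc n) ≤ d n) → ∀ N →
    (0# ≤ series (λ n → cosᵂ n * d n) N) × (series (λ n → cosᵂ n * d n) N ≤ d 0)
  alternating 0≤d d↓ zero          = ≤-refl , 0≤d 0
  alternating {d} 0≤d d↓ (suc zero) = ≤-respʳ eq (0≤d 0) , inj₂ (sym eq)
    where
    eq : d 0 ≈ 1# * d 0 + 0#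
    eq = sym (trans (+-identityʳ _) (*-identityˡ _))
  alternating {d} 0≤d d↓ (suc (suc N)) with alternating {λ n → d (suc (suc n))} (λ n → 0≤d (suc (suc n))) (λ n → d↓ (suc (suc n))) N
  ... | lo , hi =
      ≤-respʳ (sym (series-peel d N)) (≤⇒0≤ (≤-trans hi (≤-trans (d↓ 1) (d↓ 0))))
    , ≤-respˡ (sym (series-peel d N)) (by≤ lo (solve 2 (λ a s → s := a :- (a :- s)) refl (d 0) _))

  -- Dropping the vanishing constant term shifts the sine weights into cosine weights, which is the
  -- shape that `alternating` bounds.
  sin-limit′ : ∀ x → (λ N → series (λ n → cosᵂ n * term (suc n) x) N) ⟶ sin x
  sin-limit′ x = ⟶-cong (λ N → trans (+-congʳ (zeroˡ (term 0 x))) (+-identityˡ _)) refl (⟶-suc (sin-limit x))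

  term-1 : ∀ x → term 1 x ≈ x
  term-1 x = trans (solve 1 (λ t → t := (:1 :+ :0) :* t) refl (term 1 x)) (trans (term-suc 0 x)
      (trans (*-congˡ (term-0 x)) (*-identityʳ x)))

  module _ {x} (0≤x : 0# ≤ x) (x≤2 : x ≤ 2#) where

    -- The ratio is x/(n + 2), at most 1 for x ≤ 2. Monotonicity starts at index 1, since the step
    -- from index 0 has ratio x; hence the estimates are made for the sine, whose series begins
    -- there.
    term-decreasing : ∀ n → term (suc (suc n)) x ≤ term (suc n) x
    term-decreasing n = *-cancelˡ-≤ (0<fromℕ {suc (suc n)} (ℕ.s≤s ℕ.z≤n))
      (≤-respˡ (sym (term-suc (suc n) x))
        (*-mono-≤ (0≤fromℕ (suc (suc n))) (0≤term (suc n) 0≤x) (≤-trans x≤2 2≤) ≤-refl))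
      where
      2≤ : 2# ≤ fromℕ (suc (suc n))
      2≤ = by≤ (0≤fromℕ n) (solve 1 (λ m → m := :1 :+ (:1 :+ m) :- :2) refl (fromℕ n))

    private
      -- The case k = 0 bounds the sine itself, k = 2 the remainder after its first term.
      alt : ∀ k N → (0# ≤ series (λ n → cosᵂ n * term (suc k ℕ.+ n) x) N) × (series
          (λ n → cosᵂ n * term (suc k ℕ.+ n) x) N ≤ term (suc k ℕ.+ 0) x)
      alt k = alternating {λ n → term (suc k ℕ.+ n) x} (λ n → 0≤term (suc k ℕ.+ n) 0≤x)
        (λ n → ≤-respˡ (reflexive (≡.cong (λ m → term (suc m) x) (≡.sym (ℕₚ.+-suc k n)))) (term-decreasing (k ℕ.+ n)))

    0≤sin : 0# ≤ sin x
    0≤sin = ⟶-≥ (λ N → proj₁ (alt 0 N)) (sin-limit′ x)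

    sin≤ : sin x ≤ x
    sin≤ = ≤-respʳ (term-1 x) (⟶-≤ (λ N → proj₂ (alt 0 N)) (sin-limit′ x))

    sin≥ : x - term 3 x ≤ sin x
    sin≥ = ⟶-≥ (λ N → ≤-respʳ (sym (series-peel (λ n → term (suc n) x) N))
        (+-mono-≤ (inj₂ (sym (term-1 x))) (by≤ (≤⇒0≤ (proj₂ (alt 2 N))) (solve 2 (λ a b → a :- b := :- b :- :- a) refl _ _))))
      (⟶-suc (⟶-suc (sin-limit′ x)))

    -- By `sin≥` it is enough that x³/6 < x. Three times the left side is x · x²/2 ≤ 2 · x²/2 ≤ 2x,
    -- which is less than 3x.
    0<sin : 0# < x → 0# < sin x
    0<sin 0<x = <-≤-trans (<⇒0< term3<x) sin≥
      where
      step : ∀ n → fromℕ (suc (suc n)) * term (suc (suc n)) x ≤ 2# * term (suc n) x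
      step n = ≤-respˡ (sym (term-suc (suc n) x)) (*-mono-≤ (inj₁ 0<2) (0≤term (suc n) 0≤x) x≤2 ≤-refl)
      2≈ : fromℕ 2 ≈ 2#
      2≈ = solve 0 (:1 :+ (:1 :+ :0) := :2) refl
      term2≤ : term 2 x ≤ x
      term2≤ = ≤-respʳ (term-1 x) (*-cancelˡ-≤ 0<2 (≤-respˡ (*-congʳ 2≈) (step 0)))
      term3<x : term 3 x < x
      term3<x = *-cancelˡ-< (0<fromℕ {3} (ℕ.s≤s ℕ.z≤n)) (≤-<-trans (≤-trans (step 1) (*-monoˡ-≤ (inj₁ 0<2) term2≤))
        (by< 0<x (solve 1 (λ x → x := (:1 :+ (:1 :+ (:1 :+ :0))) :* x :- :2 :* x) refl x)))

  1≤2 : 1# ≤ 2#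
  1≤2 = by≤ (inj₁ 0<1) (solve 0 (:1 := :2 :- :1) refl)

  0≤2 : 0# ≤ 2#
  0≤2 = inj₁ 0<2

  -- By the double angle formula cos 2 = 1 - 2 sin² 1, and sin 1 ≥ 1 - 1/6 exceeds 3/4. With w = 4
  -- sin 1 - 3 ≥ 0 the number -8 cos 2 = 16 sin² 1 - 8 equals 1 + 6w + w², visibly positive.
  cos-2<0 : cos 2# < 0#
  cos-2<0 = *-cancelˡ-< (*-pos (*-pos 0<2 0<2) 0<2)
    (by< (0<-+ 0<1 (0≤-+ (0≤-* (0≤-+ 0≤2 (0≤-* 0≤2 0≤2)) 0≤w) (0≤x² w)))
      (trans (solve 1 (λ s → let w = :2 :* :2 :* s :- (:2 :+ :1) in
          :1 :+ ((:2 :+ :2 :* :2) :* w :+ w :* w) := :2 :* :2 :* :2 :* :0 :- :2 :* :2 :* :2 :* (:1 :- :2 :* (s :* s))) refl s)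
        (+-congˡ (-‿cong (*-congˡ (sym cos2≈))))))
    where
    s u w : Carrier
    s = sin 1#
    u = term 3 1#
    w = 2# * 2# * s - (2# + 1#)
    cos2≈ : cos 2# ≈ 1# - 2# * (s * s)
    cos2≈ = trans (cos-double 1#) (trans
      (solve 2 (λ p q → :2 :* p :- :1 := :2 :* (p :+ q) :- :1 :- :2 :* q) refl (cos 1# * cos 1#) (s * s))
      (trans (+-congʳ (+-congʳ (*-congˡ (cos²+sin²≈1 1#)))) (solve 1 (λ q → :2 :* :1 :- :1 :- :2 :* q := :1 :- :2 :* q) refl (s * s))))
    6u≈1 : 2# * ((2# + 1#) * u) ≈ 1#
    6u≈1 = begin
      2# * ((2# + 1#) * u)    ≈⟨ *-congˡ (trans (solve 1
          (λ u → (:2 :+ :1) :* u := (:1 :+ (:1 :+ (:1 :+ :0))) :* u) refl u) (term-suc 2 1#)) ⟩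
      2# * (1# * term 2 1#)   ≈⟨ trans (solve 1 (λ t → :2 :* (:1 :* t) := (:1 :+ (:1 :+ :0)) :* t) refl (term 2 1#)) (term-suc 1 1#) ⟩
      1# * term 1 1#          ≈⟨ trans (*-identityˡ _) (term-1 1#) ⟩
      1#                      ∎
    -- Since 6u = 1, the lower bound 4(1 - u) - 3 = 1 - 4u equals 2u.
    0≤w : 0# ≤ w
    0≤w = ≤⇒0≤ (≤-trans
      (by≤ (0≤-* 0≤2 (0≤term 3 (inj₁ 0<1)))
        (trans (solve 1 (λ u → :2 :* u := :2 :* ((:2 :+ :1) :* u) :- :2 :* :2 :* u) refl u)
          (trans (+-congʳ 6u≈1) (solve 1 (λ u → :1 :- :2 :* :2 :* u := :2 :* :2 :* (:1 :- u) :- (:2 :+ :1)) refl u))))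
      (*-monoˡ-≤ (0≤-* 0≤2 0≤2) (sin≥ (inj₁ 0<1) 1≤2)))

  -- Monotonicity and continuity of the cosine on [0, 2]

  sin≤1 : ∀ x → sin x ≤ 1#
  sin≤1 x = ≮⇒≥ λ 1<s → ≤⇒≯ (≤-respʳ (cos²+sin²≈1 x) (≤-respˡ (+-identityˡ _) (+-mono-≤ (0≤x² (cos x)) ≤-refl)))
    (<-trans 1<s (<-respˡ (*-identityʳ _) (*-monoˡ-< (<-trans 0<1 1<s) 1<s)))

  -- This product formula takes the place of derivatives. For 0 ≤ x < y ≤ 2 both sines are positive,
  -- which gives monotonicity; bounding them by 1 and by (y - x)/2 gives the Lipschitz constant 1.
  cos-diff : ∀ x y → cos x - cos y ≈ 2# * (sin (½ * x + ½ * y) * sin (½ * y - ½ * x))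
  cos-diff x y = begin
    cos x - cos y
      ≈⟨ +-cong (trans (cos-cong x≈) (cos-sub m δ)) (-‿cong (trans (cos-cong y≈) (cos-+ m δ))) ⟩
    cos m * cos δ + sin m * sin δ - (cos m * cos δ - sin m * sin δ)
      ≈⟨ solve 2 (λ p q → p :+ q :- (p :- q) := :2 :* q) refl (cos m * cos δ) (sin m * sin δ) ⟩
    2# * (sin m * sin δ) ∎
    where
    m δ : Carrier
    m = ½ * x + ½ * y
    δ = ½ * y - ½ * x
    x≈ : x ≈ m - δ
    x≈ = trans (sym (halve x)) (solve 2 (λ a b → a :+ a := a :+ b :- (b :- a)) refl (½ * x) (½ * y))
    y≈ : y ≈ m + δ
    y≈ = trans (sym (halve y)) (solve 2 (λ a b → b :+ b := a :+ b :+ (b :- a)) refl (½ * x) (½ * y))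

  module _ {x y} (0≤x : 0# ≤ x) (x<y : x < y) (y≤2 : y ≤ 2#) where
    private
      m δ : Carrier
      m = ½ * x + ½ * y
      δ = ½ * y - ½ * x
      0<y : 0# < y
      0<y = ≤-<-trans 0≤x x<y
      0<m : 0# < m
      0<m = <-respʳ (+-comm _ _) (0<-+ (0<half 0<y) (0≤-* (inj₁ 0<½) 0≤x))
      m≤2 : m ≤ 2#
      m≤2 = ≤-trans (≤-respʳ (halve y) (+-mono-≤ (*-monoˡ-≤ (inj₁ 0<½) (inj₁ x<y)) ≤-refl)) y≤2
      0<δ : 0# < δ
      0<δ = <⇒0< (*-monoˡ-< 0<½ x<y)
      δ≤2 : δ ≤ 2#
      δ≤2 = ≤-trans (by≤ (0≤-+ (0≤-* (inj₁ 0<½) 0≤x) (0≤-* (inj₁ 0<½) 0≤x)) (solve 2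
          (λ a b → a :+ a := a :+ b :- (b :- a)) refl (½ * x) (½ * y))) m≤2

    cos-strictly-decreasing : cos y < cos x
    cos-strictly-decreasing = by< (*-pos 0<2 (*-pos (0<sin (inj₁ 0<m) m≤2 0<m) (0<sin (inj₁ 0<δ) δ≤2 0<δ)))
      (sym (cos-diff x y))

    cos-lipschitz : cos x - cos y ≤ y - x
    cos-lipschitz = ≤-respˡ (sym (cos-diff x y)) (≤-respʳ eq (*-monoˡ-≤ 0≤2
      (*-mono-≤ (inj₁ 0<1) (0≤sin (inj₁ 0<δ) δ≤2) (sin≤1 m) (sin≤ (inj₁ 0<δ) δ≤2))))
      where
      eq : 2# * (1# * δ) ≈ y - x
      eq = trans (solve 2 (λ a b → :2 :* (:1 :* (b :- a)) := b :+ b :- (a :+ a)) refl (½ * x) (½ * y))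
        (+-cong (halve y) (-‿cong (halve x)))

  cos-continuous : ∀ {x y} → 0# ≤ x → x ≤ 2# → 0# ≤ y → y ≤ 2# → ∀ {ε} → Bd ε (x - y) → Bd ε (cos x - cos y)
  cos-continuous {x} {y} 0≤x x≤2 0≤y y≤2 {ε} b@(b₁ , b₂) with compare x y
  ... | tri≈ _ x≈y _ = Bd-cong refl (sym (x≈y⇒x-y≈0 (cos-cong x≈y))) (Bd-0 (Bd-nonneg b))
  ... | tri< x<y _ _ = Bd-mono (≤-trans (cos-lipschitz 0≤x x<y y≤2) (≤-respˡ (solve 2 (λ x y → :- (x :- y) := y :- x) refl x y) b₂))
                         (Bd-self (inj₁ (<⇒0< (cos-strictly-decreasing 0≤x x<y y≤2))))
  ... | tri> _ _ y<x = Bd-mono (≤-trans (cos-lipschitz 0≤y y<x x≤2) b₁)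
                         (Bd-cong refl (solve 2 (λ x y → :- (y :- x) := x :- y) refl (cos x) (cos y))
                           (Bd-neg (Bd-self (inj₁ (<⇒0< (cos-strictly-decreasing 0≤y y<x x≤2))))))

  -- Bisection for the first zero of the cosine

  record Bracket : Set (c ⊔ ℓ₁ ⊔ ℓ₂) where
    field
      lo hi : Carrier
      0≤lo  : 0# ≤ lo
      lo≤hi : lo ≤ hi
      hi≤2  : hi ≤ 2#
      0≤cos : 0# ≤ cos lo
      cos≤0 : cos hi ≤ 0#
  open Bracket

  mid : Bracket → Carrier
  mid B = ½ * lo B + ½ * hi B

  lo≤mid : ∀ B → lo B ≤ mid B
  lo≤mid B = ≤-respˡ (halve (lo B)) (+-mono-≤ ≤-refl (*-monoˡ-≤ (inj₁ 0<½) (lo≤hi B)))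

  mid≤hi : ∀ B → mid B ≤ hi B
  mid≤hi B = ≤-respʳ (halve (hi B)) (+-mono-≤ (*-monoˡ-≤ (inj₁ 0<½) (lo≤hi B)) ≤-refl)

  width : Bracket → Carrier
  width B = hi B - lo B

  bisect : ∀ B → ∃[ B′ ] (lo B ≤ lo B′) × (hi B′ ≤ hi B) × (width B′ ≈ ½ * width B)
  bisect B with ≤-total 0# (cos (mid B))
  ... | inj₁ 0≤c = record { lo = mid B ; hi = hi B ; 0≤lo = ≤-trans (0≤lo B) (lo≤mid B) ; lo≤hi = mid≤hi B
                          ; hi≤2 = hi≤2 B ; 0≤cos = 0≤c ; cos≤0 = cos≤0 B }
                 , lo≤mid B , ≤-refl
                 , trans (+-congʳ (sym (halve (hi B)))) (solve 3
                     (λ h x y → h :* y :+ h :* y :- (h :* x :+ h :* y) := h :* (y :- x)) refl ½ (lo B) (hi B))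
  ... | inj₂ c≤0 = record { lo = lo B ; hi = mid B ; 0≤lo = 0≤lo B ; lo≤hi = lo≤mid B
                          ; hi≤2 = ≤-trans (mid≤hi B) (hi≤2 B) ; 0≤cos = 0≤cos B ; cos≤0 = c≤0 }
                 , ≤-refl , mid≤hi B
                 , trans (+-congˡ (-‿cong (sym (halve (lo B))))) (solve 3
                     (λ h x y → h :* x :+ h :* y :- (h :* x :+ h :* x) := h :* (y :- x)) refl ½ (lo B) (hi B))

  bracket : ℕ → Bracket
  bracket zero    = record { lo = 0# ; hi = 2# ; 0≤lo = ≤-refl ; lo≤hi = 0≤2 ; hi≤2 = ≤-refl
                           ; 0≤cos = ≤-respʳ (sym cos-0) (inj₁ 0<1) ; cos≤0 = inj₁ cos-2<0 }
  bracket (suc n) = proj₁ (bisect (bracket n))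

  bracket-nested : ∀ n k → (lo (bracket n) ≤ lo (bracket (k ℕ.+ n))) × (hi (bracket (k ℕ.+ n)) ≤ hi (bracket n))
  bracket-nested n zero    = ≤-refl , ≤-refl
  bracket-nested n (suc k) with bracket-nested n k | bisect (bracket (k ℕ.+ n))
  ... | p , q | _ , r , s , _ = ≤-trans p r , ≤-trans s q

  -- Halving the width while n + 1 grows to n + 2 ≤ 2(n + 1) cannot increase their product, which
  -- starts at 2.
  width-null : Null (width ∘ bracket)
  width-null = Null-O[1/n] 2# (λ n → ≤⇒0≤ (lo≤hi (bracket n))) bound
    where
    bound : ∀ n → fromℕ (suc n) * width (bracket n) ≤ 2#
    bound zero    = inj₂ (solve 0 ((:1 :+ :0) :* (:2 :- :0) := :2) refl)
    bound (suc n) = ≤-trans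
      (≤-respˡ (*-congˡ (sym (proj₂ (proj₂ (proj₂ (bisect (bracket n)))))))
        (by≤ (0≤-* (0≤fromℕ n) (0≤-* (inj₁ 0<½) (≤⇒0≤ (lo≤hi (bracket n)))))
          (solve 2 (λ n h → n :* h := (:1 :+ n) :* (h :+ h) :- (:1 :+ (:1 :+ n)) :* h) refl (fromℕ n) (½ * width (bracket n)))))
      (≤-respˡ (*-congˡ (sym (halve (width (bracket n))))) (bound n))

  lo-cauchy : ∀ ε → 0# < ε → ∃[ N ] (∀ n k → N ℕ.≤ n → Bd ε (lo (bracket (n ℕ.+ k)) - lo (bracket n)))
  lo-cauchy ε 0<ε = proj₁ (width-null ε 0<ε) , λ n k N≤n →
    ≡.subst (λ m → Bd ε (lo (bracket m) - lo (bracket n))) (ℕₚ.+-comm k n)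
      (Bd-mono (≤-trans (gap n k) (proj₁ (proj₂ (width-null ε 0<ε) n N≤n))) (Bd-self (≤⇒0≤ (proj₁ (bracket-nested n k)))))
    where
    gap : ∀ n k → lo (bracket (k ℕ.+ n)) - lo (bracket n) ≤ width (bracket n)
    gap n k = +-mono-≤ (≤-trans (lo≤hi (bracket (k ℕ.+ n))) (proj₂ (bracket-nested n k))) ≤-refl

  opaque
    π/2 : Carrier
    π/2 = proj₁ (⟶-complete (lo ∘ bracket) lo-cauchy)

    lo⟶π/2 : (lo ∘ bracket) ⟶ π/2
    lo⟶π/2 = proj₂ (⟶-complete (lo ∘ bracket) lo-cauchy)

  hi⟶π/2 : (hi ∘ bracket) ⟶ π/2
  hi⟶π/2 = ⟶-null {s = lo ∘ bracket} (Null-cong (λ n → solve 2 (λ x y → :- (y :- x) := x :- y)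
      refl (lo (bracket n)) (hi (bracket n))) (Null-neg width-null)) lo⟶π/2

  0≤π/2 : 0# ≤ π/2
  0≤π/2 = ⟶-≥ (λ n → 0≤lo (bracket n)) lo⟶π/2

  π/2≤2 : π/2 ≤ 2#
  π/2≤2 = ⟶-≤ (λ n → hi≤2 (bracket n)) hi⟶π/2

  cos⟶cos-π/2 : ∀ {s} → (∀ n → 0# ≤ s n) → (∀ n → s n ≤ 2#) → s ⟶ π/2 → (cos ∘ s) ⟶ cos π/2
  cos⟶cos-π/2 0≤s s≤2 sh ε 0<ε = proj₁ (sh ε 0<ε) , λ n N≤n →
    cos-continuous (0≤s n) (s≤2 n) 0≤π/2 π/2≤2 (proj₂ (sh ε 0<ε) n N≤n)

  -- The cosine is nonnegative at the lower ends and nonpositive at the upper ends; both converge to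
  -- the same point, where continuity yields both inequalities.
  cos-π/2 : cos π/2 ≈ 0#
  cos-π/2 = ≤-antisym
    (⟶-≤ {s = cos ∘ hi ∘ bracket} (λ n → cos≤0 (bracket n)) (cos⟶cos-π/2 {hi ∘ bracket}
      (λ n → ≤-trans (0≤lo (bracket n)) (lo≤hi (bracket n))) (λ n → hi≤2 (bracket n)) hi⟶π/2))
    (⟶-≥ {s = cos ∘ lo ∘ bracket} (λ n → 0≤cos (bracket n)) (cos⟶cos-π/2 {lo ∘ bracket}
      (λ n → 0≤lo (bracket n)) (λ n → ≤-trans (lo≤hi (bracket n)) (hi≤2 (bracket n))) lo⟶π/2))

  0<π/2 : 0# < π/2
  0<π/2 = [ id , (λ 0≈h → contradiction (trans (sym cos-π/2) (trans (cos-cong (sym 0≈h)) cos-0)) 0≉1) ]′ 0≤π/2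

  π/2-least : ∀ {t} → 0# < t → cos t ≈ 0# → π/2 ≤ t
  π/2-least 0<t cos-t = ≮⇒≥ λ t<h → <-irrefl (trans cos-π/2 (sym cos-t)) (cos-strictly-decreasing (inj₁ 0<t) t<h π/2≤2)

  -- The value -1 of the cosine and the zeros of the sine

  π : Carrier
  π = π/2 + π/2

  0<π : 0# < π
  0<π = 0<-+ 0<π/2 (inj₁ 0<π/2)

  cos-π : cos π ≈ - 1#
  cos-π = trans (cos-double π/2) (trans (+-congʳ (*-congˡ (trans (*-congʳ cos-π/2) (zeroˡ _))))
      (solve 0 (:2 :* :0 :- :1 := :- :1) refl))

  sin-π : sin π ≈ 0#
  sin-π = trans (sin-+ π/2 π/2) (trans (+-cong (*-congˡ cos-π/2) (*-congʳ cos-π/2)) (solve 1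
      (λ s → s :* :0 :+ :0 :* s := :0) refl (sin π/2)))

  -- Half-angle formula: 2 cos²(t/2) = 1 + cos t = 0 makes t/2 a positive zero of the cosine, so t/2
  -- ≥ π/2. The minimality of the transfer time rests on this.
  cos≈-1⇒π≤ : ∀ {t} → 0# < t → cos t ≈ - 1# → π ≤ t
  cos≈-1⇒π≤ {t} 0<t cos-t = ≤-respʳ (halve t) (+-mono-≤ h≤ h≤)
    where
    y : Carrier
    y = ½ * t
    cos-y : cos y ≈ 0#
    cos-y = x*x≈0⇒x≈0 (x*y≈0⇒y≈0 (>⇒≉ 0<2) (begin
      2# * (cos y * cos y)             ≈⟨ solve 1 (λ a → a := a :- :1 :+ :1) refl _ ⟩
      2# * (cos y * cos y) - 1# + 1#   ≈⟨ +-congʳ (cos-double y) ⟨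
      cos (y + y) + 1#                 ≈⟨ +-congʳ (trans (cos-cong (halve t)) cos-t) ⟩
      - 1# + 1#                        ≈⟨ -‿inverseˡ 1# ⟩
      0#                               ∎))
    h≤ : π/2 ≤ y
    h≤ = π/2-least (0<half 0<t) cos-y

  cos≈-1⇒sin≈0 : ∀ {t} → cos t ≈ - 1# → sin t ≈ 0#
  cos≈-1⇒sin≈0 {t} cos-t = x*x≈0⇒x≈0 (begin
    sin t * sin t                                   ≈⟨ solve 2 (λ p q → q := p :+ q :- p) refl (cos t * cos t) _ ⟩
    cos t * cos t + sin t * sin t - cos t * cos t   ≈⟨ +-cong (cos²+sin²≈1 t) (-‿cong (*-cong cos-t cos-t)) ⟩
    1# - - 1# * - 1#                                ≈⟨ solve 0 (:1 :- (:- :1) :* (:- :1) := :0) refl ⟩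
    0#                                              ∎)

  -- Suppose 0 < t and let y = t/2 < π/2. As cos y ≠ 0, the double angle formula gives sin y = 0,
  -- whence cos(π/2 - y) = 0. This is a positive zero of the cosine before the least one.
  sin≈0⇒≈0 : ∀ {t} → 0# ≤ t → t < π → sin t ≈ 0# → t ≈ 0#
  sin≈0⇒≈0 (inj₂ 0≈t) _ _ = sym 0≈t
  sin≈0⇒≈0 {t} (inj₁ 0<t) t<π sin-t = contradiction (π/2-least 0<h-y cos-h-y) (λ h≤ → ≤⇒≯ h≤ h-y<h)
    where
    y : Carrier
    y = ½ * t
    y<h : y < π/2
    y<h = <-respʳ (trans (distribˡ ½ π/2 π/2) (halve π/2)) (*-monoˡ-< 0<½ t<π)
    0<h-y : 0# < π/2 - y
    0<h-y = <⇒0< y<h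
    h-y<h : π/2 - y < π/2
    h-y<h = by< (0<half 0<t) (solve 2 (λ h y → y := h :- (h :- y)) refl π/2 y)
    2cos-y≉0 : ¬ 2# * cos y ≈ 0#
    2cos-y≉0 = *-≉0 (>⇒≉ 0<2) λ cos-y → ≤⇒≯ (π/2-least (0<half 0<t) cos-y) y<h
    sin-y : sin y ≈ 0#
    sin-y = x*y≈0⇒y≈0 2cos-y≉0 (trans (solve 2 (λ s c → :2 :* c :* s := s :* c :+ c :* s) refl (sin y) (cos y))
      (trans (sym (sin-+ y y)) (trans (sin-cong (halve t)) sin-t)))
    cos-h-y : cos (π/2 - y) ≈ 0#
    cos-h-y = trans (cos-sub π/2 y) (trans (+-cong (*-congʳ cos-π/2) (*-congˡ sin-y)) (solve 2
        (λ c s → :0 :* c :+ s :* :0 := :0) refl (cos y) (sin π/2)))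

  sin-π-shift : ∀ t → sin (t - π) ≈ - sin t
  sin-π-shift t = trans (sin-sub t π) (trans (+-cong (*-congˡ cos-π) (-‿cong (*-congˡ sin-π)))
    (solve 2 (λ s c → s :* :- :1 :- c :* :0 := :- s) refl (sin t) (cos t)))

  -- The bound N, later supplied by the Archimedean axiom, makes the reduction modulo π terminate:
  -- each subtraction of π only changes the sign of the sine.
  sin≈0⇒ℕ : ∀ N {t} → 0# ≤ t → t < fromℕ N * π → sin t ≈ 0# → ∃[ m ] t ≈ fromℕ m * π
  sin≈0⇒ℕ zero    0≤t t<0 _ = contradiction (<-respʳ (zeroˡ π) t<0) (≤⇒≯ 0≤t)
  sin≈0⇒ℕ (suc N) {t} 0≤t t<Nπ sin-t with compare t π
  ... | tri< t<π _ _ = 0 , trans (sin≈0⇒≈0 0≤t t<π sin-t) (sym (zeroˡ π))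
  ... | tri≈ _ t≈π _ = 1 , trans t≈π (solve 1 (λ p → p := (:1 :+ :0) :* p) refl π)
  ... | tri> _ _ π<t = suc (proj₁ ih) , (begin
    t                             ≈⟨ solve 2 (λ t p → t := p :+ (t :- p)) refl t π ⟩
    π + (t - π)                   ≈⟨ +-congˡ (proj₂ ih) ⟩
    π + fromℕ (proj₁ ih) * π      ≈⟨ solve 2 (λ m p → p :+ m :* p := (:1 :+ m) :* p) refl (fromℕ (proj₁ ih)) π ⟩
    (1# + fromℕ (proj₁ ih)) * π   ∎)
    where
    ih : ∃[ m ] t - π ≈ fromℕ m * π
    ih = sin≈0⇒ℕ N {t - π} (inj₁ (<⇒0< π<t))
      (by< (<⇒0< t<Nπ) (solve 3 (λ n p t → (:1 :+ n) :* p :- t := n :* p :- (t :- p)) refl (fromℕ N) π t))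
      (trans (sin-π-shift t) (trans (-‿cong sin-t) -0#≈0#))

  sin≈0⇒ℕπ : ∀ {t} → 0# ≤ t → sin t ≈ 0# → ∃[ m ] t ≈ fromℕ m * π
  sin≈0⇒ℕπ {t} 0≤t = sin≈0⇒ℕ N 0≤t (<-respˡ eq (<-respʳ (*-comm _ _) (*-monoˡ-< 0<π (proj₂ (archimedean (t * π ⁻¹))))))
    where
    N : ℕ
    N = proj₁ (archimedean (t * π ⁻¹))
    eq : π * (t * π ⁻¹) ≈ t
    eq = trans (solve 3 (λ p t i → p :* (t :* i) := t :* (p :* i)) refl π t (π ⁻¹))
      (trans (*-congˡ (⁻¹-inverseʳ (>⇒≉ 0<π))) (*-identityʳ t))

  fromℕ≈fromℤ′ : ∀ n → fromℕ n ≈ fromℤ′ (+ n)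
  fromℕ≈fromℤ′ n = Mult′.×ᵤ≈× n 1#

  sin≈0⇒ℤπ : ∀ {t} → sin t ≈ 0# → ∃[ z ] t ≈ fromℤ′ z * π
  sin≈0⇒ℤπ {t} sin-t with ≤-total 0# t
  ... | inj₁ 0≤t = let m , eq = sin≈0⇒ℕπ 0≤t sin-t in + m , trans eq (*-congʳ (fromℕ≈fromℤ′ m))
  ... | inj₂ t≤0 = let m , eq = sin≈0⇒ℕπ (≤0⇒0≤- t≤0) (trans (sin-neg t) (trans (-‿cong sin-t) -0#≈0#)) in
    ℤ.- (+ m) , (begin
      t                       ≈⟨ -‿involutive t ⟨
      - - t                   ≈⟨ -‿cong (trans eq (*-congʳ (fromℕ≈fromℤ′ m))) ⟩
      - (fromℤ′ (+ m) * π)    ≈⟨ -‿distribˡ-* _ _ ⟩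
      - fromℤ′ (+ m) * π      ≈⟨ *-congʳ (fromℤ′-neg (+ m)) ⟨
      fromℤ′ (ℤ.- (+ m)) * π  ∎)

  -- Agreement with the cosine series of `IsCos`

  cosᵂ-even : ∀ n → cosᵂ (2 ℕ.* n) ≈ (- 1#) ^ n
  sinᵂ-even : ∀ n → sinᵂ (2 ℕ.* n) ≈ 0#
  2*suc : ∀ n → 2 ℕ.* suc n ≡ suc (suc (2 ℕ.* n))
  2*suc n = ≡.cong suc (ℕₚ.+-suc n (n ℕ.+ 0))
  cosᵂ-even zero    = refl
  cosᵂ-even (suc n) = trans (reflexive (≡.cong cosᵂ (2*suc n))) (trans (-‿cong (cosᵂ-even n)) (solve 1
      (λ p → :- p := :- :1 :* p) refl _))
  sinᵂ-even zero    = refl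
  sinᵂ-even (suc n) = trans (reflexive (≡.cong sinᵂ (2*suc n))) (trans (-‿cong (sinᵂ-even n)) -0#≈0#)

  -- The odd weights vanish, so the partial sums of the two series agree along the even indices and
  -- a subsequence has the same limit.
  cosTerms : ∀ x N → series (cosTerm x) N ≈ weighted cosᵂ x (2 ℕ.* N)
  cosTerms x zero    = refl
  cosTerms x (suc N) = begin
    series (cosTerm x) (suc N)                          ≈⟨ series-snoc (cosTerm x) N ⟩
    series (cosTerm x) N + cosTerm x N                  ≈⟨ +-cong (cosTerms x N) eq ⟩
    weighted cosᵂ x (2 ℕ.* N) + f (2 ℕ.* N)             ≈⟨ series-snoc f (2 ℕ.* N) ⟨
    series f (suc (2 ℕ.* N))                            ≈⟨ +-identityʳ _ ⟨
    series f (suc (2 ℕ.* N)) + 0#                       ≈⟨ +-congˡ odd ⟨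
    series f (suc (2 ℕ.* N)) + f (suc (2 ℕ.* N))        ≈⟨ series-snoc f (suc (2 ℕ.* N)) ⟨
    series f (suc (suc (2 ℕ.* N)))                      ≡⟨ ≡.cong (series f) (2*suc N) ⟨
    weighted cosᵂ x (2 ℕ.* suc N)                       ∎
    where
    f : ℕ → Carrier
    f n = cosᵂ n * term n x
    odd : f (suc (2 ℕ.* N)) ≈ 0#
    odd = trans (*-congʳ (trans (-‿cong (sinᵂ-even N)) -0#≈0#)) (zeroˡ _)
    eq : cosTerm x N ≈ f (2 ℕ.* N)
    eq = trans (*-assoc _ _ _) (*-cong (sym (cosᵂ-even N)) (sym (term-def (2 ℕ.* N) x)))

  cosTerms⟶cos : ∀ x → series (cosTerm x) ⟶ cos x
  cosTerms⟶cos x = ⟶-cong (λ N → sym (cosTerms x N)) refl (Null-subseq (2 ℕ.*_) (λ n → ℕₚ.m≤m+n n (n ℕ.+ 0)) (cos-limit x))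

  IsCos⇒≈cos : ∀ {x y} → IsCos x y → y ≈ cos x
  IsCos⇒≈cos {x} h = ⟶-unique (IsLimit⇒⟶ h) (cosTerms⟶cos x)

  ≈cos⇒IsCos : ∀ {x y} → cos x ≈ y → IsCos x y
  ≈cos⇒IsCos {x} eq = ⟶⇒IsLimit (⟶-cong (λ _ → refl) eq (cosTerms⟶cos x))

  π-isPi : IsPi π
  π-isPi = π/2 , ((0<π/2 , ≈cos⇒IsCos cos-π/2) , λ t (0<t , cos-t) → π/2-least 0<t (sym (IsCos⇒≈cos cos-t))) , refl

  -- Spectral decompositions

  private
    variable
      m n : ℕ

  sum-cong : ∀ {f g : Vector Carrier n} → (∀ i → f i ≈ g i) → sum f ≈ sum g
  sum-cong = sum-cong-≋

  sum-0 : ∀ {f : Vector Carrier n} → (∀ i → f i ≈ 0#) → sum f ≈ 0#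
  sum-0 {n} f≈0 = trans (sum-cong f≈0) (sum-replicate-zero n)

  sum-single : ∀ (f : Vector Carrier n) j → (∀ i → i ≢ j → f i ≈ 0#) → sum f ≈ f j
  sum-single {suc n} f j f≈0 = begin
    sum f                            ≈⟨ sum-remove {i = j} f ⟩
    f j + sum (λ k → f (punchIn j k)) ≈⟨ +-congˡ (sum-0 λ k → f≈0 (punchIn j k) (Finₚ.punchInᵢ≢i j k)) ⟩
    f j + 0#                         ≈⟨ +-identityʳ (f j) ⟩
    f j                              ∎

  sum-scale : ∀ x (f : Vector Carrier n) → sum (λ i → x * f i) ≈ x * sum f
  sum-scale x f = sym (*-distribˡ-sum x f)

  sum-sub : ∀ (f g : Vector Carrier n) → sum (λ i → f i - g i) ≈ sum f - sum g
  sum-sub f g = begin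
    sum (λ i → f i - g i)              ≈⟨ ∑-distrib-+ f (λ i → - g i) ⟩
    sum f + sum (λ i → - g i)          ≈⟨ +-congˡ (sum-cong λ i → solve 1 (λ x → :- x := :- :1 :* x) refl (g i)) ⟩
    sum f + sum (λ i → - 1# * g i)     ≈⟨ +-congˡ (sum-scale (- 1#) g) ⟩
    sum f + - 1# * sum g               ≈⟨ solve 2 (λ x y → x :+ :- :1 :* y := x :- y) refl (sum f) (sum g) ⟩
    sum f - sum g                      ∎

  sum-nonneg : ∀ {f : Vector Carrier n} → (∀ i → 0# ≤ f i) → 0# ≤ sum f
  sum-nonneg {zero}  0≤f = ≤-refl
  sum-nonneg {suc n} 0≤f = 0≤-+ (0≤f Fin.zero) (sum-nonneg (0≤f ∘ Fin.suc))

  sum≈0⇒ : ∀ {f : Vector Carrier n} → (∀ i → 0# ≤ f i) → sum f ≈ 0# → ∀ i → f i ≈ 0#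
  sum≈0⇒ {suc n} {f} 0≤f Σ≈0 i = ≤-antisym (≤-respʳ Σ≈0 (≤-respʳ (sym (sum-remove {i = i} f))
    (≤-respˡ (+-identityʳ (f i)) (+-mono-≤ ≤-refl (sum-nonneg (λ k → 0≤f (punchIn i k))))))) (0≤f i)

  e-diag : ∀ (j : Fin n) → e j j ≈ 1#
  e-diag j with j Finₚ.≟ j
  ... | yes _  = refl
  ... | no j≢j = contradiction ≡.refl j≢j

  e-off : ∀ {i j : Fin n} → i ≢ j → e j i ≈ 0#
  e-off {i = i} {j} i≢j with i Finₚ.≟ j
  ... | yes i≡j = contradiction i≡j i≢j
  ... | no _    = refl

  sum-*-e : ∀ (f : Vector Carrier n) j → sum (λ i → f i * e j i) ≈ f j
  sum-*-e f j = trans (sum-single (λ i → f i * e j i) j (λ i i≢j → trans (*-congˡ (e-off i≢j)) (zeroʳ (f i))))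
    (trans (*-congˡ (e-diag j)) (*-identityʳ (f j)))

  *ᵛ-cong : ∀ (A : Matrix n) {x y : Vector Carrier n} → x ≈ᵛ y → A *ᵛ x ≈ᵛ A *ᵛ y
  *ᵛ-cong A x≈y i = sum-cong λ k → *-congˡ (x≈y k)

  *ᵛ-scale : ∀ (A : Matrix n) a x → A *ᵛ (λ k → a * x k) ≈ᵛ λ i → a * (A *ᵛ x) i
  *ᵛ-scale A a x i = trans
    (sum-cong λ k → solve 3 (λ m a x → m :* (a :* x) := a :* (m :* x)) refl (A i k) a (x k))
    (sum-scale a λ k → A i k * x k)

  *ᵛ-sub : ∀ (A : Matrix n) x y → A *ᵛ (λ k → x k - y k) ≈ᵛ λ i → (A *ᵛ x) i - (A *ᵛ y) i
  *ᵛ-sub A x y i = trans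
    (sum-cong λ k → solve 3 (λ m x y → m :* (x :- y) := m :* x :- m :* y) refl (A i k) (x k) (y k))
    (sum-sub (λ k → A i k * x k) (λ k → A i k * y k))

  *ᵛ-sum : ∀ (A : Matrix n) (f : Fin m → Vector Carrier n) →
    A *ᵛ (λ k → sum λ i → f i k) ≈ᵛ λ q → sum λ i → (A *ᵛ f i) q
  *ᵛ-sum A f q = trans (sum-cong λ k → *-distribˡ-sum (A q k) (λ i → f i k)) (∑-comm λ k i → A q k * f i k)

  *ᵛ-e : ∀ (A : Matrix n) j → A *ᵛ e j ≈ᵛ λ i → A i j
  *ᵛ-e A j i = sum-*-e (A i) j

  1ᴹ-*ᵛ : ∀ (x : Vector Carrier n) → 1ᴹ *ᵛ x ≈ᵛ x
  1ᴹ-*ᵛ x i = begin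
    sum (λ k → e k i * x k)   ≈⟨ sum-single (λ k → e k i * x k) i (λ k k≢i → trans (*-congʳ (e-off (k≢i ∘ ≡.sym))) (zeroˡ (x k))) ⟩
    e i i * x i               ≈⟨ *-congʳ (e-diag i) ⟩
    1# * x i                  ≈⟨ *-identityˡ (x i) ⟩
    x i                       ∎

  *ᴹ-*ᵛ : ∀ (A B : Matrix n) x → (A *ᴹ B) *ᵛ x ≈ᵛ A *ᵛ (B *ᵛ x)
  *ᴹ-*ᵛ A B x i = begin
    sum (λ j → sum (λ k → A i k * B k j) * x j)     ≈⟨ sum-cong (λ j → *-distribʳ-sum (x j) (λ k → A i k * B k j)) ⟩
    sum (λ j → sum (λ k → A i k * B k j * x j))     ≈⟨ ∑-comm (λ j k → A i k * B k j * x j) ⟩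
    sum (λ k → sum (λ j → A i k * B k j * x j))     ≈⟨ sum-cong (λ k → sum-cong λ j → *-assoc (A i k) (B k j) (x j)) ⟩
    sum (λ k → sum (λ j → A i k * (B k j * x j)))   ≈⟨ sum-cong (λ k → sum-scale (A i k) (λ j → B k j * x j)) ⟩
    sum (λ k → A i k * sum (λ j → B k j * x j))     ∎

  ⟨⟩-cong : ∀ {x x′ y y′ : Vector Carrier n} → x ≈ᵛ x′ → y ≈ᵛ y′ → ⟨ x , y ⟩ ≈ ⟨ x′ , y′ ⟩
  ⟨⟩-cong x≈ y≈ = sum-cong λ i → *-cong (x≈ i) (y≈ i)

  ⟨⟩-scaleˡ : ∀ a (x y : Vector Carrier n) → ⟨ (λ i → a * x i) , y ⟩ ≈ a * ⟨ x , y ⟩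
  ⟨⟩-scaleˡ a x y = trans (sum-cong λ i → *-assoc a (x i) (y i)) (sum-scale a λ i → x i * y i)

  ⟨⟩-scaleʳ : ∀ a (x y : Vector Carrier n) → ⟨ x , (λ i → a * y i) ⟩ ≈ a * ⟨ x , y ⟩
  ⟨⟩-scaleʳ a x y = trans (sum-cong λ i → solve 3 (λ a x y → x :* (a :* y) := a :* (x :* y)) refl a (x i) (y i))
    (sum-scale a λ i → x i * y i)

  ⟨⟩-subˡ : ∀ (x y z : Vector Carrier n) → ⟨ (λ i → x i - y i) , z ⟩ ≈ ⟨ x , z ⟩ - ⟨ y , z ⟩
  ⟨⟩-subˡ x y z = trans (sum-cong λ i → solve 3 (λ x y z → (x :- y) :* z := x :* z :- y :* z) refl (x i) (y i) (z i))
    (sum-sub (λ i → x i * z i) (λ i → y i * z i))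

  ⟨⟩-sumˡ : ∀ (f : Fin m → Vector Carrier n) y → ⟨ (λ k → sum λ i → f i k) , y ⟩ ≈ sum λ i → ⟨ f i , y ⟩
  ⟨⟩-sumˡ f y = trans (sum-cong λ k → *-distribʳ-sum (y k) (λ i → f i k)) (∑-comm λ k i → f i k * y k)

  ⟨x,x⟩≈0⇒x≈0 : ∀ {x : Vector Carrier n} → ⟨ x , x ⟩ ≈ 0# → x ≈ᵛ 0ᵛ
  ⟨x,x⟩≈0⇒x≈0 {x = x} eq i = x*x≈0⇒x≈0 (sum≈0⇒ (λ i → 0≤x² (x i)) eq i)

  ⟨⟩-adjoint : ∀ {A : Matrix n} → Symmetric A → ∀ x y → ⟨ A *ᵛ x , y ⟩ ≈ ⟨ x , A *ᵛ y ⟩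
  ⟨⟩-adjoint {A = A} symA x y = begin
    sum (λ i → sum (λ k → A i k * x k) * y i)     ≈⟨ sum-cong (λ i → *-distribʳ-sum (y i) (λ k → A i k * x k)) ⟩
    sum (λ i → sum (λ k → A i k * x k * y i))     ≈⟨ ∑-comm (λ i k → A i k * x k * y i) ⟩
    sum (λ k → sum (λ i → A i k * x k * y i))     ≈⟨ sum-cong (λ k → sum-cong λ i → trans (*-congʳ (*-congʳ (symA i k)))
                                                       (solve 3 (λ a x y → a :* x :* y := x :* (a :* y)) refl (A k i) (x k) (y i))) ⟩
    sum (λ k → sum (λ i → x k * (A k i * y i)))   ≈⟨ sum-cong (λ k → sum-scale (x k) (λ i → A k i * y i)) ⟩
    sum (λ k → x k * sum (λ i → A k i * y i))     ∎

  -- The decision licenses arguments by contradiction about vectors, and the case split between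
  -- eigenspaces inside and outside a support.
  ≈ᵛ0? : ∀ (x : Vector Carrier n) → Dec (x ≈ᵛ 0ᵛ)
  ≈ᵛ0? x = Finₚ.all? λ i → x i ≟ 0#

  -- Orthogonality and completeness of the eigenspaces

  module Spectral {M : Matrix n} (symM : Symmetric M) (D : SpectralDecomposition M) where
    open SpectralDecomposition D

    U : Fin size → Vector Carrier n → Set ℓ₁
    U i = Eigenspace M (θ i)

    U-E : ∀ i x → U i (E i *ᵛ x)
    U-E i x = proj₁ (E-projection i x)

    E-orthogonal : ∀ i x {u} → U i u → ⟨ x , u ⟩ ≈ ⟨ E i *ᵛ x , u ⟩
    E-orthogonal i x {u} Uu = x-y≈0⇒x≈y (trans (sym (⟨⟩-subˡ x (E i *ᵛ x) u)) (proj₂ (E-projection i x) u Uu))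

    eigenspaces-orthogonal : ∀ {i j u v} → i ≢ j → U i u → U j v → ⟨ u , v ⟩ ≈ 0#
    eigenspaces-orthogonal {i} {j} {u} {v} i≢j Uu Uv = x*y≈0⇒y≈0
      (λ eq → i≢j (θ-injective i j (x-y≈0⇒x≈y eq)))
      (trans (solve 3 (λ a b p → (a :- b) :* p := a :* p :- b :* p) refl (θ i) (θ j) ⟨ u , v ⟩) (x≈y⇒x-y≈0 (begin
        θ i * ⟨ u , v ⟩              ≈⟨ ⟨⟩-scaleˡ (θ i) u v ⟨
        ⟨ (λ k → θ i * u k) , v ⟩    ≈⟨ ⟨⟩-cong {y = v} Uu (λ _ → refl) ⟨
        ⟨ M *ᵛ u , v ⟩               ≈⟨ ⟨⟩-adjoint symM u v ⟩
        ⟨ u , M *ᵛ v ⟩               ≈⟨ ⟨⟩-cong {x = u} (λ _ → refl) Uv ⟩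
        ⟨ u , (λ k → θ j * v k) ⟩    ≈⟨ ⟨⟩-scaleʳ (θ j) u v ⟩
        θ j * ⟨ u , v ⟩              ∎)))

    -- The squared norm of Eᵢu is ⟨u, Eᵢu⟩, a product of vectors from two orthogonal eigenspaces.
    E-off : ∀ {i j u} → i ≢ j → U j u → E i *ᵛ u ≈ᵛ 0ᵛ
    E-off {i} {j} {u} i≢j Uu = ⟨x,x⟩≈0⇒x≈0 (trans (sym (E-orthogonal i u (U-E i u)))
      (eigenspaces-orthogonal (i≢j ∘ ≡.sym) Uu (U-E i u)))

    U-sub : ∀ {i u v} → U i u → U i v → U i (λ k → u k - v k)
    U-sub {i} {u} {v} Uu Uv k = trans (*ᵛ-sub M u v k) (trans (+-cong (Uu k) (-‿cong (Uv k)))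
      (solve 3 (λ a x y → a :* x :- a :* y := a :* (x :- y)) refl (θ i) (u k) (v k)))

    -- The difference u - Eᵢu lies in the eigenspace and is orthogonal to it, hence to itself.
    E-on : ∀ {i u} → U i u → E i *ᵛ u ≈ᵛ u
    E-on {i} {u} Uu k = sym (x-y≈0⇒x≈y (⟨x,x⟩≈0⇒x≈0 (proj₂ (E-projection i u) _ (U-sub Uu (U-E i u))) k))

    -- The remainder x - Σ Eᵢ x is killed by M and orthogonal to every eigenspace;
    -- were it nonzero, 0 would be an eigenvalue and it would lie in its eigenspace.
    resolution : ∀ x → x ≈ᵛ λ k → sum λ i → (E i *ᵛ x) k
    resolution x k = x-y≈0⇒x≈y (decidable-stable (≈ᵛ0? y) (λ y≉0 → y≉0 (y≈0 y≉0)) k)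
      where
      Σx y : Vector Carrier n
      Σx k = sum λ i → (E i *ᵛ x) k
      y k = x k - Σx k
      Mx : M *ᵛ x ≈ᵛ λ k → sum λ i → θ i * (E i *ᵛ x) k
      Mx p = begin
        sum (λ q → M p q * x q)                           ≈⟨ sum-cong (λ q → *-congʳ (decomposition p q)) ⟩
        sum (λ q → sum (λ i → θ i * E i p q) * x q)       ≈⟨ sum-cong (λ q → *-distribʳ-sum (x q) (λ i → θ i * E i p q)) ⟩
        sum (λ q → sum (λ i → θ i * E i p q * x q))       ≈⟨ ∑-comm (λ q i → θ i * E i p q * x q) ⟩
        sum (λ i → sum (λ q → θ i * E i p q * x q))       ≈⟨ sum-cong (λ i → sum-cong λ q → *-assoc (θ i) (E i p q) (x q)) ⟩
        sum (λ i → sum (λ q → θ i * (E i p q * x q)))     ≈⟨ sum-cong (λ i → sum-scale (θ i) (λ q → E i p q * x q)) ⟩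
        sum (λ i → θ i * (E i *ᵛ x) p)                    ∎
      My : M *ᵛ y ≈ᵛ λ k → 0# * y k
      My p = begin
        (M *ᵛ y) p                                        ≈⟨ *ᵛ-sub M x Σx p ⟩
        (M *ᵛ x) p - (M *ᵛ Σx) p                          ≈⟨ +-cong (Mx p) (-‿cong (trans (*ᵛ-sum M
            (λ i → E i *ᵛ x) p) (sum-cong λ i → U-E i x p))) ⟩
        s - s                                             ≈⟨ -‿inverseʳ s ⟩
        0#                                                ≈⟨ zeroˡ (y p) ⟨
        0# * y p                                          ∎
        where
        s : Carrier
        s = sum (λ i → θ i * (E i *ᵛ x) p)
      y⊥U : ∀ {j u} → U j u → ⟨ y , u ⟩ ≈ 0#
      y⊥U {j} {u} Uu = begin
        ⟨ y , u ⟩                               ≈⟨ ⟨⟩-subˡ x Σx u ⟩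
        ⟨ x , u ⟩ - ⟨ Σx , u ⟩                  ≈⟨ +-congˡ (-‿cong (⟨⟩-sumˡ (λ i → E i *ᵛ x) u)) ⟩
        ⟨ x , u ⟩ - sum (λ i → ⟨ E i *ᵛ x , u ⟩) ≈⟨ +-congˡ (-‿cong (sum-single (λ i → ⟨ E i *ᵛ x , u ⟩) j
                                                    λ i i≢j → eigenspaces-orthogonal i≢j (U-E i x) Uu)) ⟩
        ⟨ x , u ⟩ - ⟨ E j *ᵛ x , u ⟩            ≈⟨ x≈y⇒x-y≈0 (E-orthogonal j x Uu) ⟩
        0#                                      ∎
      y≈0 : ¬ y ≈ᵛ 0ᵛ → y ≈ᵛ 0ᵛ
      y≈0 y≉0 = let j , θj≈0 = Equivalence.to (θ-spectrum 0#) (y , My , y≉0) in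
        ⟨x,x⟩≈0⇒x≈0 (y⊥U {j} λ p → trans (My p) (*-congʳ (sym θj≈0)))

    E-combination : ∀ (a : Fin size → Carrier) x j →
      E j *ᵛ (λ k → sum λ i → a i * (E i *ᵛ x) k) ≈ᵛ λ k → a j * (E j *ᵛ x) k
    E-combination a x j p = begin
      (E j *ᵛ (λ k → sum λ i → a i * (E i *ᵛ x) k)) p    ≈⟨ *ᵛ-sum (E j) (λ i k → a i * (E i *ᵛ x) k) p ⟩
      sum (λ i → (E j *ᵛ (λ k → a i * (E i *ᵛ x) k)) p)  ≈⟨ sum-cong (λ i → *ᵛ-scale (E j) (a i) (E i *ᵛ x) p) ⟩
      sum (λ i → a i * (E j *ᵛ (E i *ᵛ x)) p)            ≈⟨ sum-single _ j
          (λ i i≢j → trans (*-congˡ (E-off (i≢j ∘ ≡.sym) (U-E i x) p)) (zeroʳ (a i))) ⟩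
      a j * (E j *ᵛ (E j *ᵛ x)) p                        ≈⟨ *-congˡ (E-on (U-E j x) p) ⟩
      a j * (E j *ᵛ x) p                                 ∎

    -- Lets M and its powers be treated alike on the eigenspaces of M. The eigenspaces of Mᵏ itself
    -- are never formed; they can be larger, as distinct eigenvalues may have equal kth powers.
    ActsBy : Matrix n → (Fin size → Carrier) → Set _
    ActsBy K κ = ∀ {i u} → U i u → K *ᵛ u ≈ᵛ λ k → κ i * u k

    ActsBy-^ : ∀ {K κ} → ActsBy K κ → ∀ m → ActsBy (K ^ᴹ m) (λ i → κ i ^ m)
    ActsBy-^ h zero {u = u} Uu p = trans (1ᴹ-*ᵛ u p) (sym (*-identityˡ (u p)))
    ActsBy-^ {K} {κ} h (suc m) {i} {u} Uu p = begin
      ((K *ᴹ K ^ᴹ m) *ᵛ u) p              ≈⟨ *ᴹ-*ᵛ K (K ^ᴹ m) u p ⟩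
      (K *ᵛ (K ^ᴹ m *ᵛ u)) p              ≈⟨ *ᵛ-cong K (ActsBy-^ {K} {κ} h m Uu) p ⟩
      (K *ᵛ (λ k → κ i ^ m * u k)) p      ≈⟨ *ᵛ-scale K (κ i ^ m) u p ⟩
      κ i ^ m * (K *ᵛ u) p                ≈⟨ *-congˡ (h Uu p) ⟩
      κ i ^ m * (κ i * u p)               ≈⟨ solve 3 (λ a b x → a :* (b :* x) := b :* a :* x) refl (κ i ^ m) (κ i) (u p) ⟩
      κ i * κ i ^ m * u p                 ∎

    ActsBy-M^ : ∀ k → ActsBy (M ^ᴹ k) (λ i → θ i ^ k)
    ActsBy-M^ = ActsBy-^ {M} {θ} id

    ActsBy-sum : ∀ {K κ} → ActsBy K κ → ∀ x → K *ᵛ x ≈ᵛ λ k → sum λ i → κ i * (E i *ᵛ x) k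
    ActsBy-sum {K} h x p = trans (*ᵛ-cong K (resolution x) p)
      (trans (*ᵛ-sum K (λ i → E i *ᵛ x) p) (sum-cong λ i → h (U-E i x) p))

  -- The matrix exponential exp(-iτK)

  module ℂS = Algebra.Definitions.RawSemiring (RawRing.rawSemiring ℂ-rawRing)

  re-sum : ∀ (f : Fin n → ℂ) → re (ℂS.sum f) ≡ sum (re ∘ f)
  re-sum {zero}  f = ≡.refl
  re-sum {suc n} f = ≡.cong (λ s → re (f Fin.zero) + s) (re-sum (f ∘ Fin.suc))

  im-sum : ∀ (f : Fin n → ℂ) → im (ℂS.sum f) ≡ sum (im ∘ f)
  im-sum {zero}  f = ≡.refl
  im-sum {suc n} f = ≡.cong (λ s → im (f Fin.zero) + s) (im-sum (f ∘ Fin.suc))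

  re-e : ∀ (j i : Fin n) → re (ℂM.e j i) ≈ e j i
  re-e j i with i Finₚ.≟ j
  ... | yes _ = refl
  ... | no  _ = refl

  im-e : ∀ (j i : Fin n) → im (ℂM.e j i) ≈ 0#
  im-e j i with i Finₚ.≟ j
  ... | yes _ = refl
  ... | no  _ = refl

  re-*ᵛ-e : ∀ (X : ℂM.Matrix n) j i → re ((X ℂM.*ᵛ ℂM.e j) i) ≈ re (X i j)
  re-*ᵛ-e X j i = begin
    re ((X ℂM.*ᵛ ℂM.e j) i)        ≡⟨ re-sum (λ k → X i k ℂ-Ring.* ℂM.e j k) ⟩
    sum (λ k → re (X i k) * re (ℂM.e j k) - im (X i k) * im (ℂM.e j k))
      ≈⟨ sum-cong (λ k → trans (+-cong (*-congˡ (re-e j k)) (-‿cong (*-congˡ (im-e j k))))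
           (solve 3 (λ x y d → x :* d :- y :* :0 := x :* d) refl (re (X i k)) (im (X i k)) (e j k))) ⟩
    sum (λ k → re (X i k) * e j k) ≈⟨ sum-*-e (λ k → re (X i k)) j ⟩
    re (X i j)                     ∎

  im-*ᵛ-e : ∀ (X : ℂM.Matrix n) j i → im ((X ℂM.*ᵛ ℂM.e j) i) ≈ im (X i j)
  im-*ᵛ-e X j i = begin
    im ((X ℂM.*ᵛ ℂM.e j) i)        ≡⟨ im-sum (λ k → X i k ℂ-Ring.* ℂM.e j k) ⟩
    sum (λ k → re (X i k) * im (ℂM.e j k) + im (X i k) * re (ℂM.e j k))
      ≈⟨ sum-cong (λ k → trans (+-cong (*-congˡ (im-e j k)) (*-congˡ (re-e j k)))
           (solve 3 (λ x y d → x :* :0 :+ y :* d := y :* d) refl (re (X i k)) (im (X i k)) (e j k))) ⟩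
    sum (λ k → im (X i k) * e j k) ≈⟨ sum-*-e (λ k → im (X i k)) j ⟩
    im (X i j)                     ∎

  module _ (τ : Carrier) (K : Matrix n) where

    -- Here (-i)ᵐ is the conjugate `cosᵂ m` - i `sinᵂ m` of iᵐ, which explains the minus sign of the
    -- imaginary part.
    -i•-^ : ∀ m p q →
      (re (((-i τ • K) ℂM.^ᴹ m) p q) ≈ cosᵂ m * (τ ^ m * (K ^ᴹ m) p q)) ×
      (im (((-i τ • K) ℂM.^ᴹ m) p q) ≈ - sinᵂ m * (τ ^ m * (K ^ᴹ m) p q))
    -i•-^ zero p q =
        trans (re-e q p) (solve 1 (λ d → d := :1 :* (:1 :* d)) refl (e q p))
      , trans (im-e q p) (solve 1 (λ d → :0 := :- :0 :* (:1 :* d)) refl (e q p))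
    -i•-^ (suc m) p q = real , imag
      where
      A = -i τ • K
      P : Fin _ → Carrier
      P k = (K ^ᴹ m) k q
      scale : ∀ w → sum (λ k → w * (τ * τ ^ m) * (K p k * P k)) ≈ w * (τ * τ ^ m * (K ^ᴹ suc m) p q)
      scale w = trans (sum-scale (w * (τ * τ ^ m)) (λ k → K p k * P k)) (*-assoc _ _ _)
      real : re ((A ℂM.^ᴹ suc m) p q) ≈ - sinᵂ m * (τ * τ ^ m * (K ^ᴹ suc m) p q)
      real = trans (reflexive (re-sum (λ k → A p k ℂ-Ring.* (A ℂM.^ᴹ m) k q)))
        (trans (sum-cong λ k → trans (+-cong (*-congˡ (proj₁ (-i•-^ m k q))) (-‿cong (*-congˡ (proj₂ (-i•-^ m k q)))))
          (solve 6 (λ t x c s u v → :0 :* (c :* (u :* v)) :- :- (t :* x) :* (:- s :* (u :* v)) := :- s :* (t :* u) :* (x :* v)) refl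
            τ (K p k) (cosᵂ m) (sinᵂ m) (τ ^ m) (P k)))
          (scale (- sinᵂ m)))
      imag : im ((A ℂM.^ᴹ suc m) p q) ≈ - cosᵂ m * (τ * τ ^ m * (K ^ᴹ suc m) p q)
      imag = trans (reflexive (im-sum (λ k → A p k ℂ-Ring.* (A ℂM.^ᴹ m) k q)))
        (trans (sum-cong λ k → trans (+-cong (*-congˡ (proj₂ (-i•-^ m k q))) (*-congˡ (proj₁ (-i•-^ m k q))))
          (solve 6 (λ t x c s u v → :0 :* (:- s :* (u :* v)) :+ :- (t :* x) :* (c :* (u :* v)) := :- c :* (t :* u) :* (x :* v)) refl
            τ (K p k) (cosᵂ m) (sinᵂ m) (τ ^ m) (P k)))
          (scale (- cosᵂ m)))

  term-* : ∀ m x y → term m (x * y) ≈ term m x * y ^ m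
  term-* m x y = begin
    term m (x * y)                       ≈⟨ term-def m (x * y) ⟩
    (x * y) ^ m * fromℕ (m !) ⁻¹         ≈⟨ *-congʳ (^-distrib-* x y m) ⟩
    x ^ m * y ^ m * fromℕ (m !) ⁻¹       ≈⟨ solve 3 (λ a b i → a :* b :* i := a :* i :* b) refl (x ^ m) (y ^ m) _ ⟩
    x ^ m * fromℕ (m !) ⁻¹ * y ^ m       ≈⟨ *-congʳ (term-def m x) ⟨
    term m x * y ^ m                     ∎

  sg : Sign → Carrier
  sg Sign.+ = 1#
  sg Sign.- = - 1#

  module Exp {M : Matrix n} (symM : Symmetric M) (D : SpectralDecomposition M) where
    open SpectralDecomposition D
    open Spectral symM D

    signed≈ : ∀ σ x → signed D σ x ≈ sg σ * x
    signed≈ Sign.+ x = sym (*-identityˡ x)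
    signed≈ Sign.- x = solve 1 (λ x → :- x := :- :1 :* x) refl x

    module _ {K : Matrix n} {κ : Fin size → Carrier} (act : ActsBy K κ) (τ : Carrier) where

      module _ (p q : Fin n) where
        private
          v : Fin size → Carrier
          v i = (E i *ᵛ e q) p

          power-entry : ∀ m → (K ^ᴹ m) p q ≈ sum λ i → κ i ^ m * v i
          power-entry m = trans (sym (*ᵛ-e (K ^ᴹ m) q p)) (ActsBy-sum {K ^ᴹ m} (ActsBy-^ {K} {κ} act m) (e q) p)

          expand : ∀ m w → fromℕ (m !) ⁻¹ * (w * (τ ^ m * (K ^ᴹ m) p q)) ≈ sum λ i → v i * (w * term m (τ * κ i))
          expand m w = begin
            f * (w * (τ ^ m * (K ^ᴹ m) p q))
              ≈⟨ solve 4 (λ f w t k → f :* (w :* (t :* k)) := w :* (t :* f) :* k) refl f w (τ ^ m) ((K ^ᴹ m) p q) ⟩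
            w * (τ ^ m * f) * (K ^ᴹ m) p q
              ≈⟨ *-cong (*-congˡ (sym (term-def m τ))) (power-entry m) ⟩
            w * term m τ * sum (λ i → κ i ^ m * v i)
              ≈⟨ sum-scale (w * term m τ) (λ i → κ i ^ m * v i) ⟨
            sum (λ i → w * term m τ * (κ i ^ m * v i))
              ≈⟨ sum-cong (λ i → trans (solve 4 (λ w t k v → w :* t :* (k :* v) := v :* (w :* (t :* k))) refl w (term m τ) (κ i ^ m) (v i))
                   (*-congˡ (*-congˡ (sym (term-* m τ (κ i)))))) ⟩
            sum (λ i → v i * (w * term m (τ * κ i))) ∎
            where
            f : Carrier
            f = fromℕ (m !) ⁻¹

          series-expand : ∀ (w : ℕ → Carrier) N → series (λ m → sum λ i → v i * (w m * term m (τ * κ i))) N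
            ≈ sum λ i → v i * weighted w (τ * κ i) N
          series-expand w N = trans (∑-comm {N} (λ j i → v i * (w (toℕ j) * term (toℕ j) (τ * κ i))))
            (sum-cong λ i → series-scale (v i) (λ m → w m * term m (τ * κ i)) N)

          -- Exchanging the partial sums with the finite sum over eigenspaces leaves one scalar
          -- series at τκᵢ for each eigenspace, so the matrix series converges without any estimate
          -- of matrix norms.
          series-limit : ∀ {w : ℕ → Carrier} {f : Carrier → Carrier} → (∀ x → weighted w x ⟶ f x) →
            ∀ {t : ℕ → Carrier} → (∀ m → t m ≈ fromℕ (m !) ⁻¹ * (w m * (τ ^ m * (K ^ᴹ m) p q))) →
            series t ⟶ sum λ i → v i * f (τ * κ i)
          series-limit {w} {f} lim {t} eq = ⟶-cong
            (λ N → sym (trans (series-cong (λ m → trans (eq m) (expand m (w m))) N) (series-expand w N))) refl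
            (⟶-sum λ i → ⟶-* (⟶-const (v i)) (lim (τ * κ i)))

          Z : ℕ → ℂ
          Z m = ((-i τ • K) ℂM.^ᴹ m) p q

          im-term : ∀ m → im (expTerm (-i τ • K) m p q) ≈ - 1# * (fromℕ (m !) ⁻¹ * (sinᵂ m * (τ ^ m * (K ^ᴹ m) p q)))
          im-term m = trans (solve 3 (λ f x y → f :* y :+ :0 :* x := f :* y) refl (fromℕ (m !) ⁻¹) (re (Z m)) (im (Z m)))
            (trans (*-congˡ (proj₂ (-i•-^ τ K m p q)))
              (solve 3 (λ f s x → f :* (:- s :* x) := :- :1 :* (f :* (s :* x))) refl (fromℕ (m !) ⁻¹) (sinᵂ m) (τ ^ m * (K ^ᴹ m) p q)))

        exp-re : series (λ m → re (expTerm (-i τ • K) m p q)) ⟶ sum λ i → v i * cos (τ * κ i)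
        exp-re = series-limit {cosᵂ} {cos} cos-limit λ m →
          trans (solve 3 (λ f x y → f :* x :- :0 :* y := f :* x) refl (fromℕ (m !) ⁻¹) (re (Z m)) (im (Z m)))
            (*-congˡ (proj₁ (-i•-^ τ K m p q)))

        exp-im : series (λ m → im (expTerm (-i τ • K) m p q)) ⟶ - sum λ i → v i * sin (τ * κ i)
        exp-im = ⟶-cong
          (λ N → sym (trans (series-cong im-term N) (trans (series-scale (- 1#) t N) (solve 1
              (λ x → :- :1 :* x := :- x) refl (series t N)))))
          refl (⟶-neg (series-limit {sinᵂ} {sin} sin-limit {t} λ _ → refl))
          where
          t : ℕ → Carrier
          t m = fromℕ (m !) ⁻¹ * (sinᵂ m * (τ ^ m * (K ^ᴹ m) p q))

      -- Real and imaginary parts of Σ exp(-iτκᵢ) Eᵢ e_a = γ e_b: the condition for transfer, freed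
      -- of the exponential series.
      Amplitudes : (a b : Fin n) → ℂ → Set _
      Amplitudes a b γ = ∀ p →
        ((sum λ i → cos (τ * κ i) * (E i *ᵛ e a) p) ≈ re γ * e b p) ×
        ((sum λ i → - sin (τ * κ i) * (E i *ᵛ e a) p) ≈ im γ * e b p)

      private
        entry-re : ∀ (a p : Fin n) → (sum λ i → (E i *ᵛ e a) p * cos (τ * κ i)) ≈ sum λ i → cos (τ * κ i) * (E i *ᵛ e a) p
        entry-re a p = sum-cong λ i → *-comm ((E i *ᵛ e a) p) (cos (τ * κ i))

        entry-im : ∀ (a p : Fin n) → - (sum λ i → (E i *ᵛ e a) p * sin (τ * κ i)) ≈ sum λ i → - sin (τ * κ i) * (E i *ᵛ e a) p
        entry-im a p = trans (solve 1 (λ x → :- x := :- :1 :* x) refl (sum λ i → (E i *ᵛ e a) p * sin (τ * κ i)))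
          (trans (sym (sum-scale (- 1#) λ i → (E i *ᵛ e a) p * sin (τ * κ i)))
            (sum-cong λ i → solve 2 (λ v s → :- :1 :* (v :* s) := :- s :* v) refl ((E i *ᵛ e a) p) (sin (τ * κ i))))

        re-γe : ∀ γ (b p : Fin n) → re (γ ℂ-Ring.* ℂM.e b p) ≈ re γ * e b p
        re-γe γ b p = trans (+-cong (*-congˡ (re-e b p)) (-‿cong (*-congˡ (im-e b p))))
          (solve 3 (λ x y d → x :* d :- y :* :0 := x :* d) refl (re γ) (im γ) (e b p))

        im-γe : ∀ γ (b p : Fin n) → im (γ ℂ-Ring.* ℂM.e b p) ≈ im γ * e b p
        im-γe γ b p = trans (+-cong (*-congˡ (im-e b p)) (*-congˡ (re-e b p)))
          (solve 3 (λ x y d → x :* :0 :+ y :* d := y :* d) refl (re γ) (im γ) (e b p))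

      PSTAt⇒Amplitudes : ∀ {a b} → PSTAt K a b τ → ∃[ γ ] IsUnimodular γ × Amplitudes a b γ
      PSTAt⇒Amplitudes {a} {b} (_ , X , expX , γ , uni , Xe) = γ , uni , λ p →
          trans (trans (sym (entry-re a p)) (⟶-unique (exp-re p a) (IsLimit⇒⟶ (proj₁ (expX p a)))))
            (trans (sym (re-*ᵛ-e X a p)) (trans (proj₁ (Xe p)) (re-γe γ b p)))
        , trans (trans (sym (entry-im a p)) (⟶-unique (exp-im p a) (IsLimit⇒⟶ (proj₂ (expX p a)))))
            (trans (sym (im-*ᵛ-e X a p)) (trans (proj₂ (Xe p)) (im-γe γ b p)))

      Amplitudes⇒PSTAt : ∀ {a b} γ → 0# < τ → IsUnimodular γ → Amplitudes a b γ → PSTAt K a b τ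
      Amplitudes⇒PSTAt {a} {b} γ 0<τ uni amp = 0<τ , X
        , (λ p q → ⟶⇒IsLimit (exp-re p q) , ⟶⇒IsLimit (exp-im p q))
        , γ , uni , λ p →
            trans (re-*ᵛ-e X a p) (trans (entry-re a p) (trans (proj₁ (amp p)) (sym (re-γe γ b p))))
          , trans (im-*ᵛ-e X a p) (trans (entry-im a p) (trans (proj₂ (amp p)) (sym (im-γe γ b p))))
        where
        X : ℂM.Matrix n
        X p q = (sum λ i → (E i *ᵛ e q) p * cos (τ * κ i)) +i (- sum λ i → (E i *ᵛ e q) p * sin (τ * κ i))

      -- Projecting γ e_b = Σ exp(-iτκᵢ) Eᵢ e_a to one eigenspace reads off its phase.
      phase : ∀ {a b γ} → Amplitudes a b γ → ∀ j σ → ¬ E j *ᵛ e a ≈ᵛ 0ᵛ →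
        (E j *ᵛ e b ≈ᵛ λ p → signed D σ ((E j *ᵛ e a) p)) →
        (cos (τ * κ j) ≈ re γ * sg σ) × (- sin (τ * κ j) ≈ im γ * sg σ)
      phase {a} {b} {γ} amp j σ nz sign = read (λ i → cos (τ * κ i)) (re γ) (λ p → proj₁ (amp p))
                                        , read (λ i → - sin (τ * κ i)) (im γ) (λ p → proj₂ (amp p))
        where
        va : Vector Carrier n
        va = E j *ᵛ e a
        read : ∀ (z : Fin size → Carrier) g → (∀ p → (sum λ i → z i * (E i *ᵛ e a) p) ≈ g * e b p) → z j ≈ g * sg σ
        read z g eq = x-y≈0⇒x≈y (decidable-stable ((z j - g * sg σ) ≟ 0#) λ d≉0 →
          nz λ p → x*y≈0⇒y≈0 d≉0 (trans
            (solve 4 (λ z g s v → (z :- g :* s) :* v := z :* v :- g :* (s :* v)) refl (z j) g (sg σ) (va p))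
            (x≈y⇒x-y≈0 (begin
              z j * va p                                          ≈⟨ E-combination z (e a) j p ⟨
              (E j *ᵛ (λ k → sum λ i → z i * (E i *ᵛ e a) k)) p   ≈⟨ *ᵛ-cong (E j) eq p ⟩
              (E j *ᵛ (λ k → g * e b k)) p                        ≈⟨ *ᵛ-scale (E j) g (e b) p ⟩
              g * (E j *ᵛ e b) p                                  ≈⟨ *-congˡ (trans (sign p) (signed≈ σ (va p))) ⟩
              g * (sg σ * va p)                                   ∎))))

      amplitudes : ∀ {a b} γ → (∀ j p → cos (τ * κ j) * (E j *ᵛ e a) p ≈ re γ * (E j *ᵛ e b) p) →
        (∀ j p → - sin (τ * κ j) * (E j *ᵛ e a) p ≈ im γ * (E j *ᵛ e b) p) → Amplitudes a b γ
      amplitudes {a} {b} γ hre him p = collect hre , collect him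
        where
        collect : ∀ {z : Fin size → Carrier} {g} → (∀ j p → z j * (E j *ᵛ e a) p ≈ g * (E j *ᵛ e b) p) →
          (sum λ i → z i * (E i *ᵛ e a) p) ≈ g * e b p
        collect {z} {g} h = trans (sum-cong λ i → h i p)
            (trans (sum-scale g λ i → (E i *ᵛ e b) p) (*-congˡ (sym (resolution (e b) p))))

  -- Quadratic irrationalities

  fromℕ-injective : ∀ {m n} → fromℕ m ≈ fromℕ n → m ≡ n
  fromℕ-injective {m} {n} eq with ℕₚ.<-cmp m n
  ... | tri< m<n _ _ = contradiction eq (<⇒≉ (fromℕ-mono-< m<n))
  ... | tri≈ _ m≡n _ = m≡n
  ... | tri> _ _ n<m = contradiction eq (>⇒≉ (fromℕ-mono-< n<m))

  fromℤ≈fromℤ′ : ∀ z → fromℤ z ≈ fromℤ′ z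
  fromℤ≈fromℤ′ (+ n)    = fromℕ≈fromℤ′ n
  fromℤ≈fromℤ′ -[1+ n ] = -‿cong (fromℕ≈fromℤ′ (suc n))

  fromℤ′-square : ∀ z → fromℤ′ z * fromℤ′ z ≈ fromℕ (∣ z ∣ ℕ.* ∣ z ∣)
  fromℤ′-square z = trans (eq z) (sym (fromℕ-* ∣ z ∣ ∣ z ∣))
    where
    eq : ∀ z → fromℤ′ z * fromℤ′ z ≈ fromℕ ∣ z ∣ * fromℕ ∣ z ∣
    eq (+ n)    = *-cong (sym (fromℕ≈fromℤ′ n)) (sym (fromℕ≈fromℤ′ n))
    eq -[1+ n ] = trans (solve 1 (λ x → :- x :* :- x := x :* x) refl (fromℤ′ (+ suc n)))
      (*-cong (sym (fromℕ≈fromℤ′ (suc n))) (sym (fromℕ≈fromℤ′ (suc n))))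

  -- A fraction, not necessarily reduced, with its denominator cleared. Closure under sums and
  -- products is then plain integer arithmetic, and `fromℚ` need not be shown to be a homomorphism
  -- on normalised fractions.
  Rational : Carrier → Set _
  Rational x = ∃₂ λ p q → (¬ fromℤ′ q ≈ 0#) × (fromℤ′ q * x ≈ fromℤ′ p)

  ℤ-rational : ∀ z → Rational (fromℤ′ z)
  ℤ-rational z = z , + 1 , (0≉1 ∘ sym) , *-identityˡ _

  ℕ-rational : ∀ n → Rational (fromℕ n)
  ℕ-rational n = + n , + 1 , (0≉1 ∘ sym) , trans (*-identityˡ _) (fromℕ≈fromℤ′ n)

  fromℕ↧≉0 : ∀ q → ¬ fromℕ (↧ₙ q) ≈ 0#
  fromℕ↧≉0 q = fromℕ-suc≉0 (ℚ.ℚ.denominator-1 q)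

  fromℕ⁻¹-cancel : ∀ {x y} → ¬ y ≈ 0# → y * (x * y ⁻¹) ≈ x
  fromℕ⁻¹-cancel {x} {y} y≉0 = trans (solve 3 (λ x y i → y :* (x :* i) := x :* (y :* i)) refl x y (y ⁻¹))
    (trans (*-congˡ (⁻¹-inverseʳ y≉0)) (*-identityʳ x))

  ℚ-rational : ∀ q → Rational (fromℚ q)
  ℚ-rational q = ↥ q , + ↧ₙ q , (λ eq → fromℕ↧≉0 q (trans (fromℕ≈fromℤ′ (↧ₙ q)) eq))
    , trans (*-congʳ (sym (fromℕ≈fromℤ′ (↧ₙ q)))) (trans (fromℕ⁻¹-cancel (fromℕ↧≉0 q)) (fromℤ≈fromℤ′ (↥ q)))

  rational-* : ∀ {x y} → Rational x → Rational y → Rational (x * y)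
  rational-* {x} {y} (p , q , q≉0 , eq) (r , s , s≉0 , eq′) = p ℤ.* r , q ℤ.* s
    , (λ qs≈0 → *-≉0 q≉0 s≉0 (trans (sym (fromℤ′-* q s)) qs≈0)) , (begin
      fromℤ′ (q ℤ.* s) * (x * y)           ≈⟨ *-congʳ (fromℤ′-* q s) ⟩
      fromℤ′ q * fromℤ′ s * (x * y)        ≈⟨ solve 4 (λ q s x y → q :* s :* (x :* y) := q :* x :* (s :* y))
          refl (fromℤ′ q) (fromℤ′ s) x y ⟩
      fromℤ′ q * x * (fromℤ′ s * y)        ≈⟨ *-cong eq eq′ ⟩
      fromℤ′ p * fromℤ′ r                  ≈⟨ fromℤ′-* p r ⟨
      fromℤ′ (p ℤ.* r)                     ∎)

  rational-+ : ∀ {x y} → Rational x → Rational y → Rational (x + y)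
  rational-+ {x} {y} (p , q , q≉0 , eq) (r , s , s≉0 , eq′) = p ℤ.* s ℤ.+ q ℤ.* r , q ℤ.* s
    , (λ qs≈0 → *-≉0 q≉0 s≉0 (trans (sym (fromℤ′-* q s)) qs≈0)) , (begin
      fromℤ′ (q ℤ.* s) * (x + y)           ≈⟨ *-congʳ (fromℤ′-* q s) ⟩
      fromℤ′ q * fromℤ′ s * (x + y)        ≈⟨ solve 4
          (λ q s x y → q :* s :* (x :+ y) := q :* x :* s :+ q :* (s :* y)) refl (fromℤ′ q) (fromℤ′ s) x y ⟩
      fromℤ′ q * x * fromℤ′ s + fromℤ′ q * (fromℤ′ s * y) ≈⟨ +-cong (*-congʳ eq) (*-congˡ eq′) ⟩
      fromℤ′ p * fromℤ′ s + fromℤ′ q * fromℤ′ r ≈⟨ +-cong (fromℤ′-* p s) (fromℤ′-* q r) ⟨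
      fromℤ′ (p ℤ.* s) + fromℤ′ (q ℤ.* r)  ≈⟨ fromℤ′-+ (p ℤ.* s) (q ℤ.* r) ⟨
      fromℤ′ (p ℤ.* s ℤ.+ q ℤ.* r)         ∎)

  rational-neg : ∀ {x} → Rational x → Rational (- x)
  rational-neg {x} (p , q , q≉0 , eq) = ℤ.- p , q , q≉0
    , trans (sym (-‿distribʳ-* (fromℤ′ q) x)) (trans (-‿cong eq) (sym (fromℤ′-neg p)))

  rational-^ : ∀ {x} → Rational x → ∀ n → Rational (x ^ n)
  rational-^ r zero    = ℤ-rational (+ 1)
  rational-^ r (suc n) = rational-* r (rational-^ r n)

  0<fromℚ : ∀ q → 0ℚ ℚ.< q → 0# < fromℚ q
  0<fromℚ q 0<q = positive q {{ℚ.positive 0<q}}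
    where
    positive : ∀ q → .{{ℚ.Positive q}} → 0# < fromℚ q
    positive q@(mkℚ (+ suc n) d _) = *-pos (0<fromℕ {suc n} (ℕ.s≤s ℕ.z≤n)) (0<⁻¹ (0<fromℕ {suc d} (ℕ.s≤s ℕ.z≤n)))

  fromℚ≉0 : ∀ {q} → q ≢ 0ℚ → ¬ fromℚ q ≈ 0#
  fromℚ≉0 {q} q≢0 eq = nonzero (↥ q) (q≢0 ∘ ℚₚ.↥p≡0⇒p≡0 q)
    (trans (sym (fromℕ⁻¹-cancel (fromℕ↧≉0 q))) (trans (*-congˡ eq) (zeroʳ _)))
    where
    nonzero : ∀ z → z ≢ + 0 → ¬ fromℤ z ≈ 0#
    nonzero (+ zero)   z≢0 _ = z≢0 ≡.refl
    nonzero (+ suc n)  _     = fromℕ-suc≉0 n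
    nonzero -[1+ n ]   _   eq = fromℕ-suc≉0 n (trans (sym (-‿involutive _)) (trans (-‿cong eq) -0#≈0#))

  module Quadratic {Δ : ℕ} (1<Δ : 1 ℕ.< Δ) (sqf : SquareFree Δ) {√Δ : Carrier} (isSqrt : IsSqrt (fromℕ Δ) √Δ) where

    0<Δ : 0# < fromℕ Δ
    0<Δ = 0<fromℕ (ℕₚ.<⇒≤ 1<Δ)

    0<√Δ : 0# < √Δ
    0<√Δ = [ id , (λ 0≈√Δ → contradiction (trans (sym (zeroʳ √Δ)) (trans (*-congˡ 0≈√Δ) (proj₂ isSqrt))) (<⇒≉ 0<Δ)) ]′ (proj₁ isSqrt)

    -- Multiplying by both denominators turns the relation into u = -v√Δ with integers u and v.
    -- Squaring gives |u|² = Δ|v|² in ℕ, which `squareFree-nonsquare` excludes when v ≠ 0.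
    irrational : ∀ {x y} → Rational x → Rational y → x + y * √Δ ≈ 0# → y ≈ 0#
    irrational {x} {y} (p , q , q≉0 , qx≈p) (r , s , s≉0 , sy≈r) eq =
      decidable-stable (y ≟ 0#) λ y≉0 → squareFree-nonsquare 1<Δ sqf ∣ u ∣ ∣ v ∣ (∣v∣≢0 y≉0)
        (fromℕ-injective (begin
          fromℕ (∣ u ∣ ℕ.* ∣ u ∣)              ≈⟨ fromℤ′-square u ⟨
          fromℤ′ u * fromℤ′ u                  ≈⟨ *-cong u≈ u≈ ⟩
          - (fromℤ′ v * √Δ) * - (fromℤ′ v * √Δ) ≈⟨ solve 2
              (λ v d → :- (v :* d) :* :- (v :* d) := d :* d :* (v :* v)) refl (fromℤ′ v) √Δ ⟩
          √Δ * √Δ * (fromℤ′ v * fromℤ′ v)      ≈⟨ *-cong (proj₂ isSqrt) (fromℤ′-square v) ⟩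
          fromℕ Δ * fromℕ (∣ v ∣ ℕ.* ∣ v ∣)    ≈⟨ fromℕ-* Δ (∣ v ∣ ℕ.* ∣ v ∣) ⟨
          fromℕ (Δ ℕ.* (∣ v ∣ ℕ.* ∣ v ∣))      ∎))
      where
      u v : ℤ
      u = p ℤ.* s
      v = q ℤ.* r
      u≈ : fromℤ′ u ≈ - (fromℤ′ v * √Δ)
      u≈ = begin
        fromℤ′ (p ℤ.* s)                              ≈⟨ fromℤ′-* p s ⟩
        fromℤ′ p * fromℤ′ s                           ≈⟨ *-congʳ qx≈p ⟨
        fromℤ′ q * x * fromℤ′ s                       ≈⟨ solve 5
            (λ q x s y d → q :* x :* s := q :* s :* (x :+ y :* d) :- q :* (s :* y) :* d) refl (fromℤ′ q) x (fromℤ′ s) y √Δ ⟩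
        fromℤ′ q * fromℤ′ s * (x + y * √Δ) - fromℤ′ q * (fromℤ′ s * y) * √Δ
          ≈⟨ +-cong (*-congˡ eq) (-‿cong (*-congʳ (trans (*-congˡ sy≈r) (sym (fromℤ′-* q r))))) ⟩
        fromℤ′ q * fromℤ′ s * 0# - fromℤ′ v * √Δ      ≈⟨ solve 2 (λ a b → a :* :0 :- b := :- b) refl _ _ ⟩
        - (fromℤ′ v * √Δ)                             ∎
      ∣v∣≢0 : ¬ y ≈ 0# → ∣ v ∣ ≢ 0
      ∣v∣≢0 y≉0 ∣v∣≡0 = *-≉0 q≉0 (*-≉0 s≉0 y≉0) (trans (*-congˡ sy≈r) (trans (sym (fromℤ′-* q r))
        (x*x≈0⇒x≈0 (trans (fromℤ′-square v) (reflexive (≡.cong (λ k → fromℕ (k ℕ.* k)) ∣v∣≡0))))))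

    module Power {α β : Carrier} (ratα : Rational α) (ratβ : Rational β) (0<β : 0# < β) where

      -- (α ± β√Δ)ᵏ = A k ± B k √Δ.
      A B : ℕ → Carrier
      A zero    = 1#
      A (suc k) = α * A k + β * fromℕ Δ * B k
      B zero    = 0#
      B (suc k) = α * B k + β * A k

      -- The root s is left open, so that the same A and B serve both outer eigenvalues, with s = √Δ
      -- and s = -√Δ.
      power : ∀ s → s * s ≈ fromℕ Δ → ∀ k → (α + β * s) ^ k ≈ A k + B k * s
      power s ss zero    = solve 1 (λ s → :1 := :1 :+ :0 :* s) refl s
      power s ss (suc k) = begin
        (α + β * s) * (α + β * s) ^ k       ≈⟨ *-congˡ (power s ss k) ⟩
        (α + β * s) * (A k + B k * s)       ≈⟨ solve 5 (λ x y s a b → (x :+ y :* s) :* (a :+ b :* s)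
                                                 := x :* a :+ y :* (s :* s) :* b :+ (x :* b :+ y :* a) :* s) refl α β s (A k) (B k) ⟩
        α * A k + β * (s * s) * B k + B (suc k) * s ≈⟨ +-congʳ (+-congˡ (*-congʳ (*-congˡ ss))) ⟩
        A (suc k) + B (suc k) * s           ∎

      A-rational : ∀ k → Rational (A k)
      B-rational : ∀ k → Rational (B k)
      A-rational zero    = ℤ-rational (+ 1)
      A-rational (suc k) = rational-+ (rational-* ratα (A-rational k)) (rational-* (rational-* ratβ (ℕ-rational Δ)) (B-rational k))
      B-rational zero    = ℤ-rational (+ 0)
      B-rational (suc k) = rational-+ (rational-* ratα (B-rational k)) (rational-* ratβ (A-rational k))

      module _ (α≉0 : ¬ α ≈ 0#) where

        -- As α may be negative, A and B have no fixed signs. The recurrences for A² and αAB,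
        -- however, close up with nonnegative coefficients, so the two quantities can be followed
        -- together.
        A²-step : ∀ k → A (suc k) * A (suc k) ≈
          α * α * (A k * A k) + (2# * (β * fromℕ Δ) * (α * A k * B k) + β * fromℕ Δ * B k * (β * fromℕ Δ * B k))
        A²-step k = solve 4 (λ x a y b → (x :* a :+ y :* b) :* (x :* a :+ y :* b)
          := x :* x :* (a :* a) :+ (:2 :* y :* (x :* a :* b) :+ y :* b :* (y :* b))) refl α (A k) (β * fromℕ Δ) (B k)

        αAB-step : ∀ k → α * A (suc k) * B (suc k) ≈
          α * α * β * (A k * A k) + (α * α * β * fromℕ Δ * (B k * B k) + (α * α + β * β * fromℕ Δ) * (α * A k * B k))
        αAB-step k = solve 5 (λ x y d a b → x :* (x :* a :+ y :* d :* b) :* (x :* b :+ y :* a)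
          := x :* x :* y :* (a :* a) :+ (x :* x :* y :* d :* (b :* b) :+ (x :* x :+ y :* y :* d) :* (x :* a :* b))) refl α β (fromℕ Δ) (A k) (B k)

        0<αα : 0# < α * α
        0<αα = 0<x² α≉0

        0≤βΔ : 0# ≤ β * fromℕ Δ
        0≤βΔ = inj₁ (*-pos 0<β 0<Δ)

        0<A² : ∀ k → 0# ≤ α * A k * B k → 0# < A k * A k → 0# < A (suc k) * A (suc k)
        0<A² k 0≤αAB 0<AA = <-respʳ (sym (A²-step k)) (0<-+ (*-pos 0<αα 0<AA)
          (0≤-+ (0≤-* (0≤-* 0≤2 0≤βΔ) 0≤αAB) (0≤x² _)))

        0<αAB : ∀ k → 0# ≤ α * A k * B k → 0# < A k * A k → 0# < α * A (suc k) * B (suc k)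
        0<αAB k 0≤αAB 0<AA = <-respʳ (sym (αAB-step k)) (0<-+ (*-pos (*-pos 0<αα 0<β) 0<AA)
          (0≤-+ (0≤-* (inj₁ (*-pos (*-pos 0<αα 0<β) 0<Δ)) (0≤x² (B k)))
                (0≤-* (0≤-+ (inj₁ 0<αα) (inj₁ (*-pos (*-pos 0<β 0<β) 0<Δ))) 0≤αAB)))

        signs : ∀ k → (0# ≤ α * A k * B k) × (0# < A k * A k)
        signs zero    = inj₂ (solve 1 (λ x → :0 := x :* :1 :* :0) refl α) , <-respʳ (sym (*-identityˡ 1#)) 0<1
        signs (suc k) = let p , q = signs k in inj₁ (0<αAB k p q) , 0<A² k p q

        B≉0 : ∀ k → ¬ B (suc k) ≈ 0#
        B≉0 k B≈0 = >⇒≉ (let p , q = signs k in 0<αAB k p q) (trans (*-congˡ B≈0) (zeroʳ _))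

        A²≥ : ∀ k → α ^ k * α ^ k ≤ A k * A k
        A²≥ zero    = ≤-refl
        A²≥ (suc k) = ≤-trans (inj₂ (solve 2 (λ x y → x :* y :* (x :* y) := x :* x :* (y :* y)) refl α (α ^ k)))
          (≤-trans (*-monoˡ-≤ (inj₁ 0<αα) (A²≥ k)) (by≤ (0≤-+ (0≤-* (0≤-* 0≤2 0≤βΔ) (proj₁ (signs k))) (0≤x² (β * fromℕ Δ * B k)))
            (trans (solve 2 (λ x y → y := x :+ y :- x) refl _ _) (+-congʳ (sym (A²-step k))))))

        -- Strictness starts exactly at exponent 2. The gain of each step contains a positive
        -- multiple of αAB, which is 0 at index 0 and positive from index 1 on; accordingly A 1 is
        -- still α.
        A²> : ∀ k → α ^ suc (suc k) * α ^ suc (suc k) < A (suc (suc k)) * A (suc (suc k))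
        A²> k = ≤-<-trans (≤-trans (inj₂ (solve 2 (λ x y → x :* y :* (x :* y) := x :* x :* (y :* y)) refl α (α ^ suc k)))
                  (*-monoˡ-≤ (inj₁ 0<αα) (A²≥ (suc k))))
          (by< (0<-+ (*-pos (*-pos 0<2 (*-pos 0<β 0<Δ)) (let p , q = signs k in 0<αAB k p q)) (0≤x² (β * fromℕ Δ * B (suc k))))
            (trans (solve 2 (λ x y → y := x :+ y :- x) refl _ _) (+-congʳ (sym (A²-step (suc k))))))

        A≉α^ : ∀ k → ¬ A (suc (suc k)) ≈ α ^ suc (suc k)
        A≉α^ k eq = <-irrefl (*-cong (sym eq) (sym eq)) (A²> k)

  -- Transfer between strongly cospectral vertices

  sg²≈1 : ∀ σ → sg σ * sg σ ≈ 1#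
  sg²≈1 Sign.+ = *-identityˡ 1#
  sg²≈1 Sign.- = solve 0 (:- :1 :* :- :1 := :1) refl

  sg-opposite : ∀ σ → sg (opposite σ) ≈ - sg σ
  sg-opposite Sign.+ = refl
  sg-opposite Sign.- = sym (-‿involutive 1#)

  0^suc≈0 : ∀ k → 0# ^ suc k ≈ 0#
  0^suc≈0 k = zeroˡ (0# ^ k)

  0<^ : ∀ {x} → 0# < x → ∀ k → 0# < x ^ k
  0<^ 0<x zero    = 0<1
  0<^ 0<x (suc k) = *-pos 0<x (0<^ 0<x k)

  -- Stands in for the parity of k. With middle phase 0, either sign gives an outer phase of π or
  -- -π, and both are antipodal to 0.
  neg-^ : ∀ x k → ((- x) ^ k ≈ x ^ k) ⊎ ((- x) ^ k ≈ - x ^ k)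
  neg-^ x zero    = inj₁ refl
  neg-^ x (suc k) = [ (λ eq → inj₂ (trans (*-congˡ eq) (sym (-‿distribˡ-* x (x ^ k)))))
                    , (λ eq → inj₁ (trans (*-congˡ eq) (solve 2 (λ x y → :- x :* :- y := x :* y) refl x (x ^ k)))) ]′ (neg-^ x k)

  -- In complex terms, exp(ix) = -exp(iy).
  Antipodal : Carrier → Carrier → Set _
  Antipodal x y = (cos x ≈ - cos y) × (sin x ≈ - sin y)

  +π-antipodal : ∀ {x y} → x ≈ y + π → Antipodal x y
  +π-antipodal {x} {y} eq =
      trans (cos-cong eq) (trans (cos-+ y π) (trans (+-cong (*-congˡ cos-π) (-‿cong (*-congˡ sin-π)))
        (solve 2 (λ c s → c :* :- :1 :- s :* :0 := :- c) refl (cos y) (sin y))))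
    , trans (sin-cong eq) (trans (sin-+ y π) (trans (+-cong (*-congˡ cos-π) (*-congˡ sin-π))
        (solve 2 (λ c s → s :* :- :1 :+ c :* :0 := :- s) refl (cos y) (sin y))))

  -π-antipodal : ∀ {x y} → x ≈ y - π → Antipodal x y
  -π-antipodal {x} {y} eq =
      trans (sym (-‿involutive _)) (-‿cong (sym (proj₁ y-antipodal)))
    , trans (sym (-‿involutive _)) (-‿cong (sym (proj₂ y-antipodal)))
    where
    y-antipodal : Antipodal y x
    y-antipodal = +π-antipodal (trans (solve 2 (λ y p → y := y :- p :+ p) refl y π) (+-congʳ (sym eq)))

  module Transfer {n} {M : Matrix n} (symM : Symmetric M) (D : SpectralDecomposition M) {a b : Fin n}
    (cospectral : StronglyCospectral D a b) {θ₋ θ₀ θ₊ : Carrier}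
    (support : supp D (e a) ≐ (λ l → (l ≈ θ₋) ⊎ (l ≈ θ₀) ⊎ (l ≈ θ₊)))
    (σ : Sign) (sign₋ : HasSign D a b θ₋ σ) (sign₊ : HasSign D a b θ₊ σ) (sign₀ : HasSign D a b θ₀ (opposite σ)) where

    open SpectralDecomposition D
    open Spectral symM D
    open Exp symM D

    i₋ i₀ i₊ : Fin size
    i₋ = proj₁ sign₋
    i₀ = proj₁ sign₀
    i₊ = proj₁ sign₊

    module _ {K : Matrix n} {κ : Fin size → Carrier} (act : ActsBy K κ) {τ : Carrier} where

      -- Write x for an outer phase and y for the middle one. Then exp(-ix) = γσ and exp(-iy) = -γσ,
      -- and cos(x - y) is the real part of the first times the conjugate of the second, namely
      -- -|γ|²σ² = -1.
      PSTAt⇒phase-π : PSTAt K a b τ → (cos (τ * κ i₊ - τ * κ i₀) ≈ - 1#) × (cos (τ * κ i₋ - τ * κ i₀) ≈ - 1#)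
      PSTAt⇒phase-π pst = opposite-phases (phase act τ {γ = γ} amp i₊ σ (proj₁ (proj₂ (proj₂ sign₊))) (proj₂ (proj₂ (proj₂ sign₊))))
                        , opposite-phases (phase act τ {γ = γ} amp i₋ σ (proj₁ (proj₂ (proj₂ sign₋))) (proj₂ (proj₂ (proj₂ sign₋))))
        where
        γ-amp : ∃[ γ ] IsUnimodular γ × Amplitudes act τ a b γ
        γ-amp = PSTAt⇒Amplitudes act τ pst
        γ : ℂ
        γ = proj₁ γ-amp
        uni : IsUnimodular γ
        uni = proj₁ (proj₂ γ-amp)
        amp : Amplitudes act τ a b γ
        amp = proj₂ (proj₂ γ-amp)
        phase₀ : (cos (τ * κ i₀) ≈ re γ * sg (opposite σ)) × (- sin (τ * κ i₀) ≈ im γ * sg (opposite σ))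
        phase₀ = phase act τ {γ = γ} amp i₀ (opposite σ) (proj₁ (proj₂ (proj₂ sign₀))) (proj₂ (proj₂ (proj₂ sign₀)))
        opposite-phases : ∀ {x} → (cos x ≈ re γ * sg σ) × (- sin x ≈ im γ * sg σ) → cos (x - τ * κ i₀) ≈ - 1#
        opposite-phases {x} (cos-x , sin-x) = begin
          cos (x - y)                                            ≈⟨ cos-sub x y ⟩
          cos x * cos y + sin x * sin y                          ≈⟨ +-congˡ (solve 2
              (λ s t → s :* t := :- s :* :- t) refl (sin x) (sin y)) ⟩
          cos x * cos y + - sin x * - sin y                      ≈⟨ +-cong (*-cong cos-x
              (trans (proj₁ phase₀) (*-congˡ (sg-opposite σ))))
                                                                          (*-cong sin-x
                                                                              (trans (proj₂ phase₀) (*-congˡ (sg-opposite σ)))) ⟩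
          re γ * sg σ * (re γ * - sg σ) + im γ * sg σ * (im γ * - sg σ)
            ≈⟨ solve 3 (λ r i s → r :* s :* (r :* :- s) :+ i :* s :* (i :* :- s) := :- ((r :* r :+ i :* i) :* (s :* s))) refl (re γ) (im γ) (sg σ) ⟩
          - ((re γ * re γ + im γ * im γ) * (sg σ * sg σ))        ≈⟨ -‿cong (*-cong uni (sg²≈1 σ)) ⟩
          - (1# * 1#)                                            ≈⟨ -‿cong (*-identityˡ 1#) ⟩
          - 1#                                                   ∎
          where
          y : Carrier
          y = τ * κ i₀

      antipodal⇒PSTAt : 0# < τ → Antipodal (τ * κ i₊) (τ * κ i₀) → Antipodal (τ * κ i₋) (τ * κ i₀) → PSTAt K a b τ
      antipodal⇒PSTAt 0<τ anti₊ anti₋ = Amplitudes⇒PSTAt act τ γ 0<τ uni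
        (amplitudes act τ γ (λ j → proj₁ (component j)) (λ j → proj₂ (component j)))
        where
        φ C S s : Carrier
        φ = τ * κ i₀
        C = cos φ
        S = sin φ
        s = sg σ
        γ : ℂ
        -- This is -σ exp(-iφ), the value forced by the middle eigenvalue, where the sign is -σ.
        γ = (- (s * C)) +i (s * S)
        uni : IsUnimodular γ
        uni = trans (solve 3 (λ s c t → :- (s :* c) :* :- (s :* c) :+ s :* t :* (s :* t) := s :* s :* (c :* c :+ t :* t)) refl s C S)
          (trans (*-cong (sg²≈1 σ) (cos²+sin²≈1 φ)) (*-identityˡ 1#))
        Component : Fin size → Set _
        Component j = (∀ p → cos (τ * κ j) * (E j *ᵛ e a) p ≈ re γ * (E j *ᵛ e b) p)
                    × (∀ p → - sin (τ * κ j) * (E j *ᵛ e a) p ≈ im γ * (E j *ᵛ e b) p)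
        outer : ∀ {j} → (E j *ᵛ e b ≈ᵛ λ p → signed D σ ((E j *ᵛ e a) p)) → Antipodal (τ * κ j) φ → Component j
        outer {j} eq (cos≈ , sin≈) =
            (λ p → trans (*-congʳ cos≈) (sym (trans (*-congˡ (trans (eq p) (signed≈ σ _)))
              (trans (solve 3 (λ s c v → :- (s :* c) :* (s :* v) := s :* s :* (:- c :* v)) refl s C ((E j *ᵛ e a) p)) (trans (*-congʳ (sg²≈1 σ)) (*-identityˡ _))))))
          , (λ p → trans (*-congʳ (trans (-‿cong sin≈) (-‿involutive S))) (sym (trans (*-congˡ (trans (eq p) (signed≈ σ _)))
              (trans (solve 3 (λ s c v → s :* c :* (s :* v) := s :* s :* (c :* v)) refl s S ((E j *ᵛ e a) p))
                  (trans (*-congʳ (sg²≈1 σ)) (*-identityˡ _))))))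
        middle : Component i₀
        middle =
            (λ p → sym (trans (*-congˡ (eq p))
              (trans (solve 3 (λ s c v → :- (s :* c) :* (:- s :* v) := s :* s :* (c :* v)) refl s C ((E i₀ *ᵛ e a) p)) (trans (*-congʳ (sg²≈1 σ)) (*-identityˡ _)))))
          , (λ p → sym (trans (*-congˡ (eq p))
              (trans (solve 3 (λ s c v → s :* c :* (:- s :* v) := s :* s :* (:- c :* v)) refl s S ((E i₀ *ᵛ e a) p)) (trans (*-congʳ (sg²≈1 σ)) (*-identityˡ _)))))
          where
          eq : ∀ p → (E i₀ *ᵛ e b) p ≈ - s * (E i₀ *ᵛ e a) p
          eq p = trans (proj₂ (proj₂ (proj₂ sign₀)) p) (trans (signed≈ (opposite σ) _) (*-congʳ (sg-opposite σ)))
        vanishing : ∀ {j} → E j *ᵛ e a ≈ᵛ 0ᵛ → E j *ᵛ e b ≈ᵛ 0ᵛ → Component j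
        vanishing va vb = (λ p → trans (*-congˡ (va p)) (trans (zeroʳ _) (sym (trans (*-congˡ (vb p)) (zeroʳ _)))))
                        , (λ p → trans (*-congˡ (va p)) (trans (zeroʳ _) (sym (trans (*-congˡ (vb p)) (zeroʳ _)))))
        -- Strong cospectrality enters through the equality of supports: where e_a has no component,
        -- e_b has none either, and the equation reads 0 = 0.
        b-vanishes : ∀ {j} → E j *ᵛ e a ≈ᵛ 0ᵛ → E j *ᵛ e b ≈ᵛ 0ᵛ
        b-vanishes {j} va = decidable-stable (≈ᵛ0? (E j *ᵛ e b)) λ nz →
          let i , θi≈θj , nz′ = proj₂ (proj₁ cospectral) (j , refl , nz) in
          nz′ (≡.subst (λ i → E i *ᵛ e a ≈ᵛ 0ᵛ) (≡.sym (θ-injective i j θi≈θj)) va)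
        at : ∀ {j l} {i : Fin size} → θ i ≈ l → θ j ≈ l → Component i → Component j
        at {j} {l} {i} θi θj = ≡.subst Component (θ-injective i j (trans θi (sym θj)))
        component : ∀ j → Component j
        component j with ≈ᵛ0? (E j *ᵛ e a)
        ... | yes va = vanishing va (b-vanishes va)
        ... | no  nz = [ (λ θj → at (proj₁ (proj₂ sign₋)) θj (outer (proj₂ (proj₂ (proj₂ sign₋))) anti₋))
                       , [ (λ θj → at (proj₁ (proj₂ sign₀)) θj middle)
                         , (λ θj → at (proj₁ (proj₂ sign₊)) θj (outer (proj₂ (proj₂ (proj₂ sign₊))) anti₊)) ]′ ]′
                       (proj₁ support (j , refl , nz))

    module Spacing {α β s : Carrier} (θ₀≈ : θ₀ ≈ α) (θ₊≈ : θ₊ ≈ α + β * s) (θ₋≈ : θ₋ ≈ α - β * s) (0<βs : 0# < β * s) where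

      θi₀ : θ i₀ ≈ α
      θi₀ = trans (proj₁ (proj₂ sign₀)) θ₀≈
      θi₊ : θ i₊ ≈ α + β * s
      θi₊ = trans (proj₁ (proj₂ sign₊)) θ₊≈
      θi₋ : θ i₋ ≈ α - β * s
      θi₋ = trans (proj₁ (proj₂ sign₋)) θ₋≈

      π/-cancel : ∀ {x} → 0# < x → π * x ⁻¹ * x ≈ π
      π/-cancel {x} 0<x = trans (solve 3 (λ p i x → p :* i :* x := p :* (x :* i)) refl π (x ⁻¹) x)
        (trans (*-congˡ (⁻¹-inverseʳ (>⇒≉ 0<x))) (*-identityʳ π))

      0<τ : ∀ {x} → 0# < x → 0# < π * x ⁻¹
      0<τ 0<x = *-pos 0<π (0<⁻¹ 0<x)

      -- At this time the outer phases differ from the middle one by π and -π. Allowing κ to agree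
      -- with θ only up to `≈` covers both M and `M ^ᴹ 1`, where the scalars are θ¹.
      transfer : ∀ {K κ} → ActsBy K κ → (∀ i → κ i ≈ θ i) → PSTAt K a b (π * (β * s) ⁻¹)
      transfer {K} {κ} act κ≈θ = antipodal⇒PSTAt act (0<τ 0<βs)
        (+π-antipodal (trans (*-congˡ (trans (κ≈θ i₊) θi₊)) (trans (distribˡ τ α (β * s)) (+-cong τα (π/-cancel 0<βs)))))
        (-π-antipodal (trans (*-congˡ (trans (κ≈θ i₋) θi₋)) (trans
          (solve 3 (λ t a x → t :* (a :- x) := t :* a :- t :* x) refl τ α (β * s)) (+-cong τα (-‿cong (π/-cancel 0<βs))))))
        where
        τ : Carrier
        τ = π * (β * s) ⁻¹
        τα : τ * α ≈ τ * κ i₀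
        τα = *-congˡ (sym (trans (κ≈θ i₀) θi₀))

      minimal : ∀ τ → PSTAt M a b τ → π * (β * s) ⁻¹ ≤ τ
      minimal τ pst = *-cancelˡ-≤ 0<βs (≤-respˡ (trans (sym (π/-cancel 0<βs)) (*-comm _ _)) (≤-respʳ (*-comm τ (β * s))
        (cos≈-1⇒π≤ (*-pos (proj₁ pst) 0<βs) (trans (cos-cong eq) (proj₁ (PSTAt⇒phase-π {M} {θ} id pst))))))
        where
        eq : τ * (β * s) ≈ τ * θ i₊ - τ * θ i₀
        eq = sym (trans (+-cong (*-congˡ θi₊) (-‿cong (*-congˡ θi₀)))
          (solve 3 (λ t a x → t :* (a :+ x) :- t :* a := t :* x) refl τ α (β * s)))

      transfer-power : α ≈ 0# → ∀ k → PST (M ^ᴹ suc k) a b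
      transfer-power α≈0 k = τ , antipodal⇒PSTAt (ActsBy-M^ (suc k)) (0<τ 0<x)
        (+π-antipodal (trans (*-congˡ (^-congˡ (suc k) {θ i₊} (trans θi₊ (trans (+-congʳ α≈0) (+-identityˡ _)))))
          (trans (π/-cancel 0<x) (sym (trans (+-congʳ φ₀) (+-identityˡ π))))))
        ([ (λ eq → +π-antipodal (trans (κ₋ eq) (trans (π/-cancel 0<x) (sym (trans (+-congʳ φ₀) (+-identityˡ π))))))
         , (λ eq → -π-antipodal (trans (κ₋ eq) (trans (sym (-‿distribʳ-* τ x)) (trans
             (-‿cong (π/-cancel 0<x)) (sym (trans (+-congʳ φ₀) (+-identityˡ (- π)))))))) ]′
         (neg-^ (β * s) (suc k)))
        where
        x τ : Carrier
        x = (β * s) ^ suc k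
        τ = π * x ⁻¹
        0<x : 0# < x
        0<x = 0<^ 0<βs (suc k)
        φ₀ : τ * θ i₀ ^ suc k ≈ 0#
        φ₀ = trans (*-congˡ (trans (^-congˡ (suc k) {θ i₀} (trans θi₀ α≈0)) (0^suc≈0 k))) (zeroʳ τ)
        κ₋ : ∀ {y} → (- (β * s)) ^ suc k ≈ y → τ * θ i₋ ^ suc k ≈ τ * y
        κ₋ eq = *-congˡ (trans (^-congˡ (suc k) {θ i₋} (trans θi₋ (trans (+-congʳ α≈0) (+-identityˡ _)))) eq)

    module _ {Δ : ℕ} (1<Δ : 1 ℕ.< Δ) (sqf : SquareFree Δ) {√Δ : Carrier} (isSqrt : IsSqrt (fromℕ Δ) √Δ)
      {α β : Carrier} (ratα : Rational α) (ratβ : Rational β) (0<β : 0# < β) (α≉0 : ¬ α ≈ 0#)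
      (θ₀≈ : θ₀ ≈ α) (θ₊≈ : θ₊ ≈ α + β * √Δ) (θ₋≈ : θ₋ ≈ α - β * √Δ) where

      open Quadratic 1<Δ sqf isSqrt
      open Power ratα ratβ 0<β

      -- The phases τ(θ±ᵏ - αᵏ) are integer multiples Z± π, so that
      -- Z₊(θ₋ᵏ - αᵏ) = Z₋(θ₊ᵏ - αᵏ); comparing coefficients of √Δ gives
      -- Z₋ = -Z₊, and then the rational parts give A k = αᵏ.
      no-transfer : ∀ k → ¬ PST (M ^ᴹ suc (suc k)) a b
      no-transfer k′ (τ , pst) = A≉α^ α≉0 k′ (x-y≈0⇒x≈y A-αᵏ≈0)
        where
        k : ℕ
        k = suc (suc k′)
        κ : Fin size → Carrier
        κ i = θ i ^ k
        phases : (cos (τ * κ i₊ - τ * κ i₀) ≈ - 1#) × (cos (τ * κ i₋ - τ * κ i₀) ≈ - 1#)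
        phases = PSTAt⇒phase-π (ActsBy-M^ k) pst
        integer₊ : ∃[ z ] τ * κ i₊ - τ * κ i₀ ≈ fromℤ′ z * π
        integer₊ = sin≈0⇒ℤπ (cos≈-1⇒sin≈0 (proj₁ phases))
        integer₋ : ∃[ z ] τ * κ i₋ - τ * κ i₀ ≈ fromℤ′ z * π
        integer₋ = sin≈0⇒ℤπ (cos≈-1⇒sin≈0 (proj₂ phases))
        Z₊ Z₋ x y : Carrier
        Z₊ = fromℤ′ (proj₁ integer₊)
        Z₋ = fromℤ′ (proj₁ integer₋)
        x = A k - α ^ k
        y = B k
        κ₀≈ : κ i₀ ≈ α ^ k
        κ₀≈ = ^-congˡ k (trans (proj₁ (proj₂ sign₀)) θ₀≈)
        κ₊≈ : κ i₊ ≈ A k + B k * √Δ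
        κ₊≈ = trans (^-congˡ k (trans (proj₁ (proj₂ sign₊)) θ₊≈)) (power √Δ (proj₂ isSqrt) k)
        κ₋≈ : κ i₋ ≈ A k + B k * - √Δ
        κ₋≈ = trans (^-congˡ k (trans (proj₁ (proj₂ sign₋)) (trans θ₋≈ (+-congˡ (-‿distribʳ-* β √Δ)))))
          (power (- √Δ) (trans (solve 1 (λ d → :- d :* :- d := d :* d) refl √Δ) (proj₂ isSqrt)) k)
        phase₊ : τ * (x + y * √Δ) ≈ Z₊ * π
        phase₊ = trans (sym (trans (+-cong (*-congˡ κ₊≈) (-‿cong (*-congˡ κ₀≈)))
          (solve 5 (λ t a b d p → t :* (a :+ b :* d) :- t :* p := t :* (a :- p :+ b :* d)) refl τ (A k) (B k) √Δ (α ^ k)))) (proj₂ integer₊)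
        phase₋ : τ * (x - y * √Δ) ≈ Z₋ * π
        phase₋ = trans (sym (trans (+-cong (*-congˡ κ₋≈) (-‿cong (*-congˡ κ₀≈)))
          (solve 5 (λ t a b d p → t :* (a :+ b :* :- d) :- t :* p := t :* (a :- p :- b :* d)) refl τ (A k) (B k) √Δ (α ^ k)))) (proj₂ integer₋)
        relation : (Z₊ - Z₋) * x + - ((Z₊ + Z₋) * y) * √Δ ≈ 0#
        relation = x*y≈0⇒y≈0 (>⇒≉ (proj₁ pst)) (begin
          τ * ((Z₊ - Z₋) * x + - ((Z₊ + Z₋) * y) * √Δ)
            ≈⟨ solve 6 (λ t p q x y d → t :* ((p :- q) :* x :+ :- ((p :+ q) :* y) :* d)
                 := p :* (t :* (x :- y :* d)) :- q :* (t :* (x :+ y :* d))) refl τ Z₊ Z₋ x y √Δ ⟩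
          Z₊ * (τ * (x - y * √Δ)) - Z₋ * (τ * (x + y * √Δ))
            ≈⟨ +-cong (*-congˡ phase₋) (-‿cong (*-congˡ phase₊)) ⟩
          Z₊ * (Z₋ * π) - Z₋ * (Z₊ * π)
            ≈⟨ solve 3 (λ p q r → p :* (q :* r) :- q :* (p :* r) := :0) refl Z₊ Z₋ π ⟩
          0# ∎)
        Z-rational : Rational Z₊ × Rational Z₋
        Z-rational = ℤ-rational (proj₁ integer₊) , ℤ-rational (proj₁ integer₋)
        Z₊+Z₋≈0 : Z₊ + Z₋ ≈ 0#
        Z₊+Z₋≈0 = x*y≈0⇒y≈0 (B≉0 α≉0 (suc k′)) (trans (*-comm _ _) (trans (sym (-‿involutive _)) (trans (-‿cong
          (irrational
            (rational-* (rational-+ (proj₁ Z-rational) (rational-neg (proj₂ Z-rational)))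
                (rational-+ (A-rational k) (rational-neg (rational-^ ratα k))))
            (rational-neg (rational-* (rational-+ (proj₁ Z-rational) (proj₂ Z-rational)) (B-rational k)))
            relation)) -0#≈0#)))
        -- The integers were obtained from the vanishing of the sine alone. The value -1 of the
        -- cosine now excludes 0, where the cosine is 1.
        Z₊≉0 : ¬ Z₊ ≈ 0#
        Z₊≉0 Z₊≈0 = >⇒≉ (<-trans (by< 0<1 (solve 0 (:1 := :0 :- :- :1) refl)) 0<1)
          (trans (sym cos-0) (trans (cos-cong (sym (trans (proj₂ integer₊) (trans (*-congʳ Z₊≈0) (zeroˡ π))))) (proj₁ phases)))
        A-αᵏ≈0 : x ≈ 0#
        A-αᵏ≈0 = x*y≈0⇒y≈0 (*-≉0 (>⇒≉ 0<2) Z₊≉0) (begin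
          2# * Z₊ * x
            ≈⟨ solve 5 (λ p q x y d → :2 :* p :* x := (p :- q) :* x :+ :- ((p :+ q) :* y) :* d :+ (p :+ q) :* (x :+ y :* d)) refl Z₊ Z₋ x y √Δ ⟩
          (Z₊ - Z₋) * x + - ((Z₊ + Z₋) * y) * √Δ + (Z₊ + Z₋) * (x + y * √Δ)
            ≈⟨ +-cong relation (trans (*-congʳ Z₊+Z₋≈0) (zeroˡ _)) ⟩
          0# + 0# ≈⟨ +-identityˡ 0# ⟩
          0# ∎)

theorem6p1 :
  ∀ {c ℓ₁ ℓ₂} (ℝ : RealField c ℓ₁ ℓ₂) → let open Real ℝ in
  ∀ (n : ℕ) (M : Matrix n) → Symmetric M →
  ∀ (D : SpectralDecomposition M) (a b : Fin n) → a ≢ b →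
  StronglyCospectral D a b →
  ∀ (a₀ b₀ : ℚ) → 0ℚ ℚ.< b₀ →
  ∀ (Δ : ℕ) → 1 ℕ.< Δ → SquareFree Δ →
  ∀ (√Δ : Carrier) → IsSqrt (fromℕ Δ) √Δ →
  let θ₀ = fromℚ a₀
      θ₋ = fromℚ a₀ - fromℚ b₀ * √Δ
      θ₊ = fromℚ a₀ + fromℚ b₀ * √Δ
  in
  supp D (e a) ≐ (λ l → (l ≈ θ₋) ⊎ (l ≈ θ₀) ⊎ (l ≈ θ₊)) →
  ∀ (σ : Sign) → HasSign D a b θ₋ σ → HasSign D a b θ₊ σ →
  HasSign D a b θ₀ (opposite σ) →
  (a₀ ≡ 0ℚ → 𝒦 M a b ≐ ℕ⁺) ×
  (a₀ ≢ 0ℚ → (𝒦 M a b ≐ ｛ 1 ｝) ×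
    (∃[ π ] IsPi π × IsLeast (PSTAt M a b) (π * (fromℚ b₀ * √Δ) ⁻¹)))
theorem6p1 ℝ n M symM D a b _ cospectral a₀ b₀ 0<b₀ Δ 1<Δ sqf √Δ isSqrt support σ sign₋ sign₊ sign₀ =
    (λ a₀≡0 → proj₁ , λ { {suc k} 1≤k → 1≤k , transfer-power (trans (reflexive (≡.cong fromℚ a₀≡0)) (zeroˡ _)) k })
  , (λ a₀≢0 →
        ( (λ { {suc zero} _ → ≡.refl
             ; {suc (suc k)} (_ , pst) → contradiction pst
                 (no-transfer 1<Δ sqf isSqrt (ℚ-rational a₀) (ℚ-rational b₀) (0<fromℚ b₀ 0<b₀) (fromℚ≉0 a₀≢0) refl refl refl k) })
        , λ { ≡.refl → ℕ.s≤s ℕ.z≤n , _ , transfer (ActsBy-M^ 1) (λ i → *-identityʳ _) })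
      , π , π-isPi , transfer {M} {θ} id (λ _ → refl) , minimal)
  where
  open Real ℝ
  open Development ℝ
  open SpectralDecomposition D using (θ)
  open Spectral symM D
  open Transfer symM D cospectral support σ sign₋ sign₊ sign₀
  open Spacing {fromℚ a₀} {fromℚ b₀} {√Δ} refl refl refl (*-pos (0<fromℚ b₀ 0<b₀) (Quadratic.0<√Δ 1<Δ sqf isSqrt))
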